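{- Let $\Sigma$ be a finite alphabet and let $f:\Sigma^*\to\Sigma^*$ be a bijection. Then $f$ is a Two-way bijection if and only if ForNo computes $f$ with zero-garbage, i.e. there exist a ForNo term $T$, registers $\mathrm{in},\mathrm{out}$ of $T$ and an encoding $\langle\!\langle\cdot\rangle\!\rangle$ such that $T$ computes $f$ with zero-garbage.
   Context: Honest / Two-way bijection: a bijection $f$ is Honest if there is a polynomial $q$ with $|x|\le q(|f(x)|)$ for all $x$. A bijection $f$ is a Two-way bijection if both $f$ and $f^{ -1}$ are Honest and in FPTIME (computable by a deterministic Turing machine in time polynomial in the input length). Stacks and states: stacks are finite lists of natural numbers, $[\,]$ empty, $n::t$ has top $n$; $|s|$ is the length. Registers come from a countable set. A store $\phi$ maps every register to a stack; $\varnothing$ maps every register to $[\,]$, and $\phi[x\to s]$ updates $x$. A state is a pair $(\phi,c)$ with $c\in\mathbb N$ an error counter; $(\phi,0)$ is called sound; $\omega(x)$ denotes $\phi(x)$ for $\omega=(\phi,c)$. Raw terms (start symbol $T$, $n\in\mathbb N$, $x,y$ registers): $T ::= A \mid T;T \mid \mathtt{IF}\ x = n\ \{T\} \mid \mathtt{NORMAL}\ N\ \{S\}$; $N ::= y \mid y,N$; $A ::= \mathtt{SKIP}\mid \mathtt{PUSH}[n]\ x \mid \mathtt{POP}[n]\ x$; $S ::= A \mid S;S \mid \mathtt{IF}\ x=n\ \{S\} \mid \mathtt{FOR}\ x\ C \mid \mathtt{ROF}\ x\ C$; $C ::= \{S\} \mid \{S\}\ C$. $\mathtt{PUSH}/\mathtt{POP}$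 "write" their register; $x$ "leads" $\mathtt{IF}\ x=n$, $\mathtt{FOR}\ x$, $\mathtt{ROF}\ x$. ForNo is the set of raw terms generated from $T$ such that: (i) if $x$ leads a selection or iteration with bodies $S_1,\dots,S_k$, no atomic term in these bodies writes $x$; (ii) the registers listed in $N$ of $\mathtt{NORMAL}\ N\ \{S\}$ are not written in $S$ and are the only registers that can lead iterations in $S$. Semantics (big-step, judgments $\langle T,\omega\rangle\Downarrow\omega'$): $\mathtt{SKIP}$ leaves the state unchanged; $T;U$ runs $T$ then $U$; $\mathtt{PUSH}[n]\ x$ on $(\phi,c)$ yields $(\phi[x\to s],c')$ where $\mathrm{push}_n(\phi(x),c)=(s,c')$, and $\mathtt{POP}[n]\ x$ likewise with $\mathrm{pop}_n$; here $\mathrm{push}_n,\mathrm{pop}_n:\mathcal S\times\mathbb N\to\mathcal S\times\mathbb N$ are fixed, mutually inverse total functions with $\mathrm{push}_n(s,0)=(n::s,0)$, $\mathrm{pop}_n(n::s,0)=(s,0)$, and if the top of $s$ is not $n$ (e.g. $s=1::[\,]$, $n=0$) then $\mathrm{pop}_n(s,0)=(s,1)$ (the counter records failed pops). $\mathtt{IF}\ x=n\ \{P\}$ runs $P$ if $\omega(x)$ is nonempty with top $n$, otherwise does nothing. $\mathtt{FOR}\ x\ \{P_0\}\dots\{P_k\}$ takes the stack $\omega(x)$ at entry and, for each of its elements $i$ in order from the top down, runs $P_{\min(i,k)}$ (so exactly $|\omega(x)|$ steps); $\mathtt{ROF}$ does the same on the reversal of $\omega(x)$. $\mathtt{NORMAL}\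 N\ \{T\}$ runs $T$. Encoding and computation: an encoding is a bijection $\langle\!\langle\cdot\rangle\!\rangle:\Sigma\to\{0,\dots,|\Sigma|-1\}$, extended to strings by $\langle\!\langle\epsilon\rangle\!\rangle=[\,]$, $\langle\!\langle a\cdot x\rangle\!\rangle=\langle\!\langle a\rangle\!\rangle::\langle\!\langle x\rangle\!\rangle$. A term $T$ with registers $\mathrm{in},\mathrm{out}$ (not necessarily distinct) computes a total $f:\Sigma^*\to\Sigma^*$ if for every $x\in\Sigma^*$ there is $\phi$ with $\langle T,(\varnothing[\mathrm{in}\to\langle\!\langle x\rangle\!\rangle],0)\rangle\Downarrow(\phi,0)$ and $\phi(\mathrm{out})=\langle\!\langle f(x)\rangle\!\rangle$; it computes $f$ with zero-garbage if additionally $\phi(y)=[\,]$ for every register $y\neq\mathrm{out}$. -}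

module Defs where

open import Data.Nat using (ℕ; zero; suc; _+_; _*_; _≤_; _≟_)
open import Data.Fin using (Fin; zero; suc; toℕ; _↑ˡ_; splitAt)
open import Data.List using (List; []; _∷_; map; length; reverse)
open import Data.List.NonEmpty using (List⁺; toList)
open import Data.List.Membership.Propositional using (_∈_; _∉_)
open import Data.List.Relation.Unary.All using (All)
open import Data.Maybe using (Maybe; just; nothing)
open import Data.Product using (Σ; _×_; _,_; ∃; ∃-syntax)
open import Data.Sum using (_⊎_; inj₁; inj₂)
open import Data.Unit using (⊤)
open import Relation.Nullary using (¬_; yes; no)
open import Relation.Binary.PropositionalEquality using (_≡_; _≢_)
open import Function.Bundles using (Inverse; _↔_)

data Poly : Set where
  var : Poly
  con : ℕ → Poly
  _⊕_ : Poly → Poly → Poly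
  _⊗_ : Poly → Poly → Poly

⟦_⟧ : Poly → ℕ → ℕ
⟦ var ⟧ n = n
⟦ con c ⟧ n = c
⟦ p ⊕ q ⟧ n = ⟦ p ⟧ n + ⟦ q ⟧ n
⟦ p ⊗ q ⟧ n = ⟦ p ⟧ n * ⟦ q ⟧ n

-- Deterministic single-tape Turing machines over the alphabet Fin k.
-- Tape alphabet: Fin (suc (k + e)); zero is the blank, suc (inject+ e a)
-- is the input symbol a, the remaining e symbols are auxiliary.

data Move : Set where
  L R S : Move

record TM (k : ℕ) : Set where
  field
    nQ : ℕ      -- states are Fin (suc nQ); the start state is zero
    e  : ℕ      -- number of auxiliary tape symbols
    -- nothing = halt
    δ  : Fin (suc nQ) → Fin (suc (k + e)) →
         Maybe (Fin (suc nQ) × Fin (suc (k + e)) × Move)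

module _ {k : ℕ} (M : TM k) where
  open TM M

  Γ : Set
  Γ = Fin (suc (k + e))

  blank : Γ
  blank = zero

  sym : Fin k → Γ
  sym a = suc (a ↑ˡ e)

  unsym : Γ → Maybe (Fin k)
  unsym zero = nothing
  unsym (suc i) with splitAt k i
  ... | inj₁ a = just a
  ... | inj₂ _ = nothing

  -- configuration: state, left part (nearest cell first), scanned cell, right part
  record Config : Set where
    constructor cfg
    field
      state : Fin (suc nQ)
      left  : List Γ
      head  : Γ
      right : List Γ

  initial : List (Fin k) → Config
  initial []      = cfg zero [] blank []
  initial (a ∷ x) = cfg zero [] (sym a) (map sym x)

  readOut : List Γ → List (Fin k)
  readOut [] = []
  readOut (g ∷ gs) with unsym g
  ... | just a  = a ∷ readOut gs
  ... | nothing = []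

  output : Config → List (Fin k)
  output (cfg _ _ h r) = readOut (h ∷ r)

  apply : Fin (suc nQ) × Γ × Move → Config → Config
  apply (q , w , S) (cfg _ l _ r) = cfg q l w r
  apply (q , w , L) (cfg _ [] _ r) = cfg q [] blank (w ∷ r)
  apply (q , w , L) (cfg _ (g ∷ l) _ r) = cfg q l g (w ∷ r)
  apply (q , w , R) (cfg _ l _ []) = cfg q (w ∷ l) blank []
  apply (q , w , R) (cfg _ l _ (g ∷ r)) = cfg q (w ∷ l) g r

  run : ℕ → Config → Maybe (List (Fin k))
  run t c with δ (Config.state c) (Config.head c)
  run t c       | nothing = just (output c)
  run zero c    | just _  = nothing
  run (suc t) c | just tr = run t (apply tr c)

FPTIME : {k : ℕ} → (List (Fin k) → List (Fin k)) → Set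
FPTIME {k} f = Σ (TM k) λ M → Σ Poly λ p →
  ∀ x → run M (⟦ p ⟧ (length x)) (initial M x) ≡ just (f x)

Honest : {k : ℕ} → (List (Fin k) → List (Fin k)) → Set
Honest f = Σ Poly λ q → ∀ x → length x ≤ ⟦ q ⟧ (length (f x))

TwoWay : {k : ℕ} → (List (Fin k) ↔ List (Fin k)) → Set
TwoWay f = Honest (Inverse.to f) × FPTIME (Inverse.to f)
         × Honest (Inverse.from f) × FPTIME (Inverse.from f)

Reg : Set
Reg = ℕ

data Atom : Set where
  SKIP : Atom
  PUSH : ℕ → Reg → Atom
  POP  : ℕ → Reg → Atom

mutual
  data Body : Set where
    atom : Atom → Body
    _⨾_  : Body → Body → Body
    IF   : Reg → ℕ → Body → Body
    FOR  : Reg → Clauses → Body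
    ROF  : Reg → Clauses → Body

  data Clauses : Set where
    one  : Body → Clauses
    cons : Body → Clauses → Clauses

data Term : Set where
  atom   : Atom → Term
  _⨾_    : Term → Term → Term
  IF     : Reg → ℕ → Term → Term
  NORMAL : List⁺ Reg → Body → Term

writtenA : Atom → List Reg
writtenA SKIP = []
writtenA (PUSH n x) = x ∷ []
writtenA (POP n x) = x ∷ []

mutual
  writtenB : Body → List Reg
  writtenB (atom a) = writtenA a
  writtenB (s ⨾ t) = writtenB s Data.List.++ writtenB t
  writtenB (IF x n s) = writtenB s
  writtenB (FOR x c) = writtenC c
  writtenB (ROF x c) = writtenC c

  writtenC : Clauses → List Reg
  writtenC (one s) = writtenB s
  writtenC (cons s c) = writtenB s Data.List.++ writtenC c

writtenT : Term → List Reg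
writtenT (atom a) = writtenA a
writtenT (t ⨾ u) = writtenT t Data.List.++ writtenT u
writtenT (IF x n t) = writtenT t
writtenT (NORMAL N s) = writtenB s

mutual
  iterLeadersB : Body → List Reg
  iterLeadersB (atom a) = []
  iterLeadersB (s ⨾ t) = iterLeadersB s Data.List.++ iterLeadersB t
  iterLeadersB (IF x n s) = iterLeadersB s
  iterLeadersB (FOR x c) = x ∷ iterLeadersC c
  iterLeadersB (ROF x c) = x ∷ iterLeadersC c

  iterLeadersC : Clauses → List Reg
  iterLeadersC (one s) = iterLeadersB s
  iterLeadersC (cons s c) = iterLeadersB s Data.List.++ iterLeadersC c

mutual
  WfB : Body → Set
  WfB (atom a) = ⊤
  WfB (s ⨾ t) = WfB s × WfB t
  WfB (IF x n s) = x ∉ writtenB s × WfB s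
  WfB (FOR x c) = x ∉ writtenC c × WfC c
  WfB (ROF x c) = x ∉ writtenC c × WfC c

  WfC : Clauses → Set
  WfC (one s) = WfB s
  WfC (cons s c) = WfB s × WfC c

ForNo : Term → Set
ForNo (atom a) = ⊤
ForNo (t ⨾ u) = ForNo t × ForNo u
ForNo (IF x n t) = x ∉ writtenT t × ForNo t
ForNo (NORMAL N s) =
  All (λ y → y ∉ writtenB s) (toList N) ×
  All (λ y → y ∈ toList N) (iterLeadersB s) ×
  WfB s

Stack : Set
Stack = List ℕ

Store : Set
Store = Reg → Stack

∅ : Store
∅ _ = []

_[_↦_] : Store → Reg → Stack → Store
(φ [ x ↦ s ]) y with y ≟ x
... | yes _ = s
... | no  _ = φ y

State : Set
State = Store × ℕ

top : Stack → Maybe ℕ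
top [] = nothing
top (n ∷ _) = just n

-- Concrete mutually inverse push_n / pop_n:
--   pop_n (n::s, 0)   = (s, 0)
--   pop_n (n::s, c+1) = (n::s, c+1)
--   pop_n (s, c)      = (s, c+1)     if top s ≠ n
--   push_n (s, 0)     = (n::s, 0)
--   push_n (s, c+1)   = (s, c+1)     if top s = n
--   push_n (s, c+1)   = (s, c)       if top s ≠ n
pop : ℕ → Stack × ℕ → Stack × ℕ
pop n ([] , c) = [] , suc c
pop n (m ∷ s , c) with m ≟ n
pop n (m ∷ s , zero)  | yes _ = s , zero
pop n (m ∷ s , suc c) | yes _ = m ∷ s , suc c
... | no _ = m ∷ s , suc c

push : ℕ → Stack × ℕ → Stack × ℕ
push n (s , zero) = n ∷ s , zero
push n ([] , suc c) = [] , c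
push n (m ∷ s , suc c) with m ≟ n
... | yes _ = m ∷ s , suc c
... | no  _ = m ∷ s , c

atomStep : Atom → State → State
atomStep SKIP ω = ω
atomStep (PUSH n x) (φ , c) with push n (φ x , c)
... | s , c' = φ [ x ↦ s ] , c'
atomStep (POP n x) (φ , c) with pop n (φ x , c)
... | s , c' = φ [ x ↦ s ] , c'

select : Clauses → ℕ → Body
select (one s) i = s
select (cons s c) zero = s
select (cons s c) (suc i) = select c i

mutual
  data _⇓B_ : Body × State → State → Set where
    atom  : ∀ {a ω} → (atom a , ω) ⇓B atomStep a ω
    seq   : ∀ {s t ω ω' ω''} → (s , ω) ⇓B ω' → (t , ω') ⇓B ω'' →
            (s ⨾ t , ω) ⇓B ω''
    if-yes : ∀ {x n s ω ω'} → top (Data.Product.proj₁ ω x) ≡ just n →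
             (s , ω) ⇓B ω' → (IF x n s , ω) ⇓B ω'
    if-no  : ∀ {x n s ω} → top (Data.Product.proj₁ ω x) ≢ just n →
             (IF x n s , ω) ⇓B ω
    for   : ∀ {x c ω ω'} → Loop c (Data.Product.proj₁ ω x) ω ω' →
            (FOR x c , ω) ⇓B ω'
    rof   : ∀ {x c ω ω'} → Loop c (reverse (Data.Product.proj₁ ω x)) ω ω' →
            (ROF x c , ω) ⇓B ω'

  data Loop (c : Clauses) : Stack → State → State → Set where
    done : ∀ {ω} → Loop c [] ω ω
    step : ∀ {i is ω ω' ω''} → (select c i , ω) ⇓B ω' →
           Loop c is ω' ω'' → Loop c (i ∷ is) ω ω''

data _⇓_ : Term × State → State → Set where
  atom   : ∀ {a ω} → (atom a , ω) ⇓ atomStep a ω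
  seq    : ∀ {t u ω ω' ω''} → (t , ω) ⇓ ω' → (u , ω') ⇓ ω'' →
           (t ⨾ u , ω) ⇓ ω''
  if-yes : ∀ {x n t ω ω'} → top (Data.Product.proj₁ ω x) ≡ just n →
           (t , ω) ⇓ ω' → (IF x n t , ω) ⇓ ω'
  if-no  : ∀ {x n t ω} → top (Data.Product.proj₁ ω x) ≢ just n →
           (IF x n t , ω) ⇓ ω
  normal : ∀ {N s ω ω'} → (s , ω) ⇓B ω' → (NORMAL N s , ω) ⇓ ω'

-- an encoding Σ → {0,…,|Σ|-1} for Σ = Fin k is a permutation of Fin k
Encoding : ℕ → Set
Encoding k = Fin k ↔ Fin k

encode : {k : ℕ} → Encoding k → List (Fin k) → Stack
encode π = map (λ a → toℕ (Inverse.to π a))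

ComputesZG : {k : ℕ} → Term → Reg → Reg → Encoding k →
             (List (Fin k) → List (Fin k)) → Set
ComputesZG T inR outR π f = ∀ x → ∃[ φ ]
  ((T , (∅ [ inR ↦ encode π x ] , 0)) ⇓ (φ , 0)
   × φ outR ≡ encode π (f x)
   × (∀ y → y ≢ outR → φ y ≡ []))

ForNoComputesZG : {k : ℕ} → (List (Fin k) → List (Fin k)) → Set
ForNoComputesZG {k} f = ∃[ T ] (ForNo T × ∃[ inR ] ∃[ outR ]
  Σ (Encoding k) λ π → ComputesZG T inR outR π f)

{-# OPTIONS --safe #-}

-- ForNo to machines: a term whose stacks stay over a finite alphabet runs on one tape
-- with a track per register, a track for the error counter and a track per running loop
-- holding its position. Leaders of iterations are not written inside a NORMAL block, so
-- a block costs a polynomial in the sizes at its entry, and composing blocks composes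
-- polynomials. A term has an inverse term (PUSH/POP and FOR/ROF exchanged), which
-- handles f⁻¹; honesty holds since output length is bounded by input length plus time.
--
-- Machines to ForNo: nested FORs over the input give a clock running any polynomial
-- number of steps; each step is made reversible by logging the scanned symbol and state.
-- Compute, copy, uncompute turns a machine for f into a term C(f) : (x, []) ↦ (x, f x),
-- and C(f) followed by the inverse of C(f⁻¹) maps (x, []) to ([], f x).

module Submission where

open import Defs
open import Data.Bool using (Bool; true; false; if_then_else_; not)
open import Data.Nat using (ℕ; zero; suc; _+_; _*_; _^_; _≤_; _<_; _≟_; _≡ᵇ_; z≤n; s≤s)
open import Data.Nat.Properties
open import Data.Nat.Tactic.RingSolver using (solve-∀)
open import Data.Fin using (Fin; toℕ; fromℕ<; combine; remQuot; _↑ˡ_; _↑ʳ_; splitAt; funToFin; finToFun)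
open import Data.Fin.Properties using (splitAt-↑ˡ; splitAt-↑ʳ; finToFun-funToFin; toℕ-fromℕ<; fromℕ<-toℕ; toℕ<n; toℕ-injective; combine-injectiveʳ; remQuot-combine)
import Data.Fin.Properties as Fin
open import Data.List using (List; []; _∷_; _++_; map; length; reverse; _ʳ++_; replicate)
open import Data.List.Properties using (unfold-reverse; reverse-involutive; reverse-map; length-map; length-reverse; length-replicate; length-ʳ++; ʳ++-defn; map-∘; map-cong; map-++; map-replicate; ++-identityʳ)
open import Data.List.NonEmpty using (toList) renaming (_∷_ to _∷⁺_)
open import Data.List.Membership.Propositional using (_∈_; _∉_)
open import Data.List.Membership.Propositional.Properties using (∈-++⁺ˡ; ∈-++⁺ʳ; ∈-++⁻)
open import Data.List.Relation.Unary.All as All using (All; []; _∷_)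
open import Data.List.Relation.Unary.All.Properties using () renaming (++⁺ to All-++⁺)
open import Data.List.Relation.Unary.Any using (here; there)
open import Data.Maybe using (Maybe; just; nothing; maybe′)
open import Data.Maybe.Properties using (≡-dec; just-injective)
open import Data.Product using (Σ; _×_; _,_; ∃-syntax; proj₁; proj₂; map₁; uncurry)
open import Data.Sum using (_⊎_; inj₁; inj₂)
open import Data.Unit using (⊤; tt)
open import Function using (id; const; case_of_)
open import Function.Bundles using (Inverse; _↔_; _⇔_; mk⇔)
open import Function.Construct.Identity using (↔-id)
open import Relation.Nullary using (¬_; Dec; yes; no; contradiction)
open import Relation.Binary using (tri<; tri≈; tri>)
open import Relation.Binary.PropositionalEquality using (_≡_; _≢_; refl; trans; cong; cong₂; subst; _≗_; ≢-sym) renaming (sym to ≡-sym)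

-- Failed `POP`s do not block, they raise the error counter, so a computation with sound ends may
-- pass through unsound states. Hence both the inverse and the machine simulation are proved for
-- every value of the counter. On the machine side all stacks have their bottoms at a common end
-- marker. A cell is then a height, and it keeps this height whatever other stacks do. A loop
-- position is the height of one more stack, and a single kind of test suffices to compile terms:
-- which symbol does one stack have in the cell where another has its top? It decides selections
-- (both stacks equal), emptiness and the steps of loops. On the ForNo side two restrictions shape
-- the simulation. A selection tests for one given top symbol and says nothing of an empty stack, so
-- the half-tapes are padded with enough blanks for every step of the clock. The leader of a
-- selection is not written by its body, so taking a symbol off a stack needs two rounds of tests,
-- the second led by the register that received the symbol. Stores are functions without
-- extensionality, so states are compared register by register.

update-same : ∀ (φ : Store) x s → (φ [ x ↦ s ]) x ≡ s
update-same φ x s with x ≟ x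
... | yes _ = refl
... | no x≢x = contradiction refl x≢x

update-other : ∀ (φ : Store) {x y} s → y ≢ x → (φ [ x ↦ s ]) y ≡ φ y
update-other φ {x} {y} s y≢x with y ≟ x
... | yes y≡x = contradiction y≡x y≢x
... | no _ = refl

-- Interpreter

_≟ᵐ_ : (a b : Maybe ℕ) → Dec (a ≡ b)
_≟ᵐ_ = ≡-dec _≟_

loop : (ℕ → State → State) → Stack → State → State
loop f []       ω = ω
loop f (i ∷ is) ω = loop f is (f i ω)

when : ∀ {A : Set} → Dec A → State → State → State
when (yes _) ω ω' = ω
when (no _)  ω ω' = ω'

mutual
  evalB : Body → State → State
  evalB (atom a)   ω = atomStep a ω
  evalB (s ⨾ t)    ω = evalB t (evalB s ω)
  evalB (IF x n s) ω = when (top (proj₁ ω x) ≟ᵐ just n) (evalB s ω) ω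
  evalB (FOR x c)  ω = loop (evalC c) (proj₁ ω x) ω
  evalB (ROF x c)  ω = loop (evalC c) (reverse (proj₁ ω x)) ω

  evalC : Clauses → ℕ → State → State
  evalC (one s)    i       = evalB s
  evalC (cons s c) zero    = evalB s
  evalC (cons s c) (suc i) = evalC c i

evalT : Term → State → State
evalT (atom a)     ω = atomStep a ω
evalT (t ⨾ u)      ω = evalT u (evalT t ω)
evalT (IF x n t)   ω = when (top (proj₁ ω x) ≟ᵐ just n) (evalT t ω) ω
evalT (NORMAL N s) ω = evalB s ω

mutual
  ⇓B-evalB : ∀ s ω → (s , ω) ⇓B evalB s ω
  ⇓B-evalB (atom a) ω = atom
  ⇓B-evalB (s ⨾ t) ω = seq (⇓B-evalB s ω) (⇓B-evalB t _)
  ⇓B-evalB (IF x n s) ω with top (proj₁ ω x) ≟ᵐ just n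
  ... | yes p = if-yes p (⇓B-evalB s ω)
  ... | no ¬p = if-no ¬p
  ⇓B-evalB (FOR x c) ω = for (Loop-loop c _ ω)
  ⇓B-evalB (ROF x c) ω = rof (Loop-loop c _ ω)

  ⇓B-evalC : ∀ c i ω → (select c i , ω) ⇓B evalC c i ω
  ⇓B-evalC (one s) i ω = ⇓B-evalB s ω
  ⇓B-evalC (cons s c) zero ω = ⇓B-evalB s ω
  ⇓B-evalC (cons s c) (suc i) ω = ⇓B-evalC c i ω

  Loop-loop : ∀ c is ω → Loop c is ω (loop (evalC c) is ω)
  Loop-loop c [] ω = done
  Loop-loop c (i ∷ is) ω = step (⇓B-evalC c i ω) (Loop-loop c is _)

⇓-evalT : ∀ t ω → (t , ω) ⇓ evalT t ω
⇓-evalT (atom a) ω = atom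
⇓-evalT (t ⨾ u) ω = seq (⇓-evalT t ω) (⇓-evalT u _)
⇓-evalT (IF x n t) ω with top (proj₁ ω x) ≟ᵐ just n
... | yes p = if-yes p (⇓-evalT t ω)
... | no ¬p = if-no ¬p
⇓-evalT (NORMAL N s) ω = normal (⇓B-evalB s ω)

evalC-select : ∀ c i → evalC c i ≡ evalB (select c i)
evalC-select (one s) i = refl
evalC-select (cons s c) zero = refl
evalC-select (cons s c) (suc i) = evalC-select c i

mutual
  evalB-unique : ∀ {s ω ω'} → (s , ω) ⇓B ω' → evalB s ω ≡ ω'
  evalB-unique atom = refl
  evalB-unique (seq d e) rewrite evalB-unique d = evalB-unique e
  evalB-unique (if-yes {x} {n} {s} {ω} p d) with top (proj₁ ω x) ≟ᵐ just n
  ... | yes _ = evalB-unique d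
  ... | no ¬p = contradiction p ¬p
  evalB-unique (if-no {x} {n} {s} {ω} ¬p) with top (proj₁ ω x) ≟ᵐ just n
  ... | yes p = contradiction p ¬p
  ... | no _ = refl
  evalB-unique (for l) = loop-unique l
  evalB-unique (rof l) = loop-unique l

  loop-unique : ∀ {c is ω ω'} → Loop c is ω ω' → loop (evalC c) is ω ≡ ω'
  loop-unique done = refl
  loop-unique {c} (step {i} d l)
    rewrite evalC-select c i | evalB-unique d = loop-unique l

evalT-unique : ∀ {t ω ω'} → (t , ω) ⇓ ω' → evalT t ω ≡ ω'
evalT-unique atom = refl
evalT-unique (seq d e) rewrite evalT-unique d = evalT-unique e
evalT-unique (if-yes {x} {n} {t} {ω} p d) with top (proj₁ ω x) ≟ᵐ just n
... | yes _ = evalT-unique d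
... | no ¬p = contradiction p ¬p
evalT-unique (if-no {x} {n} {t} {ω} ¬p) with top (proj₁ ω x) ≟ᵐ just n
... | yes p = contradiction p ¬p
... | no _ = refl
evalT-unique (normal d) = evalB-unique d

-- Agreement of states on a set of registers

_≈[_]_ : State → (Reg → Set) → State → Set
ω ≈[ P ] ω' = (∀ y → P y → proj₁ ω y ≡ proj₁ ω' y) × proj₂ ω ≡ proj₂ ω'

All-regs : Reg → Set
All-regs _ = ⊤

infix 4 _≈_ _≈[_]_

_≈_ : State → State → Set
ω ≈ ω' = ω ≈[ All-regs ] ω'

≈-refl : ∀ {P ω} → ω ≈[ P ] ω
≈-refl = (λ _ _ → refl) , refl

≈-sym : ∀ {P ω ω'} → ω ≈[ P ] ω' → ω' ≈[ P ] ω
≈-sym (p , q) = (λ y py → ≡-sym (p y py)) , ≡-sym q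

≈-trans : ∀ {P ω ω' ω''} → ω ≈[ P ] ω' → ω' ≈[ P ] ω'' → ω ≈[ P ] ω''
≈-trans (p , q) (p' , q') = (λ y py → trans (p y py) (p' y py)) , trans q q'

≈-weaken : ∀ {P Q : Reg → Set} {ω ω'} → (∀ y → Q y → P y) → ω ≈[ P ] ω' → ω ≈[ Q ] ω'
≈-weaken Q⊆P (p , q) = (λ y qy → p y (Q⊆P y qy)) , q

module _ (P : Reg → Set) where

  RegsA : Atom → Set
  RegsA SKIP       = ⊤
  RegsA (PUSH n x) = P x
  RegsA (POP n x)  = P x

  mutual
    RegsB : Body → Set
    RegsB (atom a)   = RegsA a
    RegsB (s ⨾ t)    = RegsB s × RegsB t
    RegsB (IF x n s) = P x × RegsB s
    RegsB (FOR x c)  = P x × RegsC c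
    RegsB (ROF x c)  = P x × RegsC c

    RegsC : Clauses → Set
    RegsC (one s)    = RegsB s
    RegsC (cons s c) = RegsB s × RegsC c

  RegsT : Term → Set
  RegsT (atom a)     = RegsA a
  RegsT (t ⨾ u)      = RegsT t × RegsT u
  RegsT (IF x n t)   = P x × RegsT t
  RegsT (NORMAL N s) = RegsB s

module _ {P : Reg → Set} where

  update-cong : ∀ {φ φ' : Store} x {s s'} → (∀ y → P y → φ y ≡ φ' y) → s ≡ s' →
                ∀ y → P y → (φ [ x ↦ s ]) y ≡ (φ' [ x ↦ s' ]) y
  update-cong x φ≈φ' s≡s' y py with y ≟ x
  ... | yes _ = s≡s'
  ... | no _  = φ≈φ' y py

  atomStep-cong : ∀ a {ω ω'} → RegsA P a → ω ≈[ P ] ω' → atomStep a ω ≈[ P ] atomStep a ω'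
  atomStep-cong SKIP _ e = e
  atomStep-cong (PUSH n x) {φ , c} {φ' , .c} px (e , refl) =
    update-cong x e (cong (λ s → proj₁ (push n (s , c))) (e x px)) ,
    cong (λ s → proj₂ (push n (s , c))) (e x px)
  atomStep-cong (POP n x) {φ , c} {φ' , .c} px (e , refl) =
    update-cong x e (cong (λ s → proj₁ (pop n (s , c))) (e x px)) ,
    cong (λ s → proj₂ (pop n (s , c))) (e x px)

  when-cong : ∀ x n {ω ω' ν ν'} → P x → ω ≈[ P ] ω' → ν ≈[ P ] ν' →
    when (top (proj₁ ω x) ≟ᵐ just n) ν ω ≈[ P ] when (top (proj₁ ω' x) ≟ᵐ just n) ν' ω'
  when-cong x n {ω} {ω'} px e e' rewrite proj₁ e x px with top (proj₁ ω' x) ≟ᵐ just n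
  ... | yes _ = e'
  ... | no _  = e

  loop-cong : ∀ {f : ℕ → State → State} → (∀ i {ω ω'} → ω ≈[ P ] ω' → f i ω ≈[ P ] f i ω') →
    ∀ is {ω ω'} → ω ≈[ P ] ω' → loop f is ω ≈[ P ] loop f is ω'
  loop-cong fc [] e = e
  loop-cong fc (i ∷ is) e = loop-cong fc is (fc i e)

  mutual
    evalB-cong : ∀ s {ω ω'} → RegsB P s → ω ≈[ P ] ω' → evalB s ω ≈[ P ] evalB s ω'
    evalB-cong (atom a) r e = atomStep-cong a r e
    evalB-cong (s ⨾ t) (r , r') e = evalB-cong t r' (evalB-cong s r e)
    evalB-cong (IF x n s) (px , r) e = when-cong x n px e (evalB-cong s r e)
    evalB-cong (FOR x c) {ω} {ω'} (px , r) e rewrite proj₁ e x px =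
      loop-cong (λ i → evalC-cong c i r) (proj₁ ω' x) e
    evalB-cong (ROF x c) {ω} {ω'} (px , r) e rewrite proj₁ e x px =
      loop-cong (λ i → evalC-cong c i r) (reverse (proj₁ ω' x)) e

    evalC-cong : ∀ c i {ω ω'} → RegsC P c → ω ≈[ P ] ω' → evalC c i ω ≈[ P ] evalC c i ω'
    evalC-cong (one s) i r e = evalB-cong s r e
    evalC-cong (cons s c) zero (r , _) e = evalB-cong s r e
    evalC-cong (cons s c) (suc i) (_ , r) e = evalC-cong c i r e

  -- Registers outside `P` influence neither guards nor loop stacks nor the stacks in `P`. The case
  -- `P = (_≢ o)` lets an inverse term run on a store whose register `o` has changed in the
  -- meantime.
  evalT-cong : ∀ t {ω ω'} → RegsT P t → ω ≈[ P ] ω' → evalT t ω ≈[ P ] evalT t ω'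
  evalT-cong (atom a) r e = atomStep-cong a r e
  evalT-cong (t ⨾ u) (r , r') e = evalT-cong u r' (evalT-cong t r e)
  evalT-cong (IF x n t) (px , r) e = when-cong x n px e (evalT-cong t r e)
  evalT-cong (NORMAL N s) r e = evalB-cong s r e

module _ {P : Reg → Set} (all : ∀ x → P x) where

  regsA : ∀ a → RegsA P a
  regsA SKIP = tt
  regsA (PUSH n x) = all x
  regsA (POP n x) = all x

  mutual
    regsB : ∀ s → RegsB P s
    regsB (atom a) = regsA a
    regsB (s ⨾ t) = regsB s , regsB t
    regsB (IF x n s) = all x , regsB s
    regsB (FOR x c) = all x , regsC c
    regsB (ROF x c) = all x , regsC c

    regsC : ∀ c → RegsC P c
    regsC (one s) = regsB s
    regsC (cons s c) = regsB s , regsC c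

  regsT : ∀ t → RegsT P t
  regsT (atom a) = regsA a
  regsT (t ⨾ u) = regsT t , regsT u
  regsT (IF x n t) = all x , regsT t
  regsT (NORMAL N s) = regsB s

evalB-≈ : ∀ s {ω ω'} → ω ≈ ω' → evalB s ω ≈ evalB s ω'
evalB-≈ s = evalB-cong s (regsB (λ _ → tt) s)

evalC-≈ : ∀ c i {ω ω'} → ω ≈ ω' → evalC c i ω ≈ evalC c i ω'
evalC-≈ c i = evalC-cong c i (regsC (λ _ → tt) c)

evalT-≈ : ∀ t {ω ω'} → ω ≈ ω' → evalT t ω ≈ evalT t ω'
evalT-≈ t = evalT-cong t (regsT (λ _ → tt) t)

-- Unwritten registers

atomStep-unwritten : ∀ a {y ω} → y ∉ writtenA a → proj₁ (atomStep a ω) y ≡ proj₁ ω y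
atomStep-unwritten SKIP _ = refl
atomStep-unwritten (PUSH n x) {ω = φ , c} y∉ = update-other φ _ (λ e → y∉ (here e))
atomStep-unwritten (POP n x) {ω = φ , c} y∉ = update-other φ _ (λ e → y∉ (here e))

when-unwritten : ∀ {A : Set} (d : Dec A) {y ω ν} → proj₁ ν y ≡ proj₁ ω y → proj₁ (when d ν ω) y ≡ proj₁ ω y
when-unwritten (yes _) e = e
when-unwritten (no _) e = refl

loop-unwritten : ∀ {f : ℕ → State → State} {y} → (∀ i ω → proj₁ (f i ω) y ≡ proj₁ ω y) →
  ∀ is ω → proj₁ (loop f is ω) y ≡ proj₁ ω y
loop-unwritten fu [] ω = refl
loop-unwritten {f} fu (i ∷ is) ω = trans (loop-unwritten fu is (f i ω)) (fu i ω)

∉-++ˡ : ∀ {y : Reg} {xs ys} → y ∉ xs ++ ys → y ∉ xs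
∉-++ˡ y∉ y∈ = y∉ (∈-++⁺ˡ y∈)

∉-++ʳ : ∀ {y : Reg} xs {ys} → y ∉ xs ++ ys → y ∉ ys
∉-++ʳ xs y∉ y∈ = y∉ (∈-++⁺ʳ xs y∈)

mutual
  evalB-unwritten : ∀ s {y} ω → y ∉ writtenB s → proj₁ (evalB s ω) y ≡ proj₁ ω y
  evalB-unwritten (atom a) ω y∉ = atomStep-unwritten a {ω = ω} y∉
  evalB-unwritten (s ⨾ t) ω y∉ =
    trans (evalB-unwritten t _ (∉-++ʳ (writtenB s) y∉)) (evalB-unwritten s ω (∉-++ˡ y∉))
  evalB-unwritten (IF x n s) ω y∉ =
    when-unwritten (top (proj₁ ω x) ≟ᵐ just n) {ω = ω} (evalB-unwritten s ω y∉)
  evalB-unwritten (FOR x c) ω y∉ = loop-unwritten (λ i ω → evalC-unwritten c i ω y∉) (proj₁ ω x) ω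
  evalB-unwritten (ROF x c) ω y∉ = loop-unwritten (λ i ω → evalC-unwritten c i ω y∉) (reverse (proj₁ ω x)) ω

  evalC-unwritten : ∀ c i {y} ω → y ∉ writtenC c → proj₁ (evalC c i ω) y ≡ proj₁ ω y
  evalC-unwritten (one s) i ω y∉ = evalB-unwritten s ω y∉
  evalC-unwritten (cons s c) zero ω y∉ = evalB-unwritten s ω (∉-++ˡ y∉)
  evalC-unwritten (cons s c) (suc i) ω y∉ = evalC-unwritten c i ω (∉-++ʳ (writtenB s) y∉)

evalT-unwritten : ∀ t {y} ω → y ∉ writtenT t → proj₁ (evalT t ω) y ≡ proj₁ ω y
evalT-unwritten (atom a) ω y∉ = atomStep-unwritten a {ω = ω} y∉
evalT-unwritten (t ⨾ u) ω y∉ =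
  trans (evalT-unwritten u _ (∉-++ʳ (writtenT t) y∉)) (evalT-unwritten t ω (∉-++ˡ y∉))
evalT-unwritten (IF x n t) ω y∉ =
  when-unwritten (top (proj₁ ω x) ≟ᵐ just n) {ω = ω} (evalT-unwritten t ω y∉)
evalT-unwritten (NORMAL N s) ω y∉ = evalB-unwritten s ω y∉

-- Inverse terms

invA : Atom → Atom
invA SKIP       = SKIP
invA (PUSH n x) = POP n x
invA (POP n x)  = PUSH n x

mutual
  invB : Body → Body
  invB (atom a)   = atom (invA a)
  invB (s ⨾ t)    = invB t ⨾ invB s
  invB (IF x n s) = IF x n (invB s)
  invB (FOR x c)  = ROF x (invC c)
  invB (ROF x c)  = FOR x (invC c)

  -- Clauses keep their order: a clause is chosen by the symbol being visited, and what is reversed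
  -- is the order of the visits.
  invC : Clauses → Clauses
  invC (one s)    = one (invB s)
  invC (cons s c) = cons (invB s) (invC c)

invT : Term → Term
invT (atom a)     = atom (invA a)
invT (t ⨾ u)      = invT u ⨾ invT t
invT (IF x n t)   = IF x n (invT t)
invT (NORMAL N s) = NORMAL N (invB s)

∈-++-swap : ∀ {x : Reg} {xs ys xs' ys'} → (x ∈ xs' → x ∈ xs) → (x ∈ ys' → x ∈ ys) →
  x ∈ ys' ++ xs' → x ∈ xs ++ ys
∈-++-swap {xs = xs} {ys' = ys'} f g x∈ with ∈-++⁻ ys' x∈
... | inj₁ p = ∈-++⁺ʳ xs (g p)
... | inj₂ p = ∈-++⁺ˡ (f p)

∈-++-map : ∀ {x : Reg} {xs ys xs' ys'} → (x ∈ xs' → x ∈ xs) → (x ∈ ys' → x ∈ ys) →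
  x ∈ xs' ++ ys' → x ∈ xs ++ ys
∈-++-map {xs = xs} {xs' = xs'} f g x∈ with ∈-++⁻ xs' x∈
... | inj₁ p = ∈-++⁺ˡ (f p)
... | inj₂ p = ∈-++⁺ʳ xs (g p)

writtenA-inv : ∀ a {x} → x ∈ writtenA (invA a) → x ∈ writtenA a
writtenA-inv (PUSH n x) p = p
writtenA-inv (POP n x) p = p

mutual
  -- The conditions of `ForNo` survive when the sets of written registers and of leaders shrink, so
  -- one inclusion suffices.
  writtenB-inv : ∀ s {x} → x ∈ writtenB (invB s) → x ∈ writtenB s
  writtenB-inv (atom a) = writtenA-inv a
  writtenB-inv (s ⨾ t) = ∈-++-swap (writtenB-inv s) (writtenB-inv t)
  writtenB-inv (IF x n s) = writtenB-inv s
  writtenB-inv (FOR x c) = writtenC-inv c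
  writtenB-inv (ROF x c) = writtenC-inv c

  writtenC-inv : ∀ c {x} → x ∈ writtenC (invC c) → x ∈ writtenC c
  writtenC-inv (one s) = writtenB-inv s
  writtenC-inv (cons s c) = ∈-++-map (writtenB-inv s) (writtenC-inv c)

writtenT-inv : ∀ t {x} → x ∈ writtenT (invT t) → x ∈ writtenT t
writtenT-inv (atom a) = writtenA-inv a
writtenT-inv (t ⨾ u) = ∈-++-swap (writtenT-inv t) (writtenT-inv u)
writtenT-inv (IF x n t) = writtenT-inv t
writtenT-inv (NORMAL N s) = writtenB-inv s

mutual
  leadersB-inv : ∀ s {x} → x ∈ iterLeadersB (invB s) → x ∈ iterLeadersB s
  leadersB-inv (atom a) = λ ()
  leadersB-inv (s ⨾ t) = ∈-++-swap (leadersB-inv s) (leadersB-inv t)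
  leadersB-inv (IF x n s) = leadersB-inv s
  leadersB-inv (FOR x c) = ∈-++-map {xs = x ∷ []} {xs' = x ∷ []} (λ p → p) (leadersC-inv c)
  leadersB-inv (ROF x c) = ∈-++-map {xs = x ∷ []} {xs' = x ∷ []} (λ p → p) (leadersC-inv c)

  leadersC-inv : ∀ c {x} → x ∈ iterLeadersC (invC c) → x ∈ iterLeadersC c
  leadersC-inv (one s) = leadersB-inv s
  leadersC-inv (cons s c) = ∈-++-map (leadersB-inv s) (leadersC-inv c)

mutual
  WfB-inv : ∀ s → WfB s → WfB (invB s)
  WfB-inv (atom a) _ = tt
  WfB-inv (s ⨾ t) (w , w') = WfB-inv t w' , WfB-inv s w
  WfB-inv (IF x n s) (x∉ , w) = (λ p → x∉ (writtenB-inv s p)) , WfB-inv s w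
  WfB-inv (FOR x c) (x∉ , w) = (λ p → x∉ (writtenC-inv c p)) , WfC-inv c w
  WfB-inv (ROF x c) (x∉ , w) = (λ p → x∉ (writtenC-inv c p)) , WfC-inv c w

  WfC-inv : ∀ c → WfC c → WfC (invC c)
  WfC-inv (one s) w = WfB-inv s w
  WfC-inv (cons s c) (w , w') = WfB-inv s w , WfC-inv c w'

ForNo-inv : ∀ t → ForNo t → ForNo (invT t)
ForNo-inv (atom a) _ = tt
ForNo-inv (t ⨾ u) (w , w') = ForNo-inv u w' , ForNo-inv t w
ForNo-inv (IF x n t) (x∉ , w) = (λ p → x∉ (writtenT-inv t p)) , ForNo-inv t w
ForNo-inv (NORMAL N s) (N∉ , ⊆N , w) =
  All.map (λ y∉ p → y∉ (writtenB-inv s p)) N∉ ,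
  All.tabulate (λ p → All.lookup ⊆N (leadersB-inv s p)) ,
  WfB-inv s w

module _ {P : Reg → Set} where

  RegsA-inv : ∀ a → RegsA P a → RegsA P (invA a)
  RegsA-inv SKIP r = r
  RegsA-inv (PUSH n x) r = r
  RegsA-inv (POP n x) r = r

  mutual
    RegsB-inv : ∀ s → RegsB P s → RegsB P (invB s)
    RegsB-inv (atom a) r = RegsA-inv a r
    RegsB-inv (s ⨾ t) (r , r') = RegsB-inv t r' , RegsB-inv s r
    RegsB-inv (IF x n s) (p , r) = p , RegsB-inv s r
    RegsB-inv (FOR x c) (p , r) = p , RegsC-inv c r
    RegsB-inv (ROF x c) (p , r) = p , RegsC-inv c r

    RegsC-inv : ∀ c → RegsC P c → RegsC P (invC c)
    RegsC-inv (one s) r = RegsB-inv s r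
    RegsC-inv (cons s c) (r , r') = RegsB-inv s r , RegsC-inv c r'

  RegsT-inv : ∀ t → RegsT P t → RegsT P (invT t)
  RegsT-inv (atom a) r = RegsA-inv a r
  RegsT-inv (t ⨾ u) (r , r') = RegsT-inv u r' , RegsT-inv t r
  RegsT-inv (IF x n t) (p , r) = p , RegsT-inv t r
  RegsT-inv (NORMAL N s) r = RegsB-inv s r

-- Reversibility of the semantics

pop-push : ∀ n s c → pop n (push n (s , c)) ≡ (s , c)
pop-push n s zero with n ≟ n
... | yes _ = refl
... | no n≢n = contradiction refl n≢n
pop-push n [] (suc c) = refl
pop-push n (m ∷ s) (suc c) with m ≟ n in eq
... | yes _ rewrite eq = refl
... | no _ rewrite eq = refl

push-pop : ∀ n s c → push n (pop n (s , c)) ≡ (s , c)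
push-pop n [] c = refl
push-pop n (m ∷ s) c with m ≟ n in eq
push-pop n (m ∷ s) zero | yes refl = refl
push-pop n (m ∷ s) (suc c) | yes _ rewrite eq = refl
push-pop n (m ∷ s) c | no _ rewrite eq = refl

update-restore : ∀ (φ : Store) x {s s'} → s' ≡ φ x → ∀ y → ((φ [ x ↦ s ]) [ x ↦ s' ]) y ≡ φ y
update-restore φ x {s} e y with y ≟ x
... | yes refl = e
... | no y≢x = update-other φ s y≢x

atomStep-inv : ∀ a ω → atomStep (invA a) (atomStep a ω) ≈ ω
atomStep-inv SKIP ω = ≈-refl
atomStep-inv (PUSH n x) (φ , c)
  rewrite update-same φ x (proj₁ (push n (φ x , c))) | pop-push n (φ x) c =
  (λ y _ → update-restore φ x refl y) , refl
atomStep-inv (POP n x) (φ , c)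
  rewrite update-same φ x (proj₁ (pop n (φ x , c))) | push-pop n (φ x) c =
  (λ y _ → update-restore φ x refl y) , refl

loop-∷ʳ : ∀ (f : ℕ → State → State) is i ω → loop f (is ++ i ∷ []) ω ≡ f i (loop f is ω)
loop-∷ʳ f [] i ω = refl
loop-∷ʳ f (j ∷ is) i ω = loop-∷ʳ f is i (f j ω)

-- The last visit is undone first. The induction hypothesis restores the state after the first visit
-- only up to `≈`, hence the congruence required of `g`.
loop-inv : ∀ {f g : ℕ → State → State} → (∀ i {ω ω'} → ω ≈ ω' → g i ω ≈ g i ω') →
  (∀ i ω → g i (f i ω) ≈ ω) → ∀ is ω → loop g (reverse is) (loop f is ω) ≈ ω
loop-inv gc gf [] ω = ≈-refl
loop-inv {f} {g} gc gf (i ∷ is) ω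
  rewrite unfold-reverse i is | loop-∷ʳ g (reverse is) i (loop f is (f i ω)) =
  ≈-trans (gc i (loop-inv gc gf is (f i ω))) (gf i ω)

-- The body leaves the leader alone, so the guard has the same value when the selection is run
-- backwards.
when-inv : ∀ x n {ω} {f g : State → State} → proj₁ (f ω) x ≡ proj₁ ω x → g (f ω) ≈ ω →
  let ν = when (top (proj₁ ω x) ≟ᵐ just n) (f ω) ω in
  when (top (proj₁ ν x) ≟ᵐ just n) (g ν) ν ≈ ω
when-inv x n {ω} {f} e gf with top (proj₁ ω x) ≟ᵐ just n
... | no ¬p with top (proj₁ ω x) ≟ᵐ just n
...   | yes p = contradiction p ¬p
...   | no _ = ≈-refl
when-inv x n {ω} {f} e gf | yes p with top (proj₁ (f ω) x) ≟ᵐ just n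
...   | yes _ = gf
...   | no ¬p = contradiction (trans (cong top e) p) ¬p

mutual
  evalB-inv : ∀ s ω → WfB s → evalB (invB s) (evalB s ω) ≈ ω
  evalB-inv (atom a) ω w = atomStep-inv a ω
  evalB-inv (s ⨾ t) ω (w , w') =
    ≈-trans (evalB-≈ (invB s) (evalB-inv t (evalB s ω) w')) (evalB-inv s ω w)
  evalB-inv (IF x n s) ω (x∉ , w) =
    when-inv x n {f = evalB s} {g = evalB (invB s)} (evalB-unwritten s ω x∉) (evalB-inv s ω w)
  evalB-inv (FOR x c) ω (x∉ , w)
    -- The inverse loop reads its leader in the state after the loop; this must be the stack that
    -- drove the loop.
    rewrite loop-unwritten {evalC c} {x} (λ i ω → evalC-unwritten c i ω x∉) (proj₁ ω x) ω =
    loop-inv (λ i → evalC-≈ (invC c) i) (λ i ω → evalC-inv c i ω w) (proj₁ ω x) ω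
  evalB-inv (ROF x c) ω (x∉ , w)
    rewrite loop-unwritten {evalC c} {x} (λ i ω → evalC-unwritten c i ω x∉) (reverse (proj₁ ω x)) ω =
    subst (λ s → loop (evalC (invC c)) s (loop (evalC c) (reverse (proj₁ ω x)) ω) ≈ ω)
      (reverse-involutive (proj₁ ω x))
      (loop-inv (λ i → evalC-≈ (invC c) i) (λ i ω → evalC-inv c i ω w) (reverse (proj₁ ω x)) ω)

  evalC-inv : ∀ c i ω → WfC c → evalC (invC c) i (evalC c i ω) ≈ ω
  evalC-inv (one s) i ω w = evalB-inv s ω w
  evalC-inv (cons s c) zero ω (w , _) = evalB-inv s ω w
  evalC-inv (cons s c) (suc i) ω (_ , w) = evalC-inv c i ω w

evalT-inv : ∀ t ω → ForNo t → evalT (invT t) (evalT t ω) ≈ ω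
evalT-inv (atom a) ω w = atomStep-inv a ω
evalT-inv (t ⨾ u) ω (w , w') =
  ≈-trans (evalT-≈ (invT t) (evalT-inv u (evalT t ω) w')) (evalT-inv t ω w)
evalT-inv (IF x n t) ω (x∉ , w) =
  when-inv x n {f = evalT t} {g = evalT (invT t)} (evalT-unwritten t ω x∉) (evalT-inv t ω w)
evalT-inv (NORMAL N s) ω (_ , _ , w) = evalB-inv s ω w

-- Structured tape programs

data Prog (G : Set) : Set where
  act   : (G → G) → Move → Prog G
  _»_   : Prog G → Prog G → Prog G
  cond  : (G → Bool) → Prog G → Prog G → Prog G
  while : (G → Bool) → Prog G → Prog G

infixl 5 _»_

record Tape (G : Set) : Set where
  constructor tape
  field
    left  : List G
    head  : G
    right : List G

open Tape

module TapeMachine {G : Set} (b : G) where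

  moveTo : Move → G → Tape G → Tape G
  moveTo S w (tape l _ r)       = tape l w r
  moveTo L w (tape [] _ r)      = tape [] b (w ∷ r)
  moveTo L w (tape (g ∷ l) _ r) = tape l g (w ∷ r)
  moveTo R w (tape l _ [])      = tape (w ∷ l) b []
  moveTo R w (tape l _ (g ∷ r)) = tape (w ∷ l) g r

  -- The time index is exact, so that it becomes the length of a path through `control`: every test
  -- is a step of its own that leaves the cell and the head as they are.
  data Exec : Prog G → ℕ → Tape G → Tape G → Set where
    act        : ∀ {f m τ} → Exec (act f m) 1 τ (moveTo m (f (head τ)) τ)
    _»_        : ∀ {p q t u τ τ' τ''} → Exec p t τ τ' → Exec q u τ' τ'' →
                 Exec (p » q) (t + u) τ τ''
    cond-true  : ∀ {c p q t τ τ'} → c (head τ) ≡ true → Exec p t τ τ' →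
                 Exec (cond c p q) (suc t) τ τ'
    cond-false : ∀ {c p q t τ τ'} → c (head τ) ≡ false → Exec q t τ τ' →
                 Exec (cond c p q) (suc t) τ τ'
    while-stop : ∀ {c p τ} → c (head τ) ≡ false → Exec (while c p) 1 τ τ
    while-go   : ∀ {c p t u τ τ' τ''} → c (head τ) ≡ true → Exec p t τ τ' →
                 Exec (while c p) u τ' τ'' → Exec (while c p) (suc (t + u)) τ τ''

  -- Control graphs of tape programs

  Control : Set → Set
  Control A = A → G → Maybe A × G × Move

  data Path {A : Set} (δ : Control A) : ℕ → Maybe A → Tape G → Maybe A → Tape G → Set where
    stop : ∀ {o τ} → Path δ 0 o τ o τ
    next : ∀ {t s τ o' τ'} (let (o , g , m) = δ s (head τ)) →
           Path δ t o (moveTo m g τ) o' τ' → Path δ (suc t) (just s) τ o' τ'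

  Path-++ : ∀ {A} {δ : Control A} {t u o τ o' τ' o'' τ''} →
    Path δ t o τ o' τ' → Path δ u o' τ' o'' τ'' → Path δ (t + u) o τ o'' τ''
  Path-++ stop π' = π'
  Path-++ (next π) π' = next (Path-++ π π')

  -- Gluing of control graphs: leaving a component (`nothing`) becomes entering `e`, which is the
  -- next component, a loop test, or the exit of the whole program.
  reroute : ∀ {A B : Set} → (A → B) → Maybe B → Maybe A → Maybe B
  reroute ι e = maybe′ (λ s → just (ι s)) e

  Path-lift : ∀ {A B} {δ : Control A} {δ' : Control B} (ι : A → B) (e : Maybe B) →
    (∀ s g → δ' (ι s) g ≡ map₁ (reroute ι e) (δ s g)) →
    ∀ {t o τ o' τ'} → Path δ t o τ o' τ' → Path δ' t (reroute ι e o) τ (reroute ι e o') τ'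
  Path-lift ι e eq stop = stop
  Path-lift {δ' = δ'} ι e eq {o' = o'} {τ'} (next {t = t} {s = s} {τ = τ} π) =
    next (subst (λ (o , g , m) → Path δ' t o (moveTo m g τ) (reroute ι e o') τ')
      (≡-sym (eq s (head τ))) (Path-lift ι e eq π))

  Pos : Prog G → Set
  Pos (act f m)    = ⊤
  Pos (p » q)      = Pos p ⊎ Pos q
  Pos (cond c p q) = ⊤ ⊎ (Pos p ⊎ Pos q)
  Pos (while c p)  = ⊤ ⊎ Pos p

  entry : ∀ p → Pos p
  entry (act f m)    = tt
  entry (p » q)      = inj₁ (entry p)
  entry (cond c p q) = inj₁ tt
  entry (while c p)  = inj₁ tt

  control : ∀ p → Control (Pos p)
  control (act f m)    tt              g = nothing , f g , m
  control (p » q)      (inj₁ s)        g = map₁ (reroute inj₁ (just (inj₂ (entry q)))) (control p s g)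
  control (p » q)      (inj₂ s)        g = map₁ (reroute inj₂ nothing) (control q s g)
  control (cond c p q) (inj₁ tt)       g =
    just (inj₂ (if c g then inj₁ (entry p) else inj₂ (entry q))) , g , S
  control (cond c p q) (inj₂ (inj₁ s)) g = map₁ (reroute (λ s → inj₂ (inj₁ s)) nothing) (control p s g)
  control (cond c p q) (inj₂ (inj₂ s)) g = map₁ (reroute (λ s → inj₂ (inj₂ s)) nothing) (control q s g)
  control (while c p)  (inj₁ tt)       g = (if c g then just (inj₂ (entry p)) else nothing) , g , S
  control (while c p)  (inj₂ s)        g = map₁ (reroute inj₂ (just (inj₁ tt))) (control p s g)

  Exec⇒Path : ∀ {p t τ τ'} → Exec p t τ τ' → Path (control p) t (just (entry p)) τ nothing τ'
  Exec⇒Path act = next stop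
  Exec⇒Path {p » q} (d » e) =
    Path-++ (Path-lift inj₁ (just (inj₂ (entry q))) (λ _ _ → refl) (Exec⇒Path d))
            (Path-lift inj₂ nothing (λ _ _ → refl) (Exec⇒Path e))
  Exec⇒Path {cond c p q} {τ = τ} (cond-true eq d) =
    next (subst (λ v → Path (control (cond c p q)) _ (just (inj₂ (if v then inj₁ (entry p) else inj₂ (entry q)))) τ nothing _)
      (≡-sym eq) (Path-lift (λ s → inj₂ (inj₁ s)) nothing (λ _ _ → refl) (Exec⇒Path d)))
  Exec⇒Path {cond c p q} {τ = τ} (cond-false eq d) =
    next (subst (λ v → Path (control (cond c p q)) _ (just (inj₂ (if v then inj₁ (entry p) else inj₂ (entry q)))) τ nothing _)
      (≡-sym eq) (Path-lift (λ s → inj₂ (inj₂ s)) nothing (λ _ _ → refl) (Exec⇒Path d)))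
  Exec⇒Path {while c p} {τ = τ} (while-stop eq) =
    next (subst (λ v → Path (control (while c p)) _ (if v then just (inj₂ (entry p)) else nothing) τ nothing _)
      (≡-sym eq) stop)
  Exec⇒Path {while c p} {τ = τ} (while-go eq d e) =
    next (subst (λ v → Path (control (while c p)) _ (if v then just (inj₂ (entry p)) else nothing) τ nothing _)
      (≡-sym eq)
      (Path-++ (Path-lift inj₂ (just (inj₁ tt)) (λ _ _ → refl) (Exec⇒Path d)) (Exec⇒Path e)))

-- Symbol at height i (0 = bottom) of a stack, shifted by one; 0 above the top.
ht : Stack → ℕ → ℕ
ht []      i = 0
ht (a ∷ s) i with i ≟ length s
... | yes _ = suc a
... | no  _ = ht s i

ht-∷-same : ∀ a s → ht (a ∷ s) (length s) ≡ suc a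
ht-∷-same a s with length s ≟ length s
... | yes _ = refl
... | no ¬p = contradiction refl ¬p

ht-∷-other : ∀ a s {i} → i ≢ length s → ht (a ∷ s) i ≡ ht s i
ht-∷-other a s {i} i≢ with i ≟ length s
... | yes p = contradiction p i≢
... | no _ = refl

ht-above : ∀ s {i} → length s ≤ i → ht s i ≡ 0
ht-above [] _ = refl
ht-above (a ∷ s) {i} le = trans (ht-∷-other a s (>⇒≢ le)) (ht-above s (<⇒≤ le))

ht-below : ∀ s {i} → i < length s → ht s i ≢ 0
ht-below (a ∷ s) {i} (s≤s lt) eq with i ≟ length s
ht-below (a ∷ s) {i} (s≤s lt) () | yes _
... | no i≢ = ht-below s (≤∧≢⇒< lt i≢) eq

-- What track `t` holds in the cell of the top of `s`. With `s = t` this is the top symbol; with `s`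
-- a unary mark it is the entry of `t` at the marked position. In both cases 0 stands for absence.
topv : Stack → Stack → ℕ
topv []      t = 0
topv (_ ∷ s) t = ht t (length s)

≡ᵇ-refl : ∀ n → (n ≡ᵇ n) ≡ true
≡ᵇ-refl zero = refl
≡ᵇ-refl (suc n) = ≡ᵇ-refl n

≢⇒≡ᵇ-false : ∀ m n → m ≢ n → (m ≡ᵇ n) ≡ false
≢⇒≡ᵇ-false zero zero p = contradiction refl p
≢⇒≡ᵇ-false zero (suc n) p = refl
≢⇒≡ᵇ-false (suc m) zero p = refl
≢⇒≡ᵇ-false (suc m) (suc n) p = ≢⇒≡ᵇ-false m n (λ e → p (cong suc e))

-- Multitrack cells and the cost measure

record Multitrack (G : Set) (b : G) (M s : ℕ) : Set where
  field
    track           : G → ℕ → ℕ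
    set             : ℕ → ℕ → G → G
    end             : G
    isEnd           : G → Bool
    track-blank     : ∀ j → track b j ≡ 0
    track-end       : ∀ j → track end j ≡ 0
    track-set-same  : ∀ {j v} g → j < M → v ≤ s → track (set j v g) j ≡ v
    track-set-other : ∀ {i j} v g → i ≢ j → track (set j v g) i ≡ track g i
    isEnd-end       : isEnd end ≡ true
    isEnd-blank     : isEnd b ≡ false
    isEnd-set       : ∀ j v g → isEnd (set j v g) ≡ false

-- `N` counts elementary stack operations, `n` is the initial tape length. An operation adds at most
-- one cell, so all of them work on at most `n + N` cells. Walking to a height `h` and back takes
-- two machine steps per cell each way plus a constant, which stays below `8 * suc h`.
cost : ℕ → ℕ → ℕ
cost N n = N * (8 * suc (n + N))

cost-mono : ∀ {N N' n n'} → N ≤ N' → n ≤ n' → cost N n ≤ cost N' n'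
cost-mono p q = *-mono-≤ p (*-monoʳ-≤ 8 (s≤s (+-mono-≤ q p)))

-- The second part may start on a tape that is `N₁` cells longer; the summand `N` inside `cost`
-- absorbs this.
cost-+ : ∀ {N₁ N₂ n n₁ t₁ t₂} → t₁ ≤ cost N₁ n → n₁ ≤ n + N₁ → t₂ ≤ cost N₂ n₁ →
  t₁ + t₂ ≤ cost (N₁ + N₂) n
cost-+ {N₁} {N₂} {n} {n₁} p q r = ≤-trans (+-mono-≤ p r)
  (≤-trans (+-mono-≤ (*-monoʳ-≤ N₁ (*-monoʳ-≤ 8 (s≤s (+-monoʳ-≤ n (m≤m+n N₁ N₂)))))
                     (*-monoʳ-≤ N₂ (*-monoʳ-≤ 8 (s≤s (≤-trans (+-monoˡ-≤ N₂ q) (≤-reflexive (+-assoc n N₁ N₂)))))))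
    (≤-reflexive (≡-sym (*-distribʳ-+ (8 * suc (n + (N₁ + N₂))) N₁ N₂))))

cost-1 : ∀ {h n t} → h ≤ n → t ≤ 8 * suc h → t ≤ cost 1 n
cost-1 {h} {n} p q = ≤-trans q (≤-trans (*-monoʳ-≤ 8 (s≤s (≤-trans p (m≤m+n n 1)))) (m≤m+n _ 0))

⟦⟧-mono : ∀ p {m n} → m ≤ n → ⟦ p ⟧ m ≤ ⟦ p ⟧ n
⟦⟧-mono var le = le
⟦⟧-mono (con c) le = ≤-refl
⟦⟧-mono (p ⊕ q) le = +-mono-≤ (⟦⟧-mono p le) (⟦⟧-mono q le)
⟦⟧-mono (p ⊗ q) le = *-mono-≤ (⟦⟧-mono p le) (⟦⟧-mono q le)

_∘ₚ_ : Poly → Poly → Poly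
var     ∘ₚ q = q
con c   ∘ₚ q = con c
(p ⊕ r) ∘ₚ q = (p ∘ₚ q) ⊕ (r ∘ₚ q)
(p ⊗ r) ∘ₚ q = (p ∘ₚ q) ⊗ (r ∘ₚ q)

⟦∘ₚ⟧ : ∀ p q n → ⟦ p ∘ₚ q ⟧ n ≡ ⟦ p ⟧ (⟦ q ⟧ n)
⟦∘ₚ⟧ var q n = refl
⟦∘ₚ⟧ (con c) q n = refl
⟦∘ₚ⟧ (p ⊕ r) q n = cong₂ _+_ (⟦∘ₚ⟧ p q n) (⟦∘ₚ⟧ r q n)
⟦∘ₚ⟧ (p ⊗ r) q n = cong₂ _*_ (⟦∘ₚ⟧ p q n) (⟦∘ₚ⟧ r q n)

-- Upper bound for the registers, symbols and nesting depth occurring in a term.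

bndA : Atom → ℕ
bndA SKIP       = 0
bndA (PUSH n x) = suc n + suc x
bndA (POP n x)  = suc n + suc x

mutual
  bndB : Body → ℕ
  bndB (atom a)   = bndA a
  bndB (s ⨾ t)    = bndB s + bndB t
  bndB (IF x n s) = suc x + (suc n + bndB s)
  bndB (FOR x c)  = suc x + bndC c
  bndB (ROF x c)  = suc x + bndC c

  bndC : Clauses → ℕ
  bndC (one s)    = bndB s
  bndC (cons s c) = bndB s + bndC c

bndT : Term → ℕ
bndT (atom a)     = bndA a
bndT (t ⨾ u)      = bndT t + bndT u
bndT (IF x n t)   = suc x + (suc n + bndT t)
bndT (NORMAL N s) = bndB s

mutual
  -- The variable bounds the leaders of iterations, which are fixed within a block, so sums and
  -- products suffice. Per entry of its leader a loop pays for the body, a test and a change of the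
  -- mark, and two further operations to fill or clear the mark; this gives the inner 4.
  costB : Body → Poly
  costB (atom a)   = con 3
  costB (s ⨾ t)    = costB s ⊕ costB t
  costB (IF x n s) = con 2 ⊕ costB s
  costB (FOR x c)  = con 4 ⊕ (var ⊗ (con 4 ⊕ costC c))
  costB (ROF x c)  = con 5 ⊕ (var ⊗ (con 4 ⊕ costC c))

  costC : Clauses → Poly
  costC (one s)    = costB s
  costC (cons s c) = con 1 ⊕ (costB s ⊕ costC c)

-- Between blocks leaders may be written, so a later part is charged at the tape length that the
-- earlier part may leave behind. A selection adds one cell because its test can lengthen the tape.
costT : Term → Poly
costT (atom a)     = con 3
costT (t ⨾ u)      = costT t ⊕ (costT u ∘ₚ (var ⊕ costT t))
costT (IF x n t)   = con 2 ⊕ (costT t ∘ₚ (var ⊕ con 1))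
costT (NORMAL N s) = costB s

topv-self : ∀ s n → topv s s ≡ suc n → top s ≡ just n
topv-self (a ∷ s) n eq = cong just (suc-injective (trans (≡-sym (ht-∷-same a s)) eq))

topv-self⁻¹ : ∀ s n → top s ≡ just n → topv s s ≡ suc n
topv-self⁻¹ (a ∷ s) n eq = trans (ht-∷-same a s) (cong suc (just-injective eq))

-- The entries of s from height h upwards.
data Ascending (s : Stack) : ℕ → Stack → Set where
  []  : Ascending s (length s) []
  _∷_ : ∀ {h i is} → ht s h ≡ suc i → Ascending s (suc h) is → Ascending s h (i ∷ is)

reverse-ascending : ∀ s → Ascending s 0 (reverse s)
reverse-ascending s = go s [] (λ _ _ → refl)
  where
  go : ∀ u {is} → Ascending s (length u) is → (∀ j → j < length u → ht s j ≡ ht u j) →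
       Ascending s 0 (u ʳ++ is)
  go [] asc e = asc
  go (a ∷ u) asc e =
    go u (trans (e (length u) ≤-refl) (ht-∷-same a u) ∷ asc)
      (λ j j<u → trans (e j (<-trans j<u ≤-refl)) (ht-∷-other a u (<⇒≢ j<u)))

entry-at : Stack → ℕ → ℕ
entry-at []       j       = 0
entry-at (i ∷ is) zero    = suc i
entry-at (i ∷ is) (suc j) = entry-at is j

Ascending-at : ∀ {s' h is} → Ascending s' h is → ∀ j → ht s' (h + j) ≡ entry-at is j
Ascending-at {s'} [] j = ht-above s' (m≤m+n _ j)
Ascending-at {s'} {h} (e ∷ asc) zero = trans (cong (ht s') (+-identityʳ h)) e
Ascending-at {s'} {h} (e ∷ asc) (suc j) = trans (cong (ht s') (+-suc h j)) (Ascending-at asc j)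

round-cost : ∀ P n → suc (P + 1 + suc (n * (2 + P))) ≡ suc (suc n * (2 + P))
round-cost P n = cong suc (trans (cong (_+ suc (n * (2 + P))) (+-comm P 1)) (cong suc (+-suc P (n * (2 + P)))))

-- Stacks on a multitrack tape

module Tracks {G : Set} {b : G} {M s : ℕ} (T : Multitrack G b M s) where
  open Multitrack T public
  open TapeMachine {G} b public
  open Tape

  cellAt : List G → ℕ → G
  cellAt []      i       = b
  cellAt (g ∷ l) zero    = g
  cellAt (g ∷ l) (suc i) = cellAt l i

  NotEnd : G → Set
  NotEnd g = isEnd g ≡ false

  record Rep (l : List G) (σ : Store) : Set where
    constructor represents
    field
      content : ∀ j i → track (cellAt l i) j ≡ ht (σ j) i
      clean   : All NotEnd l

  Rep-≗ : ∀ {l σ σ'} → σ ≗ σ' → Rep l σ → Rep l σ'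
  Rep-≗ e (represents c n) = represents (λ j i → trans (c j i) (cong (λ s → ht s i) (e j))) n

  All-ʳ++ : ∀ {xs ys} → All NotEnd xs → All NotEnd ys → All NotEnd (xs ʳ++ ys)
  All-ʳ++ [] q = q
  All-ʳ++ (p ∷ ps) q = All-ʳ++ ps (p ∷ q)

  cellAt-ʳ++-cong : ∀ near {xs ys n} → (∀ j → j ≢ n → cellAt xs j ≡ cellAt ys j) →
    ∀ j → j ≢ length near + n → cellAt (near ʳ++ xs) j ≡ cellAt (near ʳ++ ys) j
  cellAt-ʳ++-cong [] e j j≢ = e j j≢
  cellAt-ʳ++-cong (x ∷ near) {n = n} e j j≢ =
    cellAt-ʳ++-cong near {n = suc n}
      (λ { zero _ → refl ; (suc i) i≢ → e i (λ eq → i≢ (cong suc eq)) })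
      j (λ eq → j≢ (trans eq (+-suc (length near) n)))

  cellAt-ʳ++ : ∀ near xs i → cellAt (near ʳ++ xs) (length near + i) ≡ cellAt xs i
  cellAt-ʳ++ [] xs i = refl
  cellAt-ʳ++ (x ∷ near) xs i =
    trans (cong (cellAt (near ʳ++ (x ∷ xs))) (≡-sym (+-suc (length near) i))) (cellAt-ʳ++ near (x ∷ xs) (suc i))

  cellAt-ʳ++-length : ∀ near g far → cellAt (near ʳ++ (g ∷ far)) (length near) ≡ g
  cellAt-ʳ++-length near g far =
    trans (cong (cellAt (near ʳ++ (g ∷ far))) (≡-sym (+-identityʳ _))) (cellAt-ʳ++ near (g ∷ far) 0)

  cellAt-beyond : ∀ l → cellAt l (length l) ≡ b
  cellAt-beyond [] = refl
  cellAt-beyond (g ∷ l) = cellAt-beyond l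

  -- Outside the written cells every track is empty, whereas a stack has a symbol at each height
  -- below its length. This later bounds all loop leaders by the tape length.
  height≤ : ∀ {l σ} → Rep l σ → ∀ j → length (σ j) ≤ length l
  height≤ {l} {σ} (represents c _) j with length (σ j) ≤? length l
  ... | yes p = p
  ... | no ¬p = contradiction
    (trans (≡-sym (c j (length l))) (trans (cong (λ g → track g j) (cellAt-beyond l)) (track-blank j)))
    (ht-below (σ j) (≰⇒> ¬p))

  -- The stacks grow to the left, away from the end marker under the resting head.
  rest : List G → List G → Tape G
  rest l r = tape l end r

  busy : ℕ → G → Bool
  busy i g = not (track g i ≡ᵇ 0)

  back : Prog G
  back = while (λ g → not (isEnd g)) (act id R)

  seek : ℕ → Prog G
  seek i = act id L » while (busy i) (act id L)

  -- The head stands at height `n`. It may have created one blank cell at the far end, so `same`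
  -- compares cells instead of lists and `short` allows one extra cell.
  record Standing (l r : List G) (n : ℕ) (τ : Tape G) : Set where
    constructor standing
    field
      near   : List G
      far    : List G
      cell   : G
      shape  : τ ≡ tape far cell (near ++ end ∷ r)
      length-near : length near ≡ n
      same   : ∀ j → cellAt (near ʳ++ (cell ∷ far)) j ≡ cellAt l j
      nearOK : All NotEnd near
      cellOK : NotEnd cell
      farOK  : All NotEnd far
      short  : length (near ʳ++ (cell ∷ far)) ≤ suc (length l)

  length-ʳ++-∷ : ∀ near (g : G) far → length (near ʳ++ (g ∷ far)) ≡ suc (length near + length far)
  length-ʳ++-∷ near g far = trans (length-ʳ++ near) (+-suc (length near) (length far))

  busy-true : ∀ {i g} → track g i ≢ 0 → busy i g ≡ true
  busy-true p = cong not (≢⇒≡ᵇ-false _ 0 p)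

  busy-false : ∀ {i g} → track g i ≡ 0 → busy i g ≡ false
  busy-false p = cong (λ v → not (v ≡ᵇ 0)) p

  walk : ∀ {i r l₀} n near g far →
    (∀ j → cellAt (near ʳ++ (g ∷ far)) j ≡ cellAt l₀ j) →
    All NotEnd near → NotEnd g → All NotEnd far →
    length (near ʳ++ (g ∷ far)) ≤ length l₀ →
    (∀ j → j < n → track (cellAt (g ∷ far) j) i ≢ 0) → track (cellAt (g ∷ far) n) i ≡ 0 →
    ∃[ τ ] (Exec (while (busy i) (act id L)) (suc (n * 2)) (tape far g (near ++ end ∷ r)) τ
            × Standing l₀ r (length near + n) τ)
  walk zero near g far same nOK gOK fOK len nz z =
    _ , while-stop (busy-false z) ,
    standing near far g refl (≡-sym (+-identityʳ _)) same nOK gOK fOK (≤-trans len (n≤1+n _))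
  walk {i} {r} {l₀} (suc n) near g (g' ∷ far) same nOK gOK (g'OK ∷ fOK) len nz z
    with walk {i} {r} {l₀} n (g ∷ near) g' far same (gOK ∷ nOK) g'OK fOK len (λ j j<n → nz (suc j) (s≤s j<n)) z
  ... | τ , d , st = τ , while-go (busy-true (nz 0 (s≤s z≤n))) act d ,
    subst (λ m → Standing l₀ r m τ) (≡-sym (+-suc (length near) n)) st
  -- The written cells are exhausted: the move creates a blank, whose empty tracks end the walk.
  walk {l₀ = l₀} (suc zero) near g [] same nOK gOK fOK len nz z =
    _ , while-go (busy-true (nz 0 (s≤s z≤n))) act (while-stop (busy-false (track-blank _))) ,
    standing (g ∷ near) [] b refl (+-comm 1 (length near))
      (λ j → trans (pad j) (same j)) (gOK ∷ nOK) isEnd-blank []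
      (≤-trans (≤-reflexive (trans (length-ʳ++ near) (trans (+-suc _ 1) (cong suc (≡-sym (length-ʳ++ near)))))) (s≤s len))
    where
    pad : ∀ j → cellAt (near ʳ++ (g ∷ b ∷ [])) j ≡ cellAt (near ʳ++ (g ∷ [])) j
    pad j with j ≟ length near + 1
    ... | yes refl = trans (cellAt-ʳ++ near (g ∷ b ∷ []) 1) (≡-sym (cellAt-ʳ++ near (g ∷ []) 1))
    ... | no j≢ = cellAt-ʳ++-cong near {n = 1}
      (λ { zero _ → refl ; (suc zero) j≢ → refl ; (suc (suc i)) _ → refl }) j j≢
  walk (suc (suc n)) near g [] same nOK gOK fOK len nz z =
    contradiction (track-blank _) (nz 1 (s≤s (s≤s z≤n)))

  seek-exec : ∀ {l σ} r i → Rep l σ →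
    ∃[ τ ] (Exec (seek i) (suc (suc (length (σ i) * 2))) (rest l r) τ × Standing l r (length (σ i)) τ)
  seek-exec {[]} {σ} r i rep with σ i | height≤ rep i
  ... | [] | z≤n = _ , act » while-stop (busy-false (track-blank i)) ,
    standing [] [] b refl refl (λ { zero → refl ; (suc j) → refl }) [] isEnd-blank [] ≤-refl
  seek-exec {g ∷ l} {σ} r i (represents c (gOK ∷ lOK))
    with walk {i} {r} {g ∷ l} (length (σ i)) [] g l (λ j → refl) [] gOK lOK ≤-refl
      (λ j j< eq → ht-below (σ i) j< (trans (≡-sym (c i j)) eq))
      (trans (c i (length (σ i))) (ht-above (σ i) ≤-refl))
  ... | τ , d , st = τ , act » d , st

  back-exec : ∀ near far g r → All NotEnd near → NotEnd g →
    Exec back (suc (suc (length near) * 2)) (tape far g (near ++ end ∷ r)) (rest (near ʳ++ (g ∷ far)) r)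
  back-exec [] far g r _ gOK =
    while-go (cong not gOK) act (while-stop (cong not isEnd-end))
  back-exec (x ∷ near) far g r (xOK ∷ nOK) gOK =
    while-go (cong not gOK) act (back-exec near (g ∷ far) x r nOK xOK)

  back-rest : ∀ l r → Exec back 1 (rest l r) (rest l r)
  back-rest l r = while-stop (cong not isEnd-end)

  put-back-exec : ∀ f near far g r → All NotEnd near →
    Exec (act f R » back) (suc (suc (length near * 2))) (tape far g (near ++ end ∷ r))
      (rest (near ʳ++ (f g ∷ far)) r)
  put-back-exec f [] far g r _ = act » back-rest (f g ∷ far) r
  put-back-exec f (x ∷ near) far g r (xOK ∷ nOK) = act » back-exec near (f g ∷ far) x r nOK xOK

  -- Common core of push and pop: the new stack differs from the old one only at height `n`, where
  -- push fills the first empty cell and pop writes 0 over the old top.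
  put : ∀ {l σ n i v} s' near cell far → length near ≡ n →
    (∀ j → cellAt (near ʳ++ (cell ∷ far)) j ≡ cellAt l j) →
    All NotEnd near → All NotEnd far → Rep l σ → i < M → v ≤ s →
    v ≡ ht s' n → (∀ j → j ≢ n → ht s' j ≡ ht (σ i) j) →
    Rep (near ʳ++ (set i v cell ∷ far)) (σ [ i ↦ s' ])
  put {l} {σ} {n} {i} {v} s' near cell far refl same nOK fOK (represents c _) i<M v≤s eq eqs =
    represents content (All-ʳ++ nOK (isEnd-set i v cell ∷ fOK))
    where
    l' = near ʳ++ (set i v cell ∷ far)

    elsewhere : ∀ m → m ≢ n → cellAt l' m ≡ cellAt l m
    elsewhere m m≢ = trans
      (cellAt-ʳ++-cong near {n = 0}
        (λ { zero p → contradiction refl p ; (suc j) _ → refl }) m (λ e → m≢ (trans e (+-identityʳ _))))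
      (same m)

    content : ∀ j m → track (cellAt l' m) j ≡ ht ((σ [ i ↦ s' ]) j) m
    content j m with j ≟ i | m ≟ n
    ... | yes refl | yes refl =
      trans (cong (λ g → track g j) (cellAt-ʳ++-length near _ far)) (trans (track-set-same cell i<M v≤s) eq)
    ... | yes refl | no m≢ =
      trans (cong (λ g → track g j) (elsewhere m m≢)) (trans (c j m) (≡-sym (eqs m m≢)))
    ... | no j≢ | yes refl =
      trans (cong (λ g → track g j) (cellAt-ʳ++-length near _ far))
        (trans (track-set-other v cell j≢)
          (trans (cong (λ g → track g j) (trans (≡-sym (cellAt-ʳ++-length near cell far)) (same m))) (c j m)))
    ... | no j≢ | no m≢ = trans (cong (λ g → track g j) (elsewhere m m≢)) (c j m)

  -- N bounds both the growth of the tape and, through cost, the running time.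
  Outcome : Prog G → ℕ → List G → Store → Set
  Outcome p N l σ' = ∀ r → ∃[ l' ] ∃[ t ]
    (Exec p t (rest l r) (rest l' r) × Rep l' σ' × length l' ≤ length l + N × t ≤ cost N (length l))

  Runs : Prog G → ℕ → Store → Store → Set
  Runs p N σ σ' = ∀ l → Rep l σ → Outcome p N l σ'

  Outcome-≤ : ∀ {p N N' l σ} → N ≤ N' → Outcome p N l σ → Outcome p N' l σ
  Outcome-≤ {l = l} le o r with o r
  ... | l' , t , d , rep , len , t≤ =
    l' , t , d , rep , ≤-trans len (+-monoʳ-≤ (length l) le) , ≤-trans t≤ (cost-mono {n = length l} le ≤-refl)

  Outcome-≗ : ∀ {p N l σ σ'} → σ ≗ σ' → Outcome p N l σ → Outcome p N l σ'
  Outcome-≗ e o r with o r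
  ... | l' , t , d , rep , rest = l' , t , d , Rep-≗ e rep , rest

  Outcome-» : ∀ {p q N₁ N₂ l σ₁ σ₂} → Outcome p N₁ l σ₁ →
    (∀ l₁ → Rep l₁ σ₁ → length l₁ ≤ length l + N₁ → Outcome q N₂ l₁ σ₂) →
    Outcome (p » q) (N₁ + N₂) l σ₂
  Outcome-» {N₁ = N₁} {N₂} {l} o o' r with o r
  ... | l₁ , t₁ , d₁ , rep₁ , len₁ , t₁≤ with o' l₁ rep₁ len₁ r
  ... | l₂ , t₂ , d₂ , rep₂ , len₂ , t₂≤ = l₂ , t₁ + t₂ , d₁ » d₂ , rep₂ ,
    ≤-trans len₂ (≤-trans (+-monoˡ-≤ N₂ len₁) (≤-reflexive (+-assoc (length l) N₁ N₂))) ,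
    cost-+ {N₁} {N₂} {length l} t₁≤ len₁ t₂≤

  Runs-≗ : ∀ {p N σ₁ σ₁' σ₂ σ₂'} → σ₁' ≗ σ₁ → σ₂ ≗ σ₂' → Runs p N σ₁ σ₂ → Runs p N σ₁' σ₂'
  Runs-≗ e e' ρ l rep = Outcome-≗ e' (ρ l (Rep-≗ e rep))

  Runs-≤ : ∀ {p N N' σ σ'} → N ≤ N' → Runs p N σ σ' → Runs p N' σ σ'
  Runs-≤ le ρ l rep = Outcome-≤ le (ρ l rep)

  Runs-» : ∀ {p q N₁ N₂ σ₁ σ₂ σ₃} → Runs p N₁ σ₁ σ₂ → Runs q N₂ σ₂ σ₃ → Runs (p » q) (N₁ + N₂) σ₁ σ₃
  Runs-» ρ ρ' l rep = Outcome-» (ρ l rep) (λ l₁ rep₁ _ → ρ' l₁ rep₁)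

  skip : Prog G
  skip = act id S

  skip-outcome : ∀ {l σ} → Rep l σ → Outcome skip 1 l σ
  skip-outcome {l} rep r = l , 1 , act , rep , m≤m+n _ 1 , cost-1 {0} {length l} z≤n (s≤s z≤n)

  pushP : ℕ → ℕ → Prog G
  pushP i a = seek i » (act (set i (suc a)) R » back)

  push-runs : ∀ {σ} i a → i < M → a < s → Runs (pushP i a) 1 σ (σ [ i ↦ a ∷ σ i ])
  push-runs {σ} i a i<M a<s l rep r with seek-exec r i rep
  ... | τ , d , standing near far cell refl refl-n same nOK cOK fOK short =
    near ʳ++ (set i (suc a) cell ∷ far) , _ ,
    d » put-back-exec (set i (suc a)) near far cell r nOK ,
    put (a ∷ σ i) near cell far refl-n same nOK fOK rep i<M a<s
      (≡-sym (ht-∷-same a (σ i))) (λ j j≢ → ht-∷-other a (σ i) j≢) ,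
    ≤-trans (≤-reflexive (trans (length-ʳ++-∷ near _ far) (≡-sym (length-ʳ++-∷ near cell far))))
      (≤-trans short (≤-reflexive (+-comm 1 (length l)))) ,
    cost-1 (height≤ rep i)
      (subst (λ n → suc (suc (length (σ i) * 2)) + suc (suc (n * 2)) ≤ 8 * suc (length (σ i))) (≡-sym refl-n)
        (≤-trans (m≤m+n _ (4 * length (σ i) + 4)) (≤-reflexive (arith (length (σ i))))))
    where
    arith : ∀ n → suc (suc (n * 2)) + suc (suc (n * 2)) + (4 * n + 4) ≡ 8 * suc n
    arith = solve-∀

  -- `seek` stops one cell above the top. One move to the right reaches the top, or, for an empty
  -- stack, the end marker, whose tracks all read 0.
  peekAt : ℕ → Prog G
  peekAt i = seek i » act id R

  popP : ℕ → Prog G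
  popP i = peekAt i » (act (set i 0) R » back)

  pop-runs : ∀ {σ} i a {s'} → i < M → σ i ≡ a ∷ s' → Runs (popP i) 1 σ (σ [ i ↦ s' ])
  pop-runs {σ} i a {s'} i<M eq l rep r with seek-exec r i rep
  ... | τ , d , standing [] far cell refl len-n same nOK cOK fOK short =
    contradiction (trans len-n (cong length eq)) λ ()
  ... | τ , d , standing (x ∷ near) far cell refl len-n same (xOK ∷ nOK) cOK fOK short =
    near ʳ++ (set i 0 x ∷ cell ∷ far) , _ ,
    (d » act) » put-back-exec (set i 0) near (cell ∷ far) x r nOK ,
    put s' near x (cell ∷ far) len-s same nOK (cOK ∷ fOK) rep i<M z≤n
      (≡-sym (ht-above s' ≤-refl))
      (λ j j≢ → trans (≡-sym (ht-∷-other a s' j≢)) (cong (λ u → ht u j) (≡-sym eq))) ,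
    ≤-trans (≤-reflexive (trans (length-ʳ++-∷ near _ (cell ∷ far)) (≡-sym (length-ʳ++-∷ near x (cell ∷ far)))))
      (≤-trans short (≤-reflexive (+-comm 1 (length l)))) ,
    cost-1 (height≤ rep i)
      (subst (λ n → suc (suc (length (σ i) * 2)) + 1 + suc (suc (length near * 2)) ≤ 8 * suc n) len-n
        (subst (λ n → suc (suc (n * 2)) + 1 + suc (suc (length near * 2)) ≤ 8 * suc (suc (length near))) len-n
        (≤-trans (m≤m+n _ (4 * length near + 9)) (≤-reflexive (arith (length near))))))
    where
    len-s : length near ≡ length s'
    len-s = suc-injective (trans len-n (cong length eq))

    arith : ∀ n → suc (suc (suc n * 2)) + 1 + suc (suc (n * 2)) + (4 * n + 9) ≡ 8 * suc (suc n)
    arith = solve-∀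

  -- The excursion is kept in two halves because a test is made between them; that test is the 1 in
  -- `time`.
  record Peek (l r : List G) (σ : Store) (i : ℕ) : Set where
    field
      pos       : Tape G
      t₁ t₂     : ℕ
      go        : Exec (peekAt i) t₁ (rest l r) pos
      l'        : List G
      return    : Exec back t₂ pos (rest l' r)
      rep'      : Rep l' σ
      length-l' : length l' ≤ length l + 1
      time      : t₁ + (1 + t₂) ≤ cost 1 (length l)
      value     : ∀ j → track (head pos) j ≡ topv (σ i) (σ j)

  peek : ∀ {l σ} r i → Rep l σ → Peek l r σ i
  peek {l} {σ} r i rep with seek-exec r i rep
  ... | τ , d , standing [] far cell refl len-n same nOK cOK fOK short = record
    { pos = rest (cell ∷ far) r ; go = d » act ; l' = cell ∷ far ; return = back-rest _ r
    ; rep' = represents (λ j m → trans (cong (λ g → track g j) (same m)) (Rep.content rep j m)) (cOK ∷ fOK)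
    ; length-l' = ≤-trans short (≤-reflexive (+-comm 1 (length l)))
    ; time = cost-1 {0} {length l} z≤n (subst (λ n → suc (suc (n * 2)) + 1 + 2 ≤ 8) len-n (m≤m+n 5 3))
    ; value = λ j → trans (track-end j) (≡-sym (empty (σ i) (≡-sym len-n) j)) }
    where
    empty : ∀ s' → length s' ≡ 0 → ∀ j → topv s' (σ j) ≡ 0
    empty [] _ j = refl
  ... | τ , d , standing (x ∷ near) far cell refl len-n same (xOK ∷ nOK) cOK fOK short = record
    { pos = tape (cell ∷ far) x (near ++ end ∷ r) ; go = d » act
    ; l' = near ʳ++ (x ∷ cell ∷ far) ; return = back-exec near (cell ∷ far) x r nOK xOK
    ; rep' = represents (λ j m → trans (cong (λ g → track g j) (same m)) (Rep.content rep j m)) (All-ʳ++ nOK (xOK ∷ cOK ∷ fOK))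
    ; length-l' = ≤-trans short (≤-reflexive (+-comm 1 (length l)))
    ; time = cost-1 (height≤ rep i)
        (subst (λ n → suc (suc (n * 2)) + 1 + suc (suc (suc (length near) * 2)) ≤ 8 * suc n) len-n
          (≤-trans (m≤m+n _ (4 * length near + 7)) (≤-reflexive (arith (length near)))))
    ; value = λ j → trans
        (trans (cong (λ g → track g j) (trans (≡-sym (cellAt-ʳ++-length near x (cell ∷ far))) (same (length near)))) (Rep.content rep j (length near)))
        (nonempty (σ i) (≡-sym len-n) j) }
    where
    arith : ∀ n → suc (suc (suc n * 2)) + 1 + suc (suc (suc n * 2)) + (4 * n + 7) ≡ 8 * suc (suc n)
    arith = solve-∀
    nonempty : ∀ s' → length s' ≡ suc (length near) → ∀ j → ht (σ j) (length near) ≡ topv s' (σ j)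
    nonempty (a ∷ s') eq j = cong (ht (σ j)) (≡-sym (suc-injective eq))

  is : ℕ → ℕ → G → Bool
  is j v g = track g j ≡ᵇ v

  branch : ℕ → ℕ → ℕ → Prog G → Prog G → Prog G
  branch i j v p q = peekAt i » cond (is j v) (back » p) (back » q)

  module _ {l : List G} {σ : Store} (i j v : ℕ) {p q : Prog G} {N : ℕ} {σ' : Store} (rep : Rep l σ) where

    branch-yes : topv (σ i) (σ j) ≡ v →
      (∀ l₁ → Rep l₁ σ → length l₁ ≤ length l + 1 → Outcome p N l₁ σ') →
      Outcome (branch i j v p q) (suc N) l σ'
    branch-yes eq o r with peek r i rep
    ... | P with o (Peek.l' P) (Peek.rep' P) (Peek.length-l' P) r
    ... | l₂ , t , d , rep₂ , len , t≤ = l₂ , _ ,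
      Peek.go P » cond-true (trans (cong (_≡ᵇ v) (trans (Peek.value P j) eq)) (≡ᵇ-refl v)) (Peek.return P » d) ,
      rep₂ , ≤-trans len (≤-trans (+-monoˡ-≤ N (Peek.length-l' P)) (≤-reflexive (+-assoc (length l) 1 N))) ,
      ≤-trans (≤-reflexive (≡-sym (+-assoc (Peek.t₁ P) (suc (Peek.t₂ P)) t)))
        (cost-+ {1} {N} {length l} (Peek.time P) (Peek.length-l' P) t≤)

    branch-no : topv (σ i) (σ j) ≢ v →
      (∀ l₁ → Rep l₁ σ → length l₁ ≤ length l + 1 → Outcome q N l₁ σ') →
      Outcome (branch i j v p q) (suc N) l σ'
    branch-no neq o r with peek r i rep
    ... | P with o (Peek.l' P) (Peek.rep' P) (Peek.length-l' P) r
    ... | l₂ , t , d , rep₂ , len , t≤ = l₂ , _ ,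
      Peek.go P » cond-false (trans (cong (_≡ᵇ v) (Peek.value P j)) (≢⇒≡ᵇ-false _ v neq)) (Peek.return P » d) ,
      rep₂ , ≤-trans len (≤-trans (+-monoˡ-≤ N (Peek.length-l' P)) (≤-reflexive (+-assoc (length l) 1 N))) ,
      ≤-trans (≤-reflexive (≡-sym (+-assoc (Peek.t₁ P) (suc (Peek.t₂ P)) t)))
        (cost-+ {1} {N} {length l} (Peek.time P) (Peek.length-l' P) t≤)

  -- The guard is read on the top of stack `i`, whereas `p` starts and ends with the head at rest;
  -- so each pass first goes back and at its end peeks again.
  repeat : ℕ → ℕ → Prog G → Prog G
  repeat i j p = (peekAt i » while (busy j) ((back » p) » peekAt i)) » back

  repeat-stop : ∀ {σ} i j {p} → topv (σ i) (σ j) ≡ 0 → Runs (repeat i j p) 1 σ σ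
  repeat-stop i j eq l rep r with peek r i rep
  ... | P = Peek.l' P , _ ,
    (Peek.go P » while-stop (busy-false (trans (Peek.value P j) eq))) » Peek.return P ,
    Peek.rep' P , Peek.length-l' P ,
    ≤-trans (≤-reflexive (+-assoc (Peek.t₁ P) 1 (Peek.t₂ P))) (Peek.time P)

  repeat-go : ∀ {σ σ₁ σ₂} i j {p N₁ N₂} → topv (σ i) (σ j) ≢ 0 → Runs p N₁ σ σ₁ →
    Runs (repeat i j p) N₂ σ₁ σ₂ → Runs (repeat i j p) (suc (N₁ + N₂)) σ σ₂
  repeat-go i j {N₁ = N₁} {N₂} neq ρ ρ' l rep r with peek r i rep
  ... | P with ρ (Peek.l' P) (Peek.rep' P) r
  ... | l₁ , t₁ , d₁ , rep₁ , len₁ , t₁≤ with ρ' l₁ rep₁ r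
  -- The remaining run is taken apart: its opening peek closes the first pass, and the rest
  -- continues the same loop.
  ... | l₂ , .(u + w + y) , (_»_ {t = .(u + w)} {u = y} (_»_ {t = u} {u = w} go' loop') back') , rep₂ , len₂ , t₂≤ = l₂ , _ ,
    (Peek.go P » while-go (busy-true (λ e → neq (trans (≡-sym (Peek.value P j)) e)))
      ((Peek.return P » d₁) » go') loop') » back' ,
    rep₂ ,
    ≤-trans len₂ (≤-trans (+-monoˡ-≤ N₂ (≤-trans len₁ (+-monoˡ-≤ N₁ (Peek.length-l' P))))
      (≤-reflexive (arith₁ (length l) N₁ N₂))) ,
    ≤-trans (≤-reflexive (arith₂ (Peek.t₁ P) (Peek.t₂ P) t₁ u w y))
      (cost-+ {1} {N₁ + N₂} {length l} (Peek.time P) (Peek.length-l' P)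
        (cost-+ {N₁} {N₂} {length (Peek.l' P)} t₁≤ len₁ t₂≤))
    where
    arith₁ : ∀ n a c → n + 1 + a + c ≡ n + suc (a + c)
    arith₁ = solve-∀
    arith₂ : ∀ a c t u w y → a + suc (c + t + u + w) + y ≡ (a + (1 + c)) + (t + (u + w + y))
    arith₂ = solve-∀

  -- Compiling ForNo terms to tape programs

  module Compile (m : ℕ) (m<M : m < M) (m≤s : m ≤ s) (0<s : 0 < s) where

    -- Track x < m holds register x, track m the error counter in unary, and the
    -- tracks above m hold μ, the unary positions of the running loops.
    layout : State → Store → Store
    layout (φ , c) μ j with <-cmp j m
    ... | tri< _ _ _ = φ j
    ... | tri≈ _ _ _ = replicate c 0
    ... | tri> _ _ _ = μ j

    layout-reg : ∀ ω μ {x} → x < m → layout ω μ x ≡ proj₁ ω x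
    layout-reg ω μ {x} x<m with <-cmp x m
    ... | tri< _ _ _ = refl
    ... | tri≈ ¬p _ _ = contradiction x<m ¬p
    ... | tri> ¬p _ _ = contradiction x<m ¬p

    layout-ctr : ∀ ω μ → layout ω μ m ≡ replicate (proj₂ ω) 0
    layout-ctr ω μ with <-cmp m m
    ... | tri< _ ¬p _ = contradiction refl ¬p
    ... | tri≈ _ _ _ = refl
    ... | tri> _ ¬p _ = contradiction refl ¬p

    layout-mark : ∀ ω μ {z} → m < z → layout ω μ z ≡ μ z
    layout-mark ω μ {z} m<z with <-cmp z m
    ... | tri< _ _ ¬p = contradiction m<z ¬p
    ... | tri≈ _ _ ¬p = contradiction m<z ¬p
    ... | tri> _ _ _ = refl

    layout-cong : ∀ {ω ω' μ μ'} → ω ≈ ω' → μ ≗ μ' → layout ω μ ≗ layout ω' μ'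
    layout-cong {φ , c} {φ' , .c} (e , refl) e' j with <-cmp j m
    ... | tri< _ _ _ = e j _
    ... | tri≈ _ _ _ = refl
    ... | tri> _ _ _ = e' j

    set-reg : ∀ {φ c μ} x s' → x < m → (layout (φ , c) μ) [ x ↦ s' ] ≗ layout (φ [ x ↦ s' ] , c) μ
    set-reg {φ} {c} {μ} x s' x<m j with j ≟ x
    ... | yes refl = ≡-sym (trans (layout-reg (φ [ x ↦ s' ] , c) μ x<m) (update-same φ x s'))
    ... | no j≢ with <-cmp j m
    ...   | tri< _ _ _ = ≡-sym (update-other φ s' j≢)
    ...   | tri≈ _ _ _ = refl
    ...   | tri> _ _ _ = refl

    set-ctr : ∀ {φ c μ} c' → (layout (φ , c) μ) [ m ↦ replicate c' 0 ] ≗ layout (φ , c') μ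
    set-ctr {φ} {c} {μ} c' j = by-cases (j ≟ m)
      where
      by-cases : Dec (j ≡ m) → ((layout (φ , c) μ) [ m ↦ replicate c' 0 ]) j ≡ layout (φ , c') μ j
      by-cases (yes refl) = trans (update-same (layout (φ , c) μ) m _) (≡-sym (layout-ctr (φ , c') μ))
      by-cases (no j≢) = trans (update-other (layout (φ , c) μ) _ j≢) elsewhere
        where
        elsewhere : layout (φ , c) μ j ≡ layout (φ , c') μ j
        elsewhere with <-cmp j m
        ... | tri< _ _ _ = refl
        ... | tri≈ _ p _ = contradiction p j≢
        ... | tri> _ _ _ = refl

    set-mark : ∀ {ω μ} z s' → m < z → (layout ω μ) [ z ↦ s' ] ≗ layout ω (μ [ z ↦ s' ])
    set-mark {ω} {μ} z s' m<z j with j ≟ z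
    ... | yes refl = ≡-sym (trans (layout-mark ω (μ [ z ↦ s' ]) m<z) (update-same μ z s'))
    ... | no j≢ with <-cmp j m
    ...   | tri< _ _ _ = refl
    ...   | tri≈ _ _ _ = refl
    ...   | tri> _ _ _ = ≡-sym (update-other μ s' j≢)

    update-id : ∀ (σ : Store) x {s'} → s' ≡ σ x → σ ≗ σ [ x ↦ s' ]
    update-id σ x e j with j ≟ x
    ... | yes refl = ≡-sym e
    ... | no _ = refl

    -- `atomStep` updates the store even if the stack stays the same; the tape has nothing to do
    -- then.
    Outcome-update-id : ∀ {p N l φ c μ} x {s'} → φ x ≡ s' → Outcome p N l (layout (φ , c) μ) →
      Outcome p N l (layout (φ [ x ↦ s' ] , c) μ)
    Outcome-update-id {φ = φ} x e = Outcome-≗ (layout-cong ((λ y _ → update-id φ x (≡-sym e) y) , refl) (λ _ → refl))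

    -- The case tables of `push` and `pop` with the counter in unary on track `m`: a failed pop adds
    -- a mark there, and the push that undoes it removes one.
    compA : Atom → Prog G
    compA SKIP       = skip
    compA (PUSH n x) = branch m m 0 (pushP x n) (branch x x (suc n) skip (popP m))
    compA (POP n x)  = branch x x (suc n) (branch m m 0 (popP x) skip) (pushP m 0)

    branch-self-yes : ∀ {l σ p q N σ'} x n {s'} → Rep l σ → σ x ≡ s' → top s' ≡ just n →
      (∀ l₁ → Rep l₁ σ → length l₁ ≤ length l + 1 → Outcome p N l₁ σ') →
      Outcome (branch x x (suc n) p q) (suc N) l σ'
    branch-self-yes x n rep refl e = branch-yes x x (suc n) rep (topv-self⁻¹ _ n e)

    branch-self-no : ∀ {l σ p q N σ'} x n {s'} → Rep l σ → σ x ≡ s' → top s' ≢ just n →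
      (∀ l₁ → Rep l₁ σ → length l₁ ≤ length l + 1 → Outcome q N l₁ σ') →
      Outcome (branch x x (suc n) p q) (suc N) l σ'
    branch-self-no x n rep refl ¬e = branch-no x x (suc n) rep (λ e → ¬e (topv-self _ n e))

    ctr-zero : ∀ {l φ μ p q N σ'} → Rep l (layout (φ , 0) μ) →
      (∀ l₁ → Rep l₁ (layout (φ , 0) μ) → length l₁ ≤ length l + 1 → Outcome p N l₁ σ') →
      Outcome (branch m m 0 p q) (suc N) l σ'
    ctr-zero {φ = φ} {μ} rep =
      branch-yes m m 0 rep (cong (λ s' → topv s' s') (layout-ctr (φ , 0) μ))

    ctr-suc : ∀ {l φ c μ p q N σ'} → Rep l (layout (φ , suc c) μ) →
      (∀ l₁ → Rep l₁ (layout (φ , suc c) μ) → length l₁ ≤ length l + 1 → Outcome q N l₁ σ') →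
      Outcome (branch m m 0 p q) (suc N) l σ'
    ctr-suc {φ = φ} {c} {μ} rep = branch-no m m 0 rep λ e →
      contradiction (trans (≡-sym (ht-∷-same 0 (replicate c 0)))
        (trans (≡-sym (cong (λ s' → topv s' s') (layout-ctr (φ , suc c) μ))) e)) λ ()

    ctr-push : ∀ {φ c μ} → Runs (pushP m 0) 1 (layout (φ , c) μ) (layout (φ , suc c) μ)
    ctr-push {φ} {c} {μ} = Runs-≗ (λ _ → refl)
      (λ j → trans (cong (λ s' → ((layout (φ , c) μ) [ m ↦ 0 ∷ s' ]) j) (layout-ctr (φ , c) μ))
                   (set-ctr {φ} {c} {μ} (suc c) j))
      (push-runs m 0 m<M 0<s)

    ctr-pop : ∀ {φ c μ} → Runs (popP m) 1 (layout (φ , suc c) μ) (layout (φ , c) μ)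
    ctr-pop {φ} {c} {μ} = Runs-≗ (λ _ → refl) (set-ctr {φ} {suc c} {μ} c)
      (pop-runs m 0 m<M (layout-ctr (φ , suc c) μ))

    push-outcome : ∀ {φ c μ} n x s' → n < s → x < m → φ x ≡ s' →
      Runs (compA (PUSH n x)) 3 (layout (φ , c) μ)
        (layout (φ [ x ↦ proj₁ (push n (s' , c)) ] , proj₂ (push n (s' , c))) μ)
    push-outcome {φ} {zero} {μ} n x s' n<s x<m refl l rep = Outcome-≤ (s≤s (s≤s z≤n))
      (ctr-zero rep λ l₁ rep₁ _ → Outcome-≗
        (λ j → trans (cong (λ u → ((layout (φ , 0) μ) [ x ↦ n ∷ u ]) j) (layout-reg (φ , 0) μ x<m))
                     (set-reg x (n ∷ s') x<m j))
        (push-runs x n (<-trans x<m m<M) n<s l₁ rep₁))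
    push-outcome {φ} {suc c} {μ} n x [] n<s x<m eq l rep =
      ctr-suc rep λ l₁ rep₁ _ → branch-self-no x n rep₁ (trans (layout-reg (φ , suc c) μ x<m) eq) (λ ())
        λ l₂ rep₂ _ → Outcome-update-id x eq (ctr-pop l₂ rep₂)
    push-outcome {φ} {suc c} {μ} n x (a ∷ s') n<s x<m eq l rep with a ≟ n
    ... | yes refl =
      ctr-suc rep λ l₁ rep₁ _ → branch-self-yes x n rep₁ (trans (layout-reg (φ , suc c) μ x<m) eq) refl
        λ l₂ rep₂ _ → Outcome-update-id x eq (skip-outcome rep₂)
    ... | no a≢n =
      ctr-suc rep λ l₁ rep₁ _ → branch-self-no x n rep₁ (trans (layout-reg (φ , suc c) μ x<m) eq)
        (λ e → a≢n (just-injective e)) λ l₂ rep₂ _ → Outcome-update-id x eq (ctr-pop l₂ rep₂)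

    pop-outcome : ∀ {φ c μ} n x s' → x < m → φ x ≡ s' →
      Runs (compA (POP n x)) 3 (layout (φ , c) μ)
        (layout (φ [ x ↦ proj₁ (pop n (s' , c)) ] , proj₂ (pop n (s' , c))) μ)
    pop-outcome {φ} {c} {μ} n x [] x<m eq l rep = Outcome-≤ (s≤s (s≤s z≤n))
      (branch-self-no x n rep (trans (layout-reg (φ , c) μ x<m) eq) (λ ())
        λ l₁ rep₁ _ → Outcome-update-id x eq (ctr-push l₁ rep₁))
    pop-outcome {φ} {c} {μ} n x (a ∷ s') x<m eq l rep with a ≟ n
    pop-outcome {φ} {zero} {μ} n x (a ∷ s') x<m eq l rep | yes refl =
      branch-self-yes x n rep (trans (layout-reg (φ , 0) μ x<m) eq) refl
        λ l₁ rep₁ _ → ctr-zero rep₁ λ l₂ rep₂ _ → Outcome-≗ (set-reg x s' x<m)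
          (pop-runs x a (<-trans x<m m<M) (trans (layout-reg (φ , 0) μ x<m) eq) l₂ rep₂)
    pop-outcome {φ} {suc c} {μ} n x (a ∷ s') x<m eq l rep | yes refl =
      branch-self-yes x n rep (trans (layout-reg (φ , suc c) μ x<m) eq) refl
        λ l₁ rep₁ _ → ctr-suc rep₁ λ l₂ rep₂ _ → Outcome-update-id x eq (skip-outcome rep₂)
    pop-outcome {φ} {c} {μ} n x (a ∷ s') x<m eq l rep | no a≢n = Outcome-≤ (s≤s (s≤s z≤n))
      (branch-self-no x n rep (trans (layout-reg (φ , c) μ x<m) eq) (λ e → a≢n (just-injective e))
        λ l₁ rep₁ _ → Outcome-update-id x eq (ctr-push l₁ rep₁))

    compA-runs : ∀ a {ω μ} → bndA a ≤ m → Runs (compA a) 3 (layout ω μ) (layout (atomStep a ω) μ)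
    compA-runs SKIP le l rep = Outcome-≤ (s≤s z≤n) (skip-outcome rep)
    compA-runs (PUSH n x) {φ , c} le =
      push-outcome n x (φ x) (≤-trans (m+n≤o⇒m≤o (suc n) le) m≤s) (m+n≤o⇒n≤o (suc n) le) refl
    compA-runs (POP n x) {φ , c} le =
      pop-outcome n x (φ x) (m+n≤o⇒n≤o (suc n) le) refl

    mutual
      -- A mark of height `suc h` on track `z` points at the entry of height `h` of the leader.
      -- `FOR` raises the mark just past the top of the leader, takes one step back and then lowers
      -- it to nothing; `ROF` starts at the bottom and raises it until the leader has no entry
      -- there, then clears it.
      compB : Body → ℕ → Prog G
      compB (atom a)   z = compA a
      compB (s ⨾ t)    z = compB s z » compB t z
      compB (IF x n s) z = branch x x (suc n) (compB s z) skip
      compB (FOR x c)  z = (pushP z 0 » repeat z x (pushP z 0) » popP z)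
                         » repeat z z (compC c x z 0 » popP z)
      compB (ROF x c)  z = pushP z 0 » repeat z x (compC c x z 0 » pushP z 0) » repeat z z (popP z)

      -- The last clause is entered without a test, so it takes all larger symbols, as `min(i,k)`
      -- demands.
      compC : Clauses → Reg → ℕ → ℕ → Prog G
      compC (one s)    x z n = compB s (suc z)
      compC (cons s c) x z n = branch z x (suc n) (compB s (suc z)) (compC c x z (suc n))

    compT : Term → Prog G
    compT (atom a)     = compA a
    compT (t ⨾ u)      = compT t » compT u
    compT (IF x n t)   = branch x x (suc n) (compT t) skip
    compT (NORMAL N s) = compB s (suc m)

    marked : State → Store → ℕ → ℕ → Store
    marked ω μ z h = layout ω (μ [ z ↦ replicate h 0 ])

    module _ {ω : State} {μ : Store} {z : ℕ} (m<z : m < z) where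

      marked-z : ∀ h → marked ω μ z h z ≡ replicate h 0
      marked-z h = trans (layout-mark ω _ m<z) (update-same μ z _)

      update-twice : ∀ {s' s''} → ((μ [ z ↦ s' ]) [ z ↦ s'' ]) ≗ (μ [ z ↦ s'' ])
      update-twice {s'} j with j ≟ z
      ... | yes _ = refl
      ... | no j≢ = update-other μ s' j≢

      marked-≗ : ∀ h h' → (marked ω μ z h) [ z ↦ replicate h' 0 ] ≗ marked ω μ z h'
      marked-≗ h h' j = trans (set-mark z (replicate h' 0) m<z j) (layout-cong {ω} ≈-refl update-twice j)

      mark-push : z < M → ∀ {h} → Runs (pushP z 0) 1 (marked ω μ z h) (marked ω μ z (suc h))
      mark-push z<M {h} = Runs-≗ (λ _ → refl)
        (λ j → trans (cong (λ s' → ((marked ω μ z h) [ z ↦ 0 ∷ s' ]) j) (marked-z h)) (marked-≗ h (suc h) j))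
        (push-runs z 0 z<M 0<s)

      mark-pop : z < M → ∀ {h} → Runs (popP z) 1 (marked ω μ z (suc h)) (marked ω μ z h)
      mark-pop z<M {h} = Runs-≗ (λ _ → refl) (marked-≗ (suc h) h)
        (pop-runs z 0 z<M (marked-z (suc h)))

      marked-0 : μ z ≡ [] → marked ω μ z 0 ≗ layout ω μ
      marked-0 e = layout-cong {ω} ≈-refl (λ j → ≡-sym (update-id μ z (≡-sym e) j))

      topv-mark : ∀ {x} h → x < m → topv (marked ω μ z (suc h) z) (marked ω μ z (suc h) x) ≡ ht (proj₁ ω x) h
      topv-mark h x<m = trans
        (cong₂ topv (marked-z (suc h)) (layout-reg ω _ x<m))
        (cong (ht (proj₁ ω _)) (length-replicate h))

      topv-mark-self : ∀ h → topv (marked ω μ z (suc h) z) (marked ω μ z (suc h) z) ≢ 0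
      topv-mark-self h e = contradiction
        (trans (≡-sym (ht-∷-same 0 (replicate h 0))) (trans (≡-sym (cong (λ s' → topv s' s') (marked-z (suc h)))) e)) λ ()

      topv-mark-0 : topv (marked ω μ z 0 z) (marked ω μ z 0 z) ≡ 0
      topv-mark-0 = cong (λ s' → topv s' s') (marked-z 0)

      mark-fill : z < M → ∀ {x} d h → x < m → h + d ≡ length (proj₁ ω x) →
        Runs (repeat z x (pushP z 0)) (suc (d * 2)) (marked ω μ z (suc h)) (marked ω μ z (suc (h + d)))
      mark-fill z<M zero h x<m eq rewrite +-identityʳ h =
        repeat-stop z _ (trans (topv-mark h x<m) (ht-above (proj₁ ω _) (≤-reflexive (≡-sym eq))))
      mark-fill z<M {x} (suc d) h x<m eq rewrite +-suc h d = repeat-go z x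
        (λ e → ht-below (proj₁ ω x) (≤-trans (s≤s (m≤m+n h d)) (≤-reflexive eq)) (trans (≡-sym (topv-mark h x<m)) e))
        (mark-push z<M) (mark-fill z<M d (suc h) x<m eq)

      mark-clear : z < M → ∀ h →
        Runs (repeat z z (popP z)) (suc (h * 2)) (marked ω μ z h) (marked ω μ z 0)
      mark-clear z<M zero = repeat-stop z z topv-mark-0
      mark-clear z<M (suc h) = repeat-go z z (topv-mark-self h) (mark-pop z<M) (mark-clear z<M h)

    module _ (c : Clauses) {x z P : ℕ} {μ : Store} (m<z : m < z) (z<M : z < M) (x<m : x < m)
      (I : State → Set)
      (I-step : ∀ i {ω} → I ω → I (evalC c i ω))
      (x-fixed : ∀ i ω → proj₁ (evalC c i ω) x ≡ proj₁ ω x)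
      (body : ∀ i h {ω} → I ω → ht (proj₁ ω x) h ≡ suc i →
        Runs (compC c x z 0) P (marked ω μ z (suc h)) (marked (evalC c i ω) μ z (suc h))) where

      -- The entries still to be visited are the lowest part of the leader, hence the agreement on
      -- heights below `length is`; the mark has exactly this height.
      for-runs : ∀ is {ω} → I ω → (∀ j → j < length is → ht (proj₁ ω x) j ≡ ht is j) →
        Runs (repeat z z (compC c x z 0 » popP z)) (suc (length is * (2 + P)))
          (marked ω μ z (length is)) (marked (loop (evalC c) is ω) μ z 0)
      for-runs [] iω e = repeat-stop z z (topv-mark-0 m<z)
      for-runs (i ∷ is) {ω} iω e = Runs-≤ (≤-reflexive (round-cost P (length is)))
        (repeat-go z z (topv-mark-self m<z (length is))
          (Runs-» (body i (length is) iω (trans (e _ ≤-refl) (ht-∷-same i is))) (mark-pop m<z z<M))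
          (for-runs is (I-step i iω) λ j j<is → trans (cong (λ s' → ht s' j) (x-fixed i ω))
            (trans (e j (<-trans j<is ≤-refl)) (ht-∷-other i is (<⇒≢ j<is)))))

      rof-runs : ∀ {is h ω} → I ω → Ascending (proj₁ ω x) h is →
        Runs (repeat z x (compC c x z 0 » pushP z 0)) (suc (length is * (2 + P)))
          (marked ω μ z (suc h)) (marked (loop (evalC c) is ω) μ z (suc (h + length is)))
      rof-runs {ω = ω} iω [] rewrite +-identityʳ (length (proj₁ ω x)) =
        repeat-stop z x (trans (topv-mark m<z _ x<m) (ht-above (proj₁ ω x) ≤-refl))
      rof-runs {i ∷ is} {h} {ω} iω (e ∷ asc) rewrite +-suc h (length is) =
        Runs-≤ (≤-reflexive (round-cost P (length is)))
        (repeat-go z x (λ e' → contradiction (trans (≡-sym e) (trans (≡-sym (topv-mark m<z h x<m)) e')) λ ())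
          (Runs-» (body i h iω e) (mark-push m<z z<M))
          (rof-runs (I-step i iω) (subst (λ s' → Ascending s' (suc h) is) (≡-sym (x-fixed i ω)) asc)))

    module _ (N : List Reg) (B : ℕ) where

      -- The invariant behind the polynomial bound: a block does not write the registers in `N`, so
      -- a bound valid at its entry is valid at every pass of every loop.
      Small : State → Set
      Small ω = ∀ y → y ∈ N → y < m → length (proj₁ ω y) ≤ B

      record Fits (written leaders : List Reg) (bnd z : ℕ) : Set where
        constructor fits
        field
          unwritten : ∀ {y} → y ∈ N → y ∉ written
          ⊆N        : ∀ {y} → y ∈ leaders → y ∈ N
          bnd≤m     : bnd ≤ m
          bnd≤M     : z + bnd ≤ M
          m<z       : m < z

      FitsB : Body → ℕ → Set
      FitsB s = Fits (writtenB s) (iterLeadersB s) (bndB s)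

      FitsC : Clauses → ℕ → Set
      FitsC c = Fits (writtenC c) (iterLeadersC c) (bndC c)

      fits-ˡ : ∀ {ws ws' ls ls' n n' z} → Fits (ws ++ ws') (ls ++ ls') (n + n') z → Fits ws ls n z
      fits-ˡ {n = n} {n'} {z} (fits u l m' M' z') =
        fits (λ y∈ → ∉-++ˡ (u y∈)) (λ y∈ → l (∈-++⁺ˡ y∈)) (m+n≤o⇒m≤o n m')
          (≤-trans (+-monoʳ-≤ z (m≤m+n n n')) M') z'

      fits-ʳ : ∀ {ws ws' ls ls' n n' z} → Fits (ws ++ ws') (ls ++ ls') (n + n') z → Fits ws' ls' n' z
      fits-ʳ {ws} {ls = ls} {n = n} {n'} {z} (fits u l m' M' z') =
        fits (λ y∈ → ∉-++ʳ ws (u y∈)) (λ y∈ → l (∈-++⁺ʳ ls y∈)) (m+n≤o⇒n≤o n m')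
          (≤-trans (+-monoʳ-≤ z (m≤n+m n' n)) M') z'

      fits-IF : ∀ {ws ls n z} k → Fits ws ls (k + n) z → Fits ws ls n z
      fits-IF {n = n} {z} k (fits u l m' M' z') =
        fits u l (m+n≤o⇒n≤o k m') (≤-trans (+-monoʳ-≤ z (m≤n+m n k)) M') z'

      -- The summand `suc x` of the bound is at least 1 and pays for the track that the loop
      -- occupies.
      fits-loop : ∀ {ws x ls n z} → Fits ws (x ∷ ls) (suc x + n) z → Fits ws ls n (suc z)
      fits-loop {x = x} {n = n} {z} (fits u l m' M' z') =
        fits u (λ y∈ → l (there y∈)) (m+n≤o⇒n≤o (suc x) m')
          (≤-trans (≤-trans (≤-reflexive (≡-sym (+-suc z n))) (+-monoʳ-≤ z (s≤s (m≤n+m n x)))) M') (<-trans z' ≤-refl)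

      fits-z<M : ∀ {ws x ls n z} → Fits ws (x ∷ ls) (suc x + n) z → z < M
      fits-z<M {x = x} {n = n} {z} f = ≤-trans (≤-trans (≤-reflexive (+-comm 1 z)) (+-monoʳ-≤ z (s≤s z≤n))) (Fits.bnd≤M f)

      Small-step : ∀ {ω ω'} → (∀ {y} → y ∈ N → proj₁ ω' y ≡ proj₁ ω y) → Small ω → Small ω'
      Small-step e sm y y∈ y<m = ≤-trans (≤-reflexive (cong length (e y∈))) (sm y y∈ y<m)

      mutual
        -- Tracks from `z` on are free at the start, and a loop removes its mark before it ends. So
        -- `μ` is restored, and consecutive loops share a track.
        compB-runs : ∀ s {z ω μ} → FitsB s z → WfB s → Small ω → (∀ j → z ≤ j → μ j ≡ []) →
          Runs (compB s z) (⟦ costB s ⟧ B) (layout ω μ) (layout (evalB s ω) μ)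
        compB-runs (atom a) f w sm μ0 = compA-runs a (Fits.bnd≤m f)
        compB-runs (s ⨾ t) {z} {ω} f (w , w') sm μ0 = Runs-»
          (compB-runs s (fits-ˡ f) w sm μ0)
          (compB-runs t (fits-ʳ {writtenB s} {ls = iterLeadersB s} f) w'
            (Small-step {ω} {evalB s ω} (λ y∈ → evalB-unwritten s ω (∉-++ˡ (Fits.unwritten f y∈))) sm) μ0)
        compB-runs (IF x n s) {z} {ω} {μ} f (x∉ , w) sm μ0 l rep with top (proj₁ ω x) ≟ᵐ just n
        ... | yes e = Outcome-≤ (n≤1+n _)
          (branch-self-yes x n rep (layout-reg ω μ (m+n≤o⇒m≤o (suc x) (Fits.bnd≤m f))) e
            λ l₁ rep₁ _ → compB-runs s (fits-IF (suc n) (fits-IF (suc x) f)) w sm μ0 l₁ rep₁)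
        ... | no ¬e = Outcome-≤ (s≤s (s≤s z≤n))
          (branch-self-no x n rep (layout-reg ω μ (m+n≤o⇒m≤o (suc x) (Fits.bnd≤m f))) ¬e
            λ l₁ rep₁ _ → skip-outcome rep₁)
        compB-runs (FOR x c) {z} {ω} {μ} f (x∉ , w) sm μ0 =
          Runs-≤ (≤-trans (≤-reflexive (arith (length (proj₁ ω x)) (⟦ costC c ⟧ B)))
                   (+-monoʳ-≤ 4 (*-monoˡ-≤ (4 + ⟦ costC c ⟧ B) (sm x (Fits.⊆N f (here refl)) x<m))))
            (Runs-≗ (λ j → ≡-sym (marked-0 m<z (μ0 z ≤-refl) j)) (marked-0 m<z (μ0 z ≤-refl))
              (Runs-» (Runs-» (Runs-» (mark-push m<z z<M) (mark-fill m<z z<M (length (proj₁ ω x)) 0 x<m refl))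
                              (mark-pop m<z z<M))
                (for-runs c m<z z<M x<m Small
                  (λ i {ω} → Small-step {ω} {evalC c i ω} (λ y∈ → evalC-unwritten c i ω (Fits.unwritten f y∈)))
                  (λ i ω → evalC-unwritten c i ω x∉)
                  (loop-body c f w μ0)
                  (proj₁ ω x) sm (λ _ _ → refl))))
          where
          m<z = Fits.m<z f
          z<M = fits-z<M f
          x<m = m+n≤o⇒m≤o (suc x) (Fits.bnd≤m f)
          arith : ∀ n P → 1 + suc (n * 2) + 1 + suc (n * (2 + P)) ≡ 4 + n * (4 + P)
          arith = solve-∀
        compB-runs (ROF x c) {z} {ω} {μ} f (x∉ , w) sm μ0 =
          Runs-≤ (≤-trans (≤-reflexive (arith (length (reverse (proj₁ ω x))) (⟦ costC c ⟧ B)))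
                   (+-monoʳ-≤ 5 (*-monoˡ-≤ (4 + ⟦ costC c ⟧ B)
                     (≤-trans (≤-reflexive (length-reverse (proj₁ ω x))) (sm x (Fits.⊆N f (here refl)) x<m)))))
            (Runs-≗ (λ j → ≡-sym (marked-0 m<z (μ0 z ≤-refl) j)) (marked-0 m<z (μ0 z ≤-refl))
              (Runs-» (Runs-» (mark-push m<z z<M)
                (rof-runs c m<z z<M x<m Small
                  (λ i {ω} → Small-step {ω} {evalC c i ω} (λ y∈ → evalC-unwritten c i ω (Fits.unwritten f y∈)))
                  (λ i ω → evalC-unwritten c i ω x∉)
                  (loop-body c f w μ0)
                  sm (reverse-ascending (proj₁ ω x))))
                (mark-clear m<z z<M _)))
          where
          m<z = Fits.m<z f
          z<M = fits-z<M f
          x<m = m+n≤o⇒m≤o (suc x) (Fits.bnd≤m f)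
          arith : ∀ n P → 1 + suc (n * (2 + P)) + suc (suc n * 2) ≡ 5 + n * (4 + P)
          arith = solve-∀

        loop-body : ∀ c {x z μ} → Fits (writtenC c) (x ∷ iterLeadersC c) (suc x + bndC c) z → WfC c →
          (∀ j → z ≤ j → μ j ≡ []) → ∀ i h {ω} → Small ω → ht (proj₁ ω x) h ≡ suc i →
          Runs (compC c x z 0) (⟦ costC c ⟧ B) (marked ω μ z (suc h)) (marked (evalC c i ω) μ z (suc h))
        loop-body c {x} {z} {μ} f w μ0 i h sm e =
          compC-runs c 0 i (fits-loop f) w sm
            (trans (topv-mark (Fits.m<z f) h (m+n≤o⇒m≤o (suc x) (Fits.bnd≤m f))) e)
            (λ j z<j → trans (update-other μ _ (>⇒≢ z<j)) (μ0 j (<⇒≤ z<j)))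

        compC-runs : ∀ c {x z ω μ} n i → FitsC c (suc z) → WfC c → Small ω →
          topv (layout ω μ z) (layout ω μ x) ≡ suc (n + i) → (∀ j → suc z ≤ j → μ j ≡ []) →
          Runs (compC c x z n) (⟦ costC c ⟧ B) (layout ω μ) (layout (evalC c i ω) μ)
        compC-runs (one s) n i f w sm e μ0 = compB-runs s f w sm μ0
        compC-runs (cons s c) {x} {z} n zero f (w , _) sm e μ0 l rep =
          Outcome-≤ (s≤s (m≤m+n _ _))
            (branch-yes z x (suc n) rep (trans e (cong suc (+-identityʳ n)))
              λ l₁ rep₁ _ → compB-runs s (fits-ˡ f) w sm μ0 l₁ rep₁)
        compC-runs (cons s c) {x} {z} n (suc i) f (_ , w) sm e μ0 l rep =
          Outcome-≤ (s≤s (m≤n+m _ _))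
            (branch-no z x (suc n) rep
              (λ e' → m≢1+m+n n (≡-sym (trans (≡-sym (+-suc n i)) (suc-injective (trans (≡-sym e) e')))))
              λ l₁ rep₁ _ → compC-runs c (suc n) i (fits-ʳ {writtenB s} {ls = iterLeadersB s} f) w sm
                (trans e (cong suc (+-suc n i))) μ0 l₁ rep₁)

    -- At a `NORMAL` block the current tape length bounds all stacks and so serves as the bound `B`
    -- on its leaders; the first free track is `suc m`.
    compT-outcome : ∀ t {ω l} → ForNo t → bndT t ≤ m → suc m + bndT t ≤ M → Rep l (layout ω ∅) →
      Outcome (compT t) (⟦ costT t ⟧ (length l)) l (layout (evalT t ω) ∅)
    compT-outcome (atom a) f le leM rep = compA-runs a le _ rep
    compT-outcome (t ⨾ u) {ω} {l} (f , f') le leM rep =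
      Outcome-» (compT-outcome t f (m+n≤o⇒m≤o (bndT t) le) (≤-trans (+-monoʳ-≤ (suc m) (m≤m+n _ _)) leM) rep)
        λ l₁ rep₁ len → Outcome-≤ (≤-trans (⟦⟧-mono (costT u) len) (≤-reflexive (≡-sym (⟦∘ₚ⟧ (costT u) _ _))))
          (compT-outcome u f' (m+n≤o⇒n≤o (bndT t) le) (≤-trans (+-monoʳ-≤ (suc m) (m≤n+m _ _)) leM) rep₁)
    compT-outcome (IF x n t) {ω} {l} (_ , f) le leM rep with top (proj₁ ω x) ≟ᵐ just n
    ... | yes e = Outcome-≤ (n≤1+n _)
      (branch-self-yes x n rep (layout-reg ω ∅ (m+n≤o⇒m≤o (suc x) le)) e
        λ l₁ rep₁ len → Outcome-≤ (≤-trans (⟦⟧-mono (costT t) len) (≤-reflexive (≡-sym (⟦∘ₚ⟧ (costT t) _ _))))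
          (compT-outcome t f (m+n≤o⇒n≤o (suc n) (m+n≤o⇒n≤o (suc x) le))
            (≤-trans (+-monoʳ-≤ (suc m) (≤-trans (m≤n+m _ (suc n)) (m≤n+m _ (suc x)))) leM) rep₁))
    ... | no ¬e = Outcome-≤ (s≤s (s≤s z≤n))
      (branch-self-no x n rep (layout-reg ω ∅ (m+n≤o⇒m≤o (suc x) le)) ¬e λ l₁ rep₁ _ → skip-outcome rep₁)
    compT-outcome (NORMAL N s) {ω} {l} (N∉ , ⊆N , w) le leM rep =
      compB-runs (toList N) (length l) s
        (fits (All.lookup N∉) (All.lookup ⊆N) le leM ≤-refl) w
        (λ y _ y<m → ≤-trans (≤-reflexive (cong length (≡-sym (layout-reg ω ∅ y<m)))) (height≤ rep y))
        (λ _ _ → refl) l rep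

    -- Input and output on the tape

    module InputOutput {k inp out : ℕ} {π : Encoding k} (inp<m : inp < m) (out<m : out < m)
      (letter : Fin k → G) (nonblank : G → Bool)
      (nonblank-blank : nonblank b ≡ false) (nonblank-letter : ∀ a → nonblank (letter a) ≡ true)
      (letter-clean : ∀ a → isEnd (letter a) ≡ false)
      (letter-inp   : ∀ a → track (letter a) inp ≡ suc (toℕ (Inverse.to π a)))
      (letter-other : ∀ a {j} → j ≢ inp → track (letter a) j ≡ 0) where

      letters : List (Fin k) → List G
      letters = map letter

      input-inp : ∀ x i → track (cellAt (letters x ʳ++ []) i) inp ≡ ht (encode π x) i
      input-inp [] i = track-blank inp
      input-inp (a ∷ x) i with i ≟ length (encode π x)
      ... | yes refl = trans (cong (λ n → track (cellAt (letters x ʳ++ (letter a ∷ [])) n) inp)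
                                (trans (length-map _ x) (≡-sym (length-map letter x))))
        (trans (cong (λ g → track g inp) (cellAt-ʳ++-length (letters x) (letter a) [])) (letter-inp a))
      ... | no i≢ = trans (cong (λ g → track g inp)
          (cellAt-ʳ++-cong (letters x) {letter a ∷ []} {[]} {0}
            (λ { zero p → contradiction refl p ; (suc j) _ → refl })
            i (λ e → i≢ (trans e (trans (+-identityʳ _) (trans (length-map letter x) (≡-sym (length-map _ x))))))))
        (input-inp x i)

      All-track-0 : ∀ l {j} → All (λ g → track g j ≡ 0) l → ∀ i → track (cellAt l i) j ≡ 0
      All-track-0 [] [] i = track-blank _
      All-track-0 (g ∷ l) (p ∷ ps) zero = p
      All-track-0 (g ∷ l) (p ∷ ps) (suc i) = All-track-0 l ps i

      All-letters : ∀ {P : G → Set} → (∀ a → P (letter a)) → ∀ x {l} → All P l → All P (letters x ʳ++ l)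
      All-letters p [] ps = ps
      All-letters p (a ∷ x) ps = All-letters p x (p a ∷ ps)

      input-Rep : ∀ x {σ} → σ inp ≡ encode π x → (∀ j → j ≢ inp → σ j ≡ []) → Rep (letters x ʳ++ []) σ
      input-Rep x {σ} eq eq' = represents cont (All-letters letter-clean x [])
        where
        cont : ∀ j i → track (cellAt (letters x ʳ++ []) i) j ≡ ht (σ j) i
        cont j i with j ≟ inp
        ... | yes refl = trans (input-inp x i) (cong (λ s' → ht s' i) (≡-sym eq))
        ... | no j≢ = trans (All-track-0 (letters x ʳ++ []) (All-letters (λ a → letter-other a j≢) x []) i)
                            (cong (λ s' → ht s' i) (≡-sym (eq' j j≢)))

      -- The end marker goes on the first blank behind the input. The last letter lies next to it
      -- and becomes the bottom of the stack, so the raw input already represents `encode π x`.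
      start : Prog G
      start = while nonblank (act id R) » act (const end) S

      initialTape : List (Fin k) → Tape G
      initialTape []      = tape [] b []
      initialTape (a ∷ x) = tape [] (letter a) (letters x)

      scan-exec : ∀ a x l → Exec (while nonblank (act id R)) (suc (suc (length x) * 2))
        (tape l (letter a) (letters x)) (tape (letters (a ∷ x) ʳ++ l) b [])
      scan-exec a [] l = while-go (nonblank-letter a) act (while-stop nonblank-blank)
      scan-exec a (a' ∷ x) l = while-go (nonblank-letter a) act (scan-exec a' x (letter a ∷ l))

      start-exec : ∀ x → Exec start (suc (length x * 2) + 1) (initialTape x) (rest (letters x ʳ++ []) [])
      start-exec [] = while-stop nonblank-blank » act
      start-exec (a ∷ x) = scan-exec a x [] » act

      -- The default `b` is a filler: the output stack consists of codes of letters.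
      toLetter : ℕ → G
      toLetter zero = b
      toLetter (suc n) with n <? k
      ... | yes p = letter (Inverse.from π (fromℕ< p))
      ... | no _  = b

      toLetter-to : ∀ a → toLetter (suc (toℕ (Inverse.to π a))) ≡ letter a
      toLetter-to a with toℕ (Inverse.to π a) <? k
      ... | yes p = cong letter (trans (cong (Inverse.from π) (fromℕ<-toℕ (Inverse.to π a) p)) (Inverse.strictlyInverseʳ π a))
      ... | no ¬p = contradiction (toℕ<n (Inverse.to π a)) ¬p

      write-letters : Prog G
      write-letters = while (busy out) (act (λ g → toLetter (track g out)) L)

      -- The marker turns into the blank that ends the output. The output stack is overwritten by
      -- letters from its bottom leftwards, and the final move right reaches the first letter, or
      -- that blank if the output is empty.
      finish : Prog G
      finish = act (const b) L » write-letters » act (const b) R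

      move-left : ∀ w l g r → ∃[ g' ] ∃[ l' ]
        (moveTo L w (tape l g r) ≡ tape l' g' (w ∷ r) × (∀ j → cellAt (g' ∷ l') j ≡ cellAt l j))
      move-left w [] g r = b , [] , refl , λ { zero → refl ; (suc j) → refl }
      move-left w (g' ∷ l) g r = g' , l , refl , λ _ → refl

      write-exec : ∀ is g l r → (∀ j → track (cellAt (g ∷ l) j) out ≡ entry-at is j) →
        ∃[ g' ] ∃[ l' ] Exec write-letters (suc (length is * 2)) (tape l g r)
          (tape l' g' (map (λ i → toLetter (suc i)) is ʳ++ r))
      write-exec [] g l r e = g , l , while-stop (busy-false {out} {g} (e 0))
      write-exec (i ∷ is) g l r e with move-left (toLetter (track g out)) l g r
      ... | g₁ , l₁ , eq , same
        with write-exec is g₁ l₁ (toLetter (suc i) ∷ r) (λ j → trans (cong (λ h → track h out) (same j)) (e (suc j)))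
      ... | g₂ , l₂ , d = g₂ , l₂ ,
        while-go (busy-true {out} {g} (λ e0 → contradiction (trans (≡-sym (e 0)) e0) λ ())) act
          (subst (λ τ → Exec write-letters _ τ _)
            (trans (cong (λ v → tape l₁ g₁ (toLetter v ∷ r)) (≡-sym (e 0))) (≡-sym eq)) d)

      written-letters : ∀ y r →
        map (λ i → toLetter (suc i)) (reverse (encode π y)) ʳ++ r ≡ letters y ++ r
      written-letters y r = trans (ʳ++-defn (map t (reverse (encode π y))))
        (cong (_++ r) (trans (cong reverse (reverse-map t (encode π y)))
          (trans (reverse-involutive (map t (encode π y)))
            (trans (≡-sym (map-∘ y)) (map-cong toLetter-to y)))))
        where
        t : ℕ → G
        t i = toLetter (suc i)

      finish-exec : ∀ {l σ} y r → Rep l σ → σ out ≡ encode π y →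
        ∃[ τ ] (Exec finish (1 + suc (length y * 2) + 1) (rest l r) τ
                × Tape.head τ ∷ Tape.right τ ≡ letters y ++ b ∷ r)
      finish-exec {l} {σ} y r rep eq with move-left b l end r
      ... | g₁ , l₁ , eq₁ , same with write-exec (reverse (encode π y)) g₁ l₁ (b ∷ r)
          (λ j → trans (cong (λ h → track h out) (same j)) (trans (Rep.content rep out j)
            (trans (cong (λ s' → ht s' j) eq) (Ascending-at (reverse-ascending (encode π y)) j))))
      ... | g₂ , l₂ , d rewrite written-letters y (b ∷ r) | length-reverse (encode π y) | length-map (λ a → toℕ (Inverse.to π a)) y
        with letters y ++ b ∷ r in eqy
      ... | [] = contradiction eqy (nonempty (letters y))
        where
        nonempty : ∀ (xs : List G) → xs ++ b ∷ r ≢ []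
        nonempty [] ()
        nonempty (_ ∷ _) ()
      ... | h ∷ rs = _ ,
        (act » subst (λ τ → Exec write-letters (suc (length y * 2)) τ (tape l₂ g₂ (h ∷ rs))) (≡-sym eq₁) d) » act , refl

      program : Term → Prog G
      program t = start » compT t » finish

      -- The summands belong to `start`, the compiled term and `finish`. The last one uses that the
      -- output is no longer than the final tape, which has at most `var ⊕ costT t` cells.
      time : Term → Poly
      time t = ((con 2 ⊕ (var ⊗ con 2)) ⊕ (costT t ⊗ (con 8 ⊗ (con 1 ⊕ (var ⊕ costT t)))))
             ⊕ (con 3 ⊕ ((var ⊕ costT t) ⊗ con 2))

      length-letters : ∀ x → length (letters x ʳ++ []) ≡ length x
      length-letters x = trans (length-ʳ++ (letters x)) (trans (+-identityʳ _) (length-map letter x))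

      input : List (Fin k) → State
      input x = ∅ [ inp ↦ encode π x ] , 0

      initial-Rep : ∀ x → Rep (letters x ʳ++ []) (layout (input x) ∅)
      initial-Rep x = input-Rep x (trans (layout-reg (input x) ∅ inp<m) (update-same ∅ inp _)) empty
        where
        empty : ∀ j → j ≢ inp → layout (input x) ∅ j ≡ []
        empty j j≢ with <-cmp j m
        ... | tri< _ _ _ = update-other ∅ _ j≢
        ... | tri≈ _ _ _ = refl
        ... | tri> _ _ _ = refl

      program-exec : ∀ t x y → ForNo t → bndT t ≤ m → suc m + bndT t ≤ M →
        evalT t (input x) ≈ (∅ [ out ↦ encode π y ] , 0) →
        ∃[ u ] ∃[ τ ] (Exec (program t) u (initialTape x) τ
          × head τ ∷ right τ ≡ letters y ++ b ∷ [] × u ≤ ⟦ time t ⟧ (length x))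
      program-exec t x y fn bnd≤m bnd≤M computes =
        case compT-outcome t fn bnd≤m bnd≤M (initial-Rep x) [] of λ { (l' , u , d , rep , len , u≤) →
        case finish-exec y [] rep out-stack of λ { (τ , d' , eq) →
        _ , τ , (start-exec x » d) » d' , eq ,
        +-mono-≤
          (+-mono-≤ (≤-reflexive (cong suc (+-comm (length x * 2) 1)))
            (subst (λ n → u ≤ cost (⟦ costT t ⟧ n) n) (length-letters x) u≤))
          (≤-trans (≤-reflexive (cong (λ n → suc (suc n)) (+-comm (length y * 2) 1)))
            (+-monoʳ-≤ 3 (*-monoˡ-≤ 2 (≤-trans (height rep)
              (subst (λ n → length l' ≤ n + ⟦ costT t ⟧ n) (length-letters x) len))))) }}
        where
        out-stack : layout (evalT t (input x)) ∅ out ≡ encode π y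
        out-stack = trans (layout-reg (evalT t (input x)) ∅ out<m)
          (trans (proj₁ computes out _) (update-same ∅ out _))

        height : ∀ {l'} → Rep l' (layout (evalT t (input x)) ∅) → length y ≤ length l'
        height rep = ≤-trans
          (≤-reflexive (trans (≡-sym (length-map _ y)) (cong length (≡-sym out-stack)))) (height≤ rep out)

open Data.Fin using (zero; suc)

-- From tape programs to Turing machines

record Finite (A : Set) : Set where
  field
    size    : ℕ
    enc     : A → Fin size
    dec     : Fin size → A
    dec-enc : ∀ a → dec (enc a) ≡ a

⊤-finite : Finite ⊤
⊤-finite = record { size = 1 ; enc = λ _ → zero ; dec = λ _ → tt ; dec-enc = λ _ → refl }

⊎-finite : ∀ {A B} → Finite A → Finite B → Finite (A ⊎ B)
⊎-finite {A} {B} F H = record { size = size F + size H ; enc = enc' ; dec = dec' ; dec-enc = dec-enc' }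
  where
  open Finite
  enc' : A ⊎ B → Fin (size F + size H)
  enc' (inj₁ a) = enc F a ↑ˡ size H
  enc' (inj₂ a) = size F ↑ʳ enc H a
  dec' : Fin (size F + size H) → A ⊎ B
  dec' i with splitAt (size F) i
  ... | inj₁ j = inj₁ (dec F j)
  ... | inj₂ j = inj₂ (dec H j)
  dec-enc' : ∀ x → dec' (enc' x) ≡ x
  dec-enc' (inj₁ a) rewrite splitAt-↑ˡ (size F) (enc F a) (size H) = cong inj₁ (dec-enc F a)
  dec-enc' (inj₂ a) rewrite splitAt-↑ʳ (size F) (size H) (enc H a) = cong inj₂ (dec-enc H a)

module _ {G : Set} (b : G) where
  open TapeMachine b

  Pos-finite : ∀ p → Finite (Pos p)
  Pos-finite (act f m)    = ⊤-finite
  Pos-finite (p » q)      = ⊎-finite (Pos-finite p) (Pos-finite q)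
  Pos-finite (cond c p q) = ⊎-finite ⊤-finite (⊎-finite (Pos-finite p) (Pos-finite q))
  Pos-finite (while c p)  = ⊎-finite ⊤-finite (Pos-finite p)

module _ {k e : ℕ} (p : Prog (Fin (suc (k + e)))) where
  open TapeMachine {Fin (suc (k + e))} zero
  open Finite (Pos-finite {Fin (suc (k + e))} zero p)

  -- A machine starts in state `zero`, so the entry of the program gets this extra code; `suc zero`
  -- is the halting state.
  decodeState : Fin (suc (suc size)) → Maybe (Pos p)
  decodeState zero          = just (entry p)
  decodeState (suc zero)    = nothing
  decodeState (suc (suc i)) = just (dec i)

  encodeState : Maybe (Pos p) → Fin (suc (suc size))
  encodeState nothing  = suc zero
  encodeState (just s) = suc (suc (enc s))

  decode-encode : ∀ o → decodeState (encodeState o) ≡ o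
  decode-encode nothing  = refl
  decode-encode (just s) = cong just (dec-enc s)

  transition : Maybe (Pos p) → Fin (suc (k + e)) →
    Maybe (Fin (suc (suc size)) × Fin (suc (k + e)) × Move)
  transition nothing  g = nothing
  transition (just s) g = just (map₁ encodeState (control p s g))

  machine : TM k
  machine = record { nQ = suc size ; e = e ; δ = λ q g → transition (decodeState q) g }

  onTape : Fin (suc (suc size)) → Tape (Fin (suc (k + e))) → Config machine
  onTape q (tape l h r) = cfg q l h r

  apply-onTape : ∀ q q' g m τ → apply machine (q' , g , m) (onTape q τ) ≡ onTape q' (moveTo m g τ)
  apply-onTape q q' g S (tape l h r) = refl
  apply-onTape q q' g L (tape [] h r) = refl
  apply-onTape q q' g L (tape (x ∷ l) h r) = refl
  apply-onTape q q' g R (tape l h []) = refl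
  apply-onTape q q' g R (tape l h (x ∷ r)) = refl

  run-Path : ∀ {t o τ τ'} q → decodeState q ≡ o → Path (control p) t o τ nothing τ' →
    run machine t (onTape q τ) ≡ just (readOut machine (head τ' ∷ right τ'))
  run-Path q eq stop rewrite eq = refl
  run-Path q eq (next {s = s} {τ = τ} π)
    rewrite eq | apply-onTape q (encodeState (proj₁ (control p s (head τ))))
                   (proj₁ (proj₂ (control p s (head τ)))) (proj₂ (proj₂ (control p s (head τ)))) τ =
    run-Path _ (decode-encode _) π

  run-Exec : ∀ {t τ τ'} → Exec p t τ τ' →
    run machine t (onTape zero τ) ≡ just (readOut machine (head τ' ∷ right τ'))
  run-Exec d = run-Path zero refl (Exec⇒Path d)

run-mono : ∀ {k} (M : TM k) {t u c y} → t ≤ u → run M t c ≡ just y → run M u c ≡ just y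
run-mono M {t} {u} {c} t≤u eq with TM.δ M (Config.state c) (Config.head c)
... | nothing = eq
run-mono M {suc t} {suc u} (s≤s t≤u) eq | just tr = run-mono M t≤u eq

readOut-length : ∀ {k} (M : TM k) gs → length (readOut M gs) ≤ length gs
readOut-length M [] = z≤n
readOut-length M (g ∷ gs) with unsym M g
... | just _ = s≤s (readOut-length M gs)
... | nothing = z≤n

apply-right : ∀ {k} (M : TM k) tr c → length (Config.right (apply M tr c)) ≤ suc (length (Config.right c))
apply-right M (q , w , S) (cfg _ l _ r) = n≤1+n _
apply-right M (q , w , L) (cfg _ [] _ r) = ≤-refl
apply-right M (q , w , L) (cfg _ (g ∷ l) _ r) = ≤-refl
apply-right M (q , w , R) (cfg _ l _ []) = z≤n
apply-right M (q , w , R) (cfg _ l _ (g ∷ r)) = ≤-trans (n≤1+n _) (n≤1+n _)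

-- The output is read from the scanned cell, which is the `suc`, to the right, and a step lengthens
-- the right part by at most one cell.
run-length : ∀ {k} (M : TM k) t c {y} → run M t c ≡ just y →
  length y ≤ suc (length (Config.right c) + t)
run-length M t c eq with TM.δ M (Config.state c) (Config.head c)
run-length M t (cfg q l h r) refl | nothing =
  ≤-trans (readOut-length M (h ∷ r)) (s≤s (m≤m+n _ t))
run-length M (suc t) c eq | just tr =
  ≤-trans (run-length M t (apply M tr c) eq)
    (s≤s (≤-trans (+-monoˡ-≤ t (apply-right M tr c)) (≤-reflexive (≡-sym (+-suc _ t)))))

initial-right : ∀ {k} (M : TM k) x → length (Config.right (initial M x)) ≤ length x
initial-right M [] = z≤n
initial-right M (a ∷ x) = ≤-trans (≤-reflexive (length-map (sym M) x)) (n≤1+n _)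

FPTIME-length : ∀ {k} {f : List (Fin k) → List (Fin k)} → FPTIME f →
  Σ Poly λ q → ∀ x → length (f x) ≤ ⟦ q ⟧ (length x)
FPTIME-length (M , p , runs) = con 1 ⊕ (var ⊕ p) , λ x →
  ≤-trans (run-length M _ _ (runs x)) (s≤s (+-monoˡ-≤ _ (initial-right M x)))

-- A concrete tape alphabet

clamp : ∀ s → ℕ → Fin (suc s)
clamp s v with v <? suc s
... | yes p = fromℕ< p
... | no _  = zero

toℕ-clamp : ∀ {s v} → v ≤ s → toℕ (clamp s v) ≡ v
toℕ-clamp {s} {v} v≤s with v <? suc s
... | yes p = toℕ-fromℕ< p
... | no ¬p = contradiction (s≤s v≤s) ¬p

record Alphabet (k : ℕ) (π : Encoding k) (M s inp : ℕ) : Set where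
  field
    e            : ℕ
    cells        : Multitrack (Fin (suc (k + e))) zero M s
  open Multitrack cells public
  letter : Fin k → Fin (suc (k + e))
  letter a = suc (a ↑ˡ e)
  field
    letter-clean : ∀ a → isEnd (letter a) ≡ false
    letter-inp   : ∀ a → track (letter a) inp ≡ suc (toℕ (Inverse.to π a))
    letter-other : ∀ a {j} → j ≢ inp → track (letter a) j ≡ 0

-- A raw input letter is read as a cell whose only non-empty track is `inp`; the
-- auxiliary tape symbols are the end marker and the M-tuples of values 0 … s.
module Cells (k s M inp : ℕ) (π : Encoding k) (k≤s : k ≤ s) (inp<M : inp < M) where

  aux : ℕ
  aux = suc (suc s ^ M)

  G : Set
  G = Fin (suc (k + aux))

  content : Fin k ⊎ Fin aux → ℕ → ℕ
  content (inj₁ a) j with j ≟ inp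
  ... | yes _ = suc (toℕ (Inverse.to π a))
  ... | no _  = 0
  content (inj₂ zero) j = 0
  content (inj₂ (suc t)) j with j <? M
  ... | yes p = toℕ (finToFun {suc s} {M} t (fromℕ< p))
  ... | no _  = 0

  trackOf : G → ℕ → ℕ
  trackOf zero    j = 0
  trackOf (suc i) j = content (splitAt k i) j

  tuple : (ℕ → ℕ) → G
  tuple F = suc (k ↑ʳ suc (funToFin {M} {suc s} (λ i → clamp s (F (toℕ i)))))

  tuple-track : ∀ F {j} → j < M → F j ≤ s → trackOf (tuple F) j ≡ F j
  tuple-track F {j} j<M F≤s
    rewrite splitAt-↑ʳ k aux (suc (funToFin {M} {suc s} (λ i → clamp s (F (toℕ i))))) with j <? M
  ... | no ¬p = contradiction j<M ¬p
  ... | yes p rewrite finToFun-funToFin {M} {suc s} (λ i → clamp s (F (toℕ i))) (fromℕ< p) | toℕ-fromℕ< p =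
    toℕ-clamp F≤s

  tuple-track-≥M : ∀ F {j} → ¬ j < M → trackOf (tuple F) j ≡ 0
  tuple-track-≥M F {j} j≮M
    rewrite splitAt-↑ʳ k aux (suc (funToFin {M} {suc s} (λ i → clamp s (F (toℕ i))))) with j <? M
  ... | yes p = contradiction p j≮M
  ... | no _ = refl

  content≤s : ∀ c j → content c j ≤ s
  content≤s (inj₁ a) j with j ≟ inp
  ... | yes _ = ≤-trans (toℕ<n (Inverse.to π a)) k≤s
  ... | no _  = z≤n
  content≤s (inj₂ zero) j = z≤n
  content≤s (inj₂ (suc t)) j with j <? M
  ... | yes p = ≤-pred (toℕ<n (finToFun {suc s} {M} t (fromℕ< p)))
  ... | no _  = z≤n

  trackOf≤s : ∀ g j → trackOf g j ≤ s
  trackOf≤s zero j = z≤n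
  trackOf≤s (suc i) j = content≤s (splitAt k i) j

  content-≥M : ∀ c {j} → ¬ j < M → content c j ≡ 0
  content-≥M (inj₁ a) {j} j≮M with j ≟ inp
  ... | yes refl = contradiction inp<M j≮M
  ... | no _ = refl
  content-≥M (inj₂ zero) j≮M = refl
  content-≥M (inj₂ (suc t)) {j} j≮M with j <? M
  ... | yes p = contradiction p j≮M
  ... | no _ = refl

  trackOf-≥M : ∀ g {j} → ¬ j < M → trackOf g j ≡ 0
  trackOf-≥M zero j≮M = refl
  trackOf-≥M (suc i) j≮M = content-≥M (splitAt k i) j≮M

  modify : ℕ → ℕ → (ℕ → ℕ) → ℕ → ℕ
  modify j v F i with i ≟ j
  ... | yes _ = v
  ... | no _  = F i

  modify-same : ∀ j v F → modify j v F j ≡ v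
  modify-same j v F with j ≟ j
  ... | yes _ = refl
  ... | no ¬p = contradiction refl ¬p

  modify-other : ∀ {i j} v F → i ≢ j → modify j v F i ≡ F i
  modify-other {i} {j} v F i≢j with i ≟ j
  ... | yes p = contradiction p i≢j
  ... | no _ = refl

  put-track : ℕ → ℕ → G → G
  put-track j v g = tuple (modify j v (trackOf g))

  put-track-same : ∀ {j v} g → j < M → v ≤ s → trackOf (put-track j v g) j ≡ v
  put-track-same {j} {v} g j<M v≤s = trans
    (tuple-track (modify j v (trackOf g)) j<M (≤-trans (≤-reflexive (modify-same j v (trackOf g))) v≤s)) (modify-same j v (trackOf g))

  put-track-other : ∀ {i j} v g → i ≢ j → trackOf (put-track j v g) i ≡ trackOf g i
  put-track-other {i} {j} v g i≢j with i <? M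
  ... | yes i<M = trans
    (tuple-track (modify j v (trackOf g)) i<M (≤-trans (≤-reflexive (modify-other v (trackOf g) i≢j)) (trackOf≤s g i)))
    (modify-other v (trackOf g) i≢j)
  ... | no i≮M = trans (tuple-track-≥M (modify j v (trackOf g)) i≮M) (≡-sym (trackOf-≥M g i≮M))

  marker : G
  marker = suc (k ↑ʳ zero)

  isMarkerᶜ : Fin k ⊎ Fin aux → Bool
  isMarkerᶜ (inj₁ _)       = false
  isMarkerᶜ (inj₂ zero)    = true
  isMarkerᶜ (inj₂ (suc _)) = false

  isMarker : G → Bool
  isMarker zero    = false
  isMarker (suc i) = isMarkerᶜ (splitAt k i)

  cells : Multitrack G zero M s
  cells = record
    { track = trackOf ; set = put-track ; end = marker ; isEnd = isMarker
    ; track-blank = λ _ → refl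
    ; track-end = λ j → cong (λ c → content c j) (splitAt-↑ʳ k aux zero)
    ; track-set-same = put-track-same ; track-set-other = put-track-other
    ; isEnd-end = cong isMarkerᶜ (splitAt-↑ʳ k aux zero)
    ; isEnd-blank = refl
    ; isEnd-set = λ j v g → cong isMarkerᶜ (splitAt-↑ʳ k aux _) }

  letterᶜ-inp : ∀ a → content (inj₁ a) inp ≡ suc (toℕ (Inverse.to π a))
  letterᶜ-inp a with inp ≟ inp
  ... | yes _ = refl
  ... | no ¬p = contradiction refl ¬p

  letterᶜ-other : ∀ a {j} → j ≢ inp → content (inj₁ a) j ≡ 0
  letterᶜ-other a {j} j≢ with j ≟ inp
  ... | yes p = contradiction p j≢
  ... | no _ = refl

  alphabet : Alphabet k π M s inp
  alphabet = record
    { e = aux ; cells = cells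
    ; letter-clean = λ a → cong isMarkerᶜ (splitAt-↑ˡ k a aux)
    ; letter-inp = λ a → trans (cong (λ c → content c inp) (splitAt-↑ˡ k a aux)) (letterᶜ-inp a)
    ; letter-other = λ a {j} j≢ → trans (cong (λ c → content c j) (splitAt-↑ˡ k a aux)) (letterᶜ-other a j≢) }

readOut-letters : ∀ {k} (M : TM k) y r → readOut M (map (sym M) y ++ zero ∷ r) ≡ y
readOut-letters M [] r = refl
readOut-letters {k} M (a ∷ y) r rewrite splitAt-↑ˡ k a (TM.e M) = cong (a ∷_) (readOut-letters M y r)

nonzero : ∀ {n} → Fin (suc n) → Bool
nonzero zero    = false
nonzero (suc _) = true

-- Functions computed by ForNo are in FPTIME

module Simulate {k : ℕ} {f : List (Fin k) → List (Fin k)} (t : Term) {inp out : Reg} {π : Encoding k}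
  (fn : ForNo t)
  (computes : ∀ x → evalT t (∅ [ inp ↦ encode π x ] , 0) ≈ (∅ [ out ↦ encode π (f x) ] , 0))
  (m : ℕ) (bndT≤m : bndT t ≤ m) (inp<m : inp < m) (out<m : out < m)
  (α : Alphabet k π (suc m + bndT t) m inp) where

  open Alphabet α

  module IO = Tracks.Compile.InputOutput cells m (s≤s (m≤m+n m (bndT t))) ≤-refl (≤-trans (s≤s z≤n) inp<m)
    {k} {inp} {out} {π} inp<m out<m letter nonzero refl (λ _ → refl) letter-clean letter-inp letter-other

  M : TM k
  M = machine {k} {e} (IO.program t)

  initial-tape : ∀ x → initial M x ≡ onTape {k} {e} (IO.program t) zero (IO.initialTape x)
  initial-tape [] = refl
  initial-tape (a ∷ x) = refl

  inFPTIME : FPTIME f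
  inFPTIME = M , IO.time t , λ x →
    case IO.program-exec t x (f x) fn bndT≤m ≤-refl (computes x) of λ { (u , τ , d , eq , u≤) →
    run-mono M {c = initial M x} u≤
      (trans (cong (run M u) (initial-tape x))
        (trans (run-Exec {k} {e} (IO.program t) d)
          (cong just (trans (cong (readOut M) eq) (readOut-letters M (f x) []))))) }

forNo⇒FPTIME : ∀ {k} {f : List (Fin k) → List (Fin k)} t inp out (π : Encoding k) → ForNo t →
  (∀ x → evalT t (∅ [ inp ↦ encode π x ] , 0) ≈ (∅ [ out ↦ encode π (f x) ] , 0)) → FPTIME f
forNo⇒FPTIME {k} t inp out π fn computes =
  Simulate.inFPTIME t fn computes m bndT≤m inp<m out<m
    (Cells.alphabet k m (suc m + bndT t) inp π k≤m (<-trans inp<m (s≤s (m≤m+n m _))))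
  where
  -- One number exceeds all registers, including `inp` and `out`, which may be absent from `t`, and
  -- bounds the symbols of `t` and the letter codes. It is both the number of register tracks and
  -- the largest cell value; the other tracks hold the counter and up to `bndT t` nested loops.
  m : ℕ
  m = bndT t + (suc inp + (suc out + k))

  bndT≤m : bndT t ≤ m
  bndT≤m = m≤m+n _ _

  inp<m : inp < m
  inp<m = ≤-trans (m≤m+n (suc inp) _) (m≤n+m _ (bndT t))

  out<m : out < m
  out<m = ≤-trans (≤-trans (m≤m+n (suc out) _) (m≤n+m _ (suc inp))) (m≤n+m _ (bndT t))

  k≤m : k ≤ m
  k≤m = ≤-trans (≤-trans (m≤n+m k (suc out)) (m≤n+m _ (suc inp))) (m≤n+m _ (bndT t))

-- Building blocks for simulating machines in ForNo

each : ∀ n → (Fin n → Body) → Body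
each zero    b = atom SKIP
each (suc n) b = b zero ⨾ each n (λ i → b (suc i))

clauses : ∀ n → (Fin n → Body) → Clauses
clauses zero    b = one (atom SKIP)
clauses (suc n) b = cons (b zero) (clauses n (λ i → b (suc i)))

times : ℕ → Body → Body
times zero    b = atom SKIP
times (suc n) b = b ⨾ times n b

clock : Reg → Poly → Body → Body
clock x var     b = FOR x (one b)
clock x (con c) b = times c b
clock x (p ⊕ q) b = clock x p b ⨾ clock x q b
clock x (p ⊗ q) b = clock x p (clock x q b)

evalB-IF-yes : ∀ {x n s ω} → top (proj₁ ω x) ≡ just n → evalB (IF x n s) ω ≡ evalB s ω
evalB-IF-yes {x} {n} {ω = ω} e with top (proj₁ ω x) ≟ᵐ just n
... | yes _ = refl
... | no ¬e = contradiction e ¬e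

evalB-IF-no : ∀ {x n s ω} → top (proj₁ ω x) ≢ just n → evalB (IF x n s) ω ≡ ω
evalB-IF-no {x} {n} {ω = ω} ¬e with top (proj₁ ω x) ≟ᵐ just n
... | yes e = contradiction e ¬e
... | no _ = refl

evalB≡⇒⇓B : ∀ s ω {ω'} → evalB s ω ≡ ω' → (s , ω) ⇓B ω'
evalB≡⇒⇓B s ω refl = ⇓B-evalB s ω

loop≡⇒FOR : ∀ x c ω {s ω'} → proj₁ ω x ≡ s → loop (evalC c) s ω ≡ ω' → (FOR x c , ω) ⇓B ω'
loop≡⇒FOR x c ω refl refl = for (Loop-loop c _ ω)

loop≡⇒ROF : ∀ x c ω {s ω'} → proj₁ ω x ≡ s → loop (evalC c) (reverse s) ω ≡ ω' → (ROF x c , ω) ⇓B ω'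
loop≡⇒ROF x c ω refl refl = rof (Loop-loop c _ ω)

evalB-POP : ∀ {φ x n s} → φ x ≡ n ∷ s → evalB (atom (POP n x)) (φ , 0) ≡ (φ [ x ↦ s ] , 0)
evalB-POP {φ} {x} {n} {s} e = cong (λ (s' , c) → φ [ x ↦ s' ] , c) (trans (cong (λ s' → pop n (s' , 0)) e) pop-top)
  where
  pop-top : pop n (n ∷ s , 0) ≡ (s , 0)
  pop-top with n ≟ n
  ... | yes _ = refl
  ... | no ¬p = contradiction refl ¬p

module _ {x : Reg} where

  each-IF-none : ∀ n {lab : Fin n → ℕ} {b : Fin n → Body} {ω} → (∀ c → top (proj₁ ω x) ≢ just (lab c)) →
    evalB (each n (λ c → IF x (lab c) (b c))) ω ≡ ω
  each-IF-none zero ¬e = refl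
  each-IF-none (suc n) {lab} {b} {ω} ¬e = trans
    (cong (evalB (each n (λ c → IF x (lab (suc c)) (b (suc c))))) (evalB-IF-no {s = b zero} {ω} (¬e zero)))
    (each-IF-none n (λ c → ¬e (suc c)))

  -- The tests are made one after another and do not exclude each other by form. The chosen body
  -- leaves the leader alone and labels are distinct, so no later test succeeds.
  each-IF : ∀ n {lab : Fin n → ℕ} {b : Fin n → Body} {ω} → (∀ {c d} → lab c ≡ lab d → c ≡ d) →
    (∀ c → x ∉ writtenB (b c)) → ∀ c → top (proj₁ ω x) ≡ just (lab c) →
    evalB (each n (λ c → IF x (lab c) (b c))) ω ≡ evalB (b c) ω
  each-IF (suc n) {lab} {b} {ω} inj x∉ zero e = trans
    (cong (evalB (each n (λ c → IF x (lab (suc c)) (b (suc c))))) (evalB-IF-yes {s = b zero} {ω} e))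
    (each-IF-none n λ c e' → contradiction
      (inj (just-injective (trans (≡-sym e) (trans (cong top (≡-sym (evalB-unwritten (b zero) ω (x∉ zero)))) e')))) λ ())
  each-IF (suc n) {lab} {b} {ω} inj x∉ (suc c) e = trans
    (cong (evalB (each n (λ c → IF x (lab (suc c)) (b (suc c)))))
      (evalB-IF-no {s = b zero} {ω} (λ e' → Fin.0≢1+n (inj (just-injective (trans (≡-sym e') e))))))
    (each-IF n (λ eq → Fin.suc-injective (inj eq)) (λ c → x∉ (suc c)) c e)

evalC-clauses : ∀ n (b : Fin n → Body) a ω → evalC (clauses n b) (toℕ a) ω ≡ evalB (b a) ω
evalC-clauses (suc n) b zero ω = refl
evalC-clauses (suc n) b (suc a) ω = evalC-clauses n (λ i → b (suc i)) a ω

iter : ∀ {A : Set} → ℕ → (A → A) → A → A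
iter zero    f a = a
iter (suc n) f a = iter n f (f a)

iter-+ : ∀ {A : Set} m n (f : A → A) a → iter (m + n) f a ≡ iter n f (iter m f a)
iter-+ zero n f a = refl
iter-+ (suc m) n f a = iter-+ m n f (f a)

times-eval : ∀ c b ω → evalB (times c b) ω ≡ iter c (evalB b) ω
times-eval zero b ω = refl
times-eval (suc c) b ω = times-eval c b (evalB b ω)

loop-one : ∀ b s ω → loop (evalC (one b)) s ω ≡ iter (length s) (evalB b) ω
loop-one b [] ω = refl
loop-one b (_ ∷ s) ω = loop-one b s (evalB b ω)

times-written : ∀ c b {P : Reg → Set} → All P (writtenB b) → All P (writtenB (times c b))
times-written zero b _ = []
times-written (suc c) b all = All-++⁺ all (times-written c b all)

clock-written : ∀ x p b {P : Reg → Set} → All P (writtenB b) → All P (writtenB (clock x p b))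
clock-written x var b all = all
clock-written x (con c) b all = times-written c b all
clock-written x (p ⊕ q) b all = All-++⁺ (clock-written x p b all) (clock-written x q b all)
clock-written x (p ⊗ q) b all = clock-written x p (clock x q b) (clock-written x q b all)

All⇒∉ : ∀ {P : Reg → Set} {x xs} → All P xs → ¬ P x → x ∉ xs
All⇒∉ all ¬px x∈ = ¬px (All.lookup all x∈)

-- The body does not write `x`, so every nested loop finds the same length; sums become sequencing
-- and products nesting.
clock-eval : ∀ {x n} p b ω → All (_≢ x) (writtenB b) → length (proj₁ ω x) ≡ n →
  evalB (clock x p b) ω ≡ iter (⟦ p ⟧ n) (evalB b) ω
clock-eval {x} var b ω x∉ refl = loop-one b (proj₁ ω x) ω
clock-eval (con c) b ω x∉ len = times-eval c b ω
clock-eval {x} {n} (p ⊕ q) b ω x∉ len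
  rewrite clock-eval q b (evalB (clock x p b) ω) x∉
            (trans (cong length (evalB-unwritten (clock x p b) ω (All⇒∉ (clock-written x p b x∉) (λ ¬p → ¬p refl)))) len)
        | clock-eval p b ω x∉ len = ≡-sym (iter-+ (⟦ p ⟧ n) (⟦ q ⟧ n) (evalB b) ω)
clock-eval {x} {n} (p ⊗ q) b ω x∉ len =
  trans (clock-eval p (clock x q b) ω (clock-written x q b x∉) len) (go (⟦ p ⟧ n) ω len)
  where
  go : ∀ m ω → length (proj₁ ω x) ≡ n →
    iter m (evalB (clock x q b)) ω ≡ iter (m * ⟦ q ⟧ n) (evalB b) ω
  go zero ω len = refl
  go (suc m) ω len = trans
    (go m (evalB (clock x q b) ω)
      (trans (cong length (evalB-unwritten (clock x q b) ω (All⇒∉ (clock-written x q b x∉) (λ ¬p → ¬p refl)))) len))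
    (trans (cong (iter (m * ⟦ q ⟧ n) (evalB b)) (clock-eval q b ω x∉ len))
      (≡-sym (iter-+ (⟦ q ⟧ n) (m * ⟦ q ⟧ n) (evalB b) ω)))

-- `P` restricts all registers that occur, `Q` those leading iterations. Taking `_≢ x` for `P`
-- yields the non-writing conditions of `ForNo`.
record Ok (P Q : Reg → Set) (s : Body) : Set where
  constructor ok
  field
    regs    : RegsB P s
    leaders : All Q (iterLeadersB s)
    wf      : WfB s

mutual
  RegsB-written : ∀ {P} s → RegsB P s → All P (writtenB s)
  RegsB-written (atom SKIP) r = []
  RegsB-written (atom (PUSH n x)) r = r ∷ []
  RegsB-written (atom (POP n x)) r = r ∷ []
  RegsB-written (s ⨾ t) (r , r') = All-++⁺ (RegsB-written s r) (RegsB-written t r')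
  RegsB-written (IF x n s) (_ , r) = RegsB-written s r
  RegsB-written (FOR x c) (_ , r) = RegsC-written c r
  RegsB-written (ROF x c) (_ , r) = RegsC-written c r

  RegsC-written : ∀ {P} c → RegsC P c → All P (writtenC c)
  RegsC-written (one s) r = RegsB-written s r
  RegsC-written (cons s c) (r , r') = All-++⁺ (RegsB-written s r) (RegsC-written c r')

Ok-∉ : ∀ {x Q s} → Ok (_≢ x) Q s → x ∉ writtenB s
Ok-∉ {s = s} o = All⇒∉ (RegsB-written s (Ok.regs o)) (λ ¬p → ¬p refl)

module _ {P Q : Reg → Set} where

  ok-atom : ∀ {a} → RegsA P a → Ok P Q (atom a)
  ok-atom r = ok r [] tt

  ok-⨾ : ∀ {s t} → Ok P Q s → Ok P Q t → Ok P Q (s ⨾ t)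
  ok-⨾ (ok r l w) (ok r' l' w') = ok (r , r') (All-++⁺ l l') (w , w')

  ok-IF : ∀ {x n s} → P x → x ∉ writtenB s → Ok P Q s → Ok P Q (IF x n s)
  ok-IF px x∉ (ok r l w) = ok (px , r) l (x∉ , w)

  ok-each-IF : ∀ {x} n (lab : Fin n → ℕ) (b : Fin n → Body) → P x → (∀ c → x ∉ writtenB (b c)) →
    (∀ c → Ok P Q (b c)) → Ok P Q (each n (λ c → IF x (lab c) (b c)))
  ok-each-IF zero lab b px x∉ o = ok-atom tt
  ok-each-IF (suc n) lab b px x∉ o = ok-⨾ (ok-IF px (x∉ zero) (o zero))
    (ok-each-IF n (λ c → lab (suc c)) (λ c → b (suc c)) px (λ c → x∉ (suc c)) (λ c → o (suc c)))

  ok-clauses : ∀ n {b} → (∀ i → Ok P Q (b i)) →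
    RegsC P (clauses n b) × All Q (iterLeadersC (clauses n b)) × WfC (clauses n b)
  ok-clauses zero o = tt , [] , tt
  ok-clauses (suc n) o with o zero | ok-clauses n (λ i → o (suc i))
  ... | ok r l w | r' , l' , w' = (r , r') , All-++⁺ l l' , (w , w')

  ok-times : ∀ c {b} → Ok P Q b → Ok P Q (times c b)
  ok-times zero o = ok-atom tt
  ok-times (suc c) o = ok-⨾ o (ok-times c o)

  ok-clock : ∀ {x} p {b} → P x → Q x → All (_≢ x) (writtenB b) → Ok P Q b → Ok P Q (clock x p b)
  ok-clock var px qx x∉ (ok r l w) = ok (px , r) (qx ∷ l) (All⇒∉ x∉ (λ ¬p → ¬p refl) , w)
  ok-clock (con c) px qx x∉ o = ok-times c o
  ok-clock (p ⊕ q) px qx x∉ o = ok-⨾ (ok-clock p px qx x∉ o) (ok-clock q px qx x∉ o)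
  ok-clock {x} (p ⊗ q) {b} px qx x∉ o = ok-clock p px qx (clock-written x q b x∉) (ok-clock q px qx x∉ o)

module _ {P Q : Reg → Set} {x : Reg} (n : ℕ) {b : Fin n → Body} (px : P x) (qx : Q x)
  (o : ∀ i → Ok P Q (b i)) (o' : ∀ i → Ok (_≢ x) All-regs (b i)) where

  ok-FOR : Ok P Q (FOR x (clauses n b))
  ok-FOR with ok-clauses n o | ok-clauses n o'
  ... | r , l , w | r' , _ , _ = ok (px , r) (qx ∷ l) (All⇒∉ (RegsC-written (clauses n b) r') (λ ¬p → ¬p refl) , w)

  ok-ROF : Ok P Q (ROF x (clauses n b))
  ok-ROF = ok (Ok.regs ok-FOR) (Ok.leaders ok-FOR) (Ok.wf ok-FOR)

record Changed (φ φ' : Store) (x : Reg) (s : Stack) : Set where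
  constructor changed
  field
    at        : φ' x ≡ s
    elsewhere : ∀ y → y ≢ x → φ' y ≡ φ y

iter-PUSH : ∀ m n x φ → ∃[ φ' ]
  (iter m (evalB (atom (PUSH n x))) (φ , 0) ≡ (φ' , 0) × Changed φ φ' x (replicate m n ++ φ x))
iter-PUSH zero n x φ = φ , refl , changed refl (λ _ _ → refl)
iter-PUSH (suc m) n x φ with iter-PUSH m n x (φ [ x ↦ n ∷ φ x ])
... | φ' , eq , changed e e' = φ' , eq ,
  changed (trans e (trans (cong (replicate m n ++_) (update-same φ x _)) (replicate-snoc m)))
    (λ y y≢ → trans (e' y y≢) (update-other φ _ y≢))
  where
  replicate-snoc : ∀ m → replicate m n ++ n ∷ φ x ≡ n ∷ replicate m n ++ φ x
  replicate-snoc zero = refl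
  replicate-snoc (suc m) = cong (n ∷_) (replicate-snoc m)

loop-PUSH : ∀ k (v : Fin k → ℕ) x (as : List (Fin k)) φ → ∃[ φ' ]
  (loop (evalC (clauses k (λ a → atom (PUSH (v a) x)))) (map toℕ as) (φ , 0) ≡ (φ' , 0)
   × Changed φ φ' x (map v as ʳ++ φ x))
loop-PUSH k v x [] φ = φ , refl , changed refl (λ _ _ → refl)
loop-PUSH k v x (a ∷ as) φ
  rewrite evalC-clauses k (λ a → atom (PUSH (v a) x)) a (φ , 0) with loop-PUSH k v x as (φ [ x ↦ v a ∷ φ x ])
... | φ' , eq , changed e e' = φ' , eq ,
  changed (trans e (cong (map v as ʳ++_) (update-same φ x _)))
    (λ y y≢ → trans (e' y y≢) (update-other φ _ y≢))

-- Work registers: the scanned cell together with the state, the two halves of the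
-- tape, the history, the flag ending the output, and the reversed output.
rA rL rR rH rF rO : Reg
rA = 2
rL = 3
rR = 4
rH = 5
rF = 6
rO = 7

-- Reversible simulation of a machine

module Simulation {k : ℕ} (M : TM k) where
  open TM M

  nS nG : ℕ
  nS = suc nQ
  nG = suc (k + e)

  -- State and symbol share a stack entry because a selection looks at a single top symbol, while a
  -- transition depends on both.
  code : Fin nS → Fin nG → ℕ
  code q g = toℕ (combine q g)

  -- A `POP` has to name its symbol. Since `q` is fixed, the code pushed on `rA` in the first round
  -- identifies the symbol that the second round removes from `X`.
  fetch : Fin nS → Reg → Body
  fetch q X = each nG (λ g → IF X (toℕ g) (atom (PUSH (code q g) rA)))
            ⨾ each nG (λ g → IF rA (code q g) (atom (POP (toℕ g) X)))

  moveB : Fin nS → Fin nG → Move → Body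
  moveB q w S = atom (PUSH (code q w) rA)
  moveB q w L = atom (PUSH (toℕ w) rR) ⨾ fetch q rL
  moveB q w R = atom (PUSH (toℕ w) rL) ⨾ fetch q rR

  -- In a halting configuration nothing happens beyond the log entry, so the clock may run on after
  -- the machine has stopped.
  transitionB : Maybe (Fin nS × Fin nG × Move) → ℕ → Body
  transitionB nothing            c = atom SKIP
  transitionB (just (q , w , m)) c = atom (POP c rA) ⨾ moveB q w m

  actionB : Fin (nS * nG) → Body
  actionB c = transitionB (uncurry δ (remQuot nG c)) (toℕ c)

  -- The current state and symbol are logged in the history, and the transition is
  -- selected by the log entry, which the transition itself does not write.
  stepB : Body
  stepB = each (nS * nG) (λ c → IF rA (toℕ c) (atom (PUSH (toℕ c) rH)))
        ⨾ each (nS * nG) (λ c → IF rH (toℕ c) (actionB c))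

  -- The output of the machine begins at the scanned cell, so its symbol is put back on the right
  -- half-tape. The entry on `rA` stays until everything is undone.
  unfetch : Body
  unfetch = each (nS * nG) (λ c → IF rA (toℕ c) (atom (PUSH (toℕ (proj₂ (remQuot {nS} nG c))) rR)))

  code-injective : ∀ q {g h} → code q g ≡ code q h → g ≡ h
  code-injective q {g} {h} eq = combine-injectiveʳ q g q h (toℕ-injective eq)

  fetch-eval : ∀ q {X φ} g {s} → X ≢ rA → φ rA ≡ [] → φ X ≡ toℕ g ∷ s →
    evalB (fetch q X) (φ , 0) ≡ ((φ [ rA ↦ code q g ∷ [] ]) [ X ↦ s ] , 0)
  fetch-eval q {X} {φ} g {s} X≢ eA eX = trans
    (cong (evalB (each nG (λ g → IF rA (code q g) (atom (POP (toℕ g) X)))))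
      (trans (each-IF nG {b = λ g → atom (PUSH (code q g) rA)} toℕ-injective (λ { _ (here e) → X≢ e }) g (cong top eX))
        (cong (λ s' → φ [ rA ↦ code q g ∷ s' ] , 0) eA)))
    (trans (each-IF nG {b = λ g → atom (POP (toℕ g) X)} (code-injective q) (λ { _ (here e) → X≢ (≡-sym e) }) g refl)
      (evalB-POP (trans (update-other φ _ X≢) eX)))

  Cfg : Set
  Cfg = Config M

  stepC : Cfg → Cfg
  stepC c with δ (Config.state c) (Config.head c)
  ... | nothing = c
  ... | just tr = apply M tr c

  iter-halted : ∀ t c → δ (Config.state c) (Config.head c) ≡ nothing → iter t stepC c ≡ c
  iter-halted zero c e = refl
  iter-halted (suc t) c e = trans (cong (iter t stepC) (stepC-halted c e)) (iter-halted t c e)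
    where
    stepC-halted : ∀ c → δ (Config.state c) (Config.head c) ≡ nothing → stepC c ≡ c
    stepC-halted c e with δ (Config.state c) (Config.head c)
    stepC-halted c e | nothing = refl
    stepC-halted c () | just _

  run-iter : ∀ t c {y} → run M t c ≡ just y → output M (iter t stepC c) ≡ y
  run-iter t c eq with δ (Config.state c) (Config.head c) in eqδ
  run-iter t c eq | nothing = trans (cong (output M) (iter-halted t c eqδ)) (just-injective eq)
  run-iter (suc t) c eq | just tr = trans (cong (λ c' → output M (iter t stepC c')) step≡) (run-iter t (apply M tr c) eq)
    where
    step≡ : stepC c ≡ apply M tr c
    step≡ rewrite eqδ = refl

  hd : List (Fin nG) → Fin nG
  hd []      = zero
  hd (g ∷ _) = g

  tl : List (Fin nG) → List (Fin nG)
  tl []      = []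
  tl (_ ∷ l) = l

  -- s holds the half-tape l followed by at least n blanks.
  Padded : ℕ → List (Fin nG) → Stack → Set
  Padded n l s = ∃[ a ] (n ≤ a × s ≡ map toℕ l ++ replicate a 0)

  Padded-∷ : ∀ {n l s} g → Padded n l s → Padded n (g ∷ l) (toℕ g ∷ s)
  Padded-∷ g (a , le , eq) = a , le , cong (toℕ g ∷_) eq

  Padded-pred : ∀ {n l s} → Padded (suc n) l s → Padded n l s
  Padded-pred (a , le , eq) = a , <⇒≤ le , eq

  Padded-uncons : ∀ {n} l {s} → Padded (suc n) l s → ∃[ s' ] (s ≡ toℕ (hd l) ∷ s' × Padded n (tl l) s')
  Padded-uncons [] (suc a , s≤s le , eq) = _ , eq , a , le , refl
  Padded-uncons (g ∷ l) (a , le , eq) = _ , eq , a , <⇒≤ le , refl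

  -- `n` is the number of steps still to come: a step uses up at most one padding blank on each
  -- side.
  record Sim (n : ℕ) (c : Cfg) (φ : Store) : Set where
    constructor sim
    field
      scanned : φ rA ≡ code (Config.state c) (Config.head c) ∷ []
      left    : Padded n (Config.left c) (φ rL)
      right   : Padded n (Config.right c) (φ rR)
      flag    : φ rF ≡ []
      result  : φ rO ≡ []

  apply-L : ∀ q w q' l h r → apply M (q , w , L) (cfg q' l h r) ≡ cfg q (tl l) (hd l) (w ∷ r)
  apply-L q w q' [] h r = refl
  apply-L q w q' (_ ∷ l) h r = refl

  apply-R : ∀ q w q' l h r → apply M (q , w , R) (cfg q' l h r) ≡ cfg q (w ∷ l) (hd r) (tl r)
  apply-R q w q' l h [] = refl
  apply-R q w q' l h (_ ∷ r) = refl

  ok-fetch : ∀ {P Q : Reg → Set} q X → X ≢ rA → P rA → P X → Ok P Q (fetch q X)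
  ok-fetch q X X≢ pA pX = ok-⨾
    (ok-each-IF nG toℕ (λ g → atom (PUSH (code q g) rA)) pX (λ { _ (here e) → X≢ e }) (λ _ → ok-atom pA))
    (ok-each-IF nG (code q) (λ g → atom (POP (toℕ g) X)) pA (λ { _ (here e) → X≢ (≡-sym e) }) (λ _ → ok-atom pX))

  ok-move : ∀ {P Q : Reg → Set} q w m → P rA → P rL → P rR → Ok P Q (moveB q w m)
  ok-move q w L pA pL pR = ok-⨾ (ok-atom pR) (ok-fetch q rL (λ ()) pA pL)
  ok-move q w R pA pL pR = ok-⨾ (ok-atom pL) (ok-fetch q rR (λ ()) pA pR)
  ok-move q w S pA pL pR = ok-atom pA

  ok-transition : ∀ {P Q : Reg → Set} tr c → P rA → P rL → P rR → Ok P Q (transitionB tr c)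
  ok-transition nothing c pA pL pR = ok-atom tt
  ok-transition (just (q , w , m)) c pA pL pR = ok-⨾ (ok-atom pA) (ok-move q w m pA pL pR)

  ok-action : ∀ {P Q : Reg → Set} c → P rA → P rL → P rR → Ok P Q (actionB c)
  ok-action c = ok-transition (uncurry δ (remQuot nG c)) (toℕ c)

  ok-step : ∀ {P Q : Reg → Set} → P rA → P rL → P rR → P rH → Ok P Q stepB
  ok-step pA pL pR pH = ok-⨾
    (ok-each-IF (nS * nG) toℕ (λ c → atom (PUSH (toℕ c) rH)) pA (λ { _ (here ()) }) (λ _ → ok-atom pH))
    (ok-each-IF (nS * nG) toℕ actionB pH
      (λ c → Ok-∉ {Q = All-regs} (ok-action c (λ ()) (λ ()) (λ ()))) (λ c → ok-action c pA pL pR))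

  ok-unfetch : ∀ {P Q : Reg → Set} → P rA → P rR → Ok P Q unfetch
  ok-unfetch pA pR = ok-each-IF (nS * nG) toℕ (λ c → atom (PUSH (toℕ (proj₂ (remQuot {nS} nG c))) rR))
    pA (λ { _ (here ()) }) (λ _ → ok-atom pR)

  move-eval : ∀ {n q l h r φ} q' w m → φ rA ≡ [] → Padded (suc n) l (φ rL) → Padded (suc n) r (φ rR) →
    φ rF ≡ [] → φ rO ≡ [] →
    ∃[ φ' ] (evalB (moveB q' w m) (φ , 0) ≡ (φ' , 0) × Sim n (apply M (q' , w , m) (cfg q l h r)) φ')
  move-eval {φ = φ} q' w S eA pL pR eF eO = _ , refl ,
    sim (cong (code q' w ∷_) eA) (Padded-pred pL) (Padded-pred pR) eF eO
  move-eval {n} {q} {l} {h} {r} {φ} q' w L eA pL pR eF eO with Padded-uncons l pL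
  ... | s' , eL , pL' = _ , fetch-eval q' {rL} {φ [ rR ↦ toℕ w ∷ φ rR ]} (hd l) (λ ()) eA eL ,
    subst (λ c → Sim n c _) (≡-sym (apply-L q' w q l h r)) (sim refl pL' (Padded-∷ w (Padded-pred pR)) eF eO)
  move-eval {n} {q} {l} {h} {r} {φ} q' w R eA pL pR eF eO with Padded-uncons r pR
  ... | s' , eR , pR' = _ , fetch-eval q' {rR} {φ [ rL ↦ toℕ w ∷ φ rL ]} (hd r) (λ ()) eA eR ,
    subst (λ c → Sim n c _) (≡-sym (apply-R q' w q l h r)) (sim refl (Padded-∷ w (Padded-pred pL)) pR' eF eO)

  transition-eval : ∀ {n φ} q l h r → Sim (suc n) (cfg q l h r) φ →
    ∃[ φ' ] (evalB (transitionB (δ q h) (code q h)) (φ , 0) ≡ (φ' , 0) × Sim n (stepC (cfg q l h r)) φ')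
  transition-eval {n} {φ} q l h r (sim eA pL pR eF eO) with δ q h
  ... | nothing = φ , refl , sim eA (Padded-pred pL) (Padded-pred pR) eF eO
  ... | just (q' , w , m)
    rewrite evalB-POP {φ} {rA} eA = move-eval {φ = φ [ rA ↦ [] ]} q' w m refl pL pR eF eO

  step-eval : ∀ {n c φ} → Sim (suc n) c φ →
    ∃[ φ' ] (evalB stepB (φ , 0) ≡ (φ' , 0) × Sim n (stepC c) φ')
  step-eval {n} {cfg q l h r} {φ} (sim eA pL pR eF eO)
    with transition-eval {n} {φ [ rH ↦ code q h ∷ φ rH ]} q l h r (sim eA pL pR eF eO)
  ... | φ' , eq , s = φ' , trans
    (cong (evalB (each (nS * nG) (λ c → IF rH (toℕ c) (actionB c))))
      (each-IF (nS * nG) {b = λ c → atom (PUSH (toℕ c) rH)} toℕ-injective (λ { _ (here ()) }) (combine q h) (cong top eA)))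
    (trans (each-IF (nS * nG) {b = actionB} {ω = φ [ rH ↦ code q h ∷ φ rH ] , 0} toℕ-injective
        (λ c → Ok-∉ {Q = All-regs} (ok-action c (λ ()) (λ ()) (λ ()))) (combine q h) refl)
      (trans (cong (λ qh → evalB (transitionB (uncurry δ qh) (code q h)) (φ [ rH ↦ code q h ∷ φ rH ] , 0))
                   (remQuot-combine q h)) eq)) , s

  steps-eval : ∀ t {c φ} → Sim t c φ →
    ∃[ φ' ] (iter t (evalB stepB) (φ , 0) ≡ (φ' , 0) × Sim 0 (iter t stepC c) φ')
  steps-eval zero s = _ , refl , s
  steps-eval (suc t) s with step-eval s
  ... | φ₁ , eq₁ , s₁ with steps-eval t s₁
  ... | φ₂ , eq₂ , s₂ = φ₂ , trans (cong (iter t (evalB stepB)) eq₁) eq₂ , s₂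

  unfetch-eval : ∀ {c φ} → Sim 0 c φ → ∃[ φ' ] ∃[ a ] (evalB unfetch (φ , 0) ≡ (φ' , 0) ×
    φ' rR ≡ map toℕ (Config.head c ∷ Config.right c) ++ replicate a 0 × φ' rF ≡ [] × φ' rO ≡ [])
  unfetch-eval {cfg q l h r} {φ} (sim eA pL (a , _ , eR) eF eO) = _ , a ,
    trans (each-IF (nS * nG) {b = λ c → atom (PUSH (toℕ (proj₂ (remQuot {nS} nG c))) rR)}
        toℕ-injective (λ { _ (here ()) }) (combine q h) (cong top eA))
      (cong (λ qh → φ [ rR ↦ toℕ (proj₂ qh) ∷ φ rR ] , 0) (remQuot-combine q h)) ,
    cong (toℕ h ∷_) eR , eF , eO

  module _ (inR : Reg) (inR<2 : inR < 2) (p : Poly) where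

    -- One blank per step of the clock, and one more for the initial fetch, which on an empty input
    -- already takes a blank.
    padP : Poly
    padP = con 1 ⊕ p

    copyInC : Clauses
    copyInC = clauses k (λ a → atom (PUSH (toℕ (sym M a)) rR))

    -- `ROF` begins with the last letter, so the first letter ends up on top, with the padding
    -- underneath.
    copyInB : Body
    copyInB = ROF inR copyInC

    loadB : Body
    loadB = clock inR padP (atom (PUSH 0 rL))
          ⨾ (clock inR padP (atom (PUSH 0 rR))
          ⨾ copyInB)

    stepsB : Body
    stepsB = clock inR p stepB ⨾ (unfetch ⨾ atom (PUSH 0 rF))

    simulateB : Body
    simulateB = loadB ⨾ (fetch zero rR ⨾ stepsB)

    work≢in : ∀ {y} → 2 ≤ y → y ≢ inR
    work≢in le refl = <⇒≱ inR<2 le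

    in≢work : ∀ {y} → 2 ≤ y → inR ≢ y
    in≢work le e = work≢in le (≡-sym e)

    2≤ : ∀ {n} → 2 ≤ suc (suc n)
    2≤ = s≤s (s≤s z≤n)

    initial-hd : ∀ x → initial M x ≡ cfg zero [] (hd (map (sym M) x)) (tl (map (sym M) x))
    initial-hd [] = refl
    initial-hd (a ∷ x) = refl

    record Loaded (x : List (Fin k)) (φ : Store) : Set where
      field
        input : φ inR ≡ map toℕ x
        left  : φ rL ≡ replicate (suc (⟦ p ⟧ (length x))) 0
        right : φ rR ≡ map toℕ (map (sym M) x) ++ replicate (suc (⟦ p ⟧ (length x))) 0
        empty : ∀ z → 2 ≤ z → z ≢ rL → z ≢ rR → φ z ≡ []

    load-eval : ∀ x φ → φ inR ≡ map toℕ x → (∀ z → 2 ≤ z → φ z ≡ []) →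
      ∃[ φ' ] ((loadB , (φ , 0)) ⇓B (φ' , 0) × Loaded x φ')
    load-eval x φ eIn empty
      with iter-PUSH (suc (⟦ p ⟧ (length x))) 0 rL φ
    ... | φ₁ , eq₁ , changed at₁ else₁
      with iter-PUSH (suc (⟦ p ⟧ (length x))) 0 rR φ₁
    ... | φ₂ , eq₂ , changed at₂ else₂
      with loop-PUSH k (λ a → toℕ (sym M a)) rR (reverse x) φ₂
    ... | φ₃ , eq₃ , changed at₃ else₃ = φ₃ ,
      seq (evalB≡⇒⇓B (clock inR padP (atom (PUSH 0 rL))) (φ , 0)
          (trans (clock-eval padP _ (φ , 0) (work≢in 2≤ ∷ []) (trans (cong length eIn) (length-map toℕ x))) eq₁))
        (seq (evalB≡⇒⇓B (clock inR padP (atom (PUSH 0 rR))) (φ₁ , 0)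
            (trans (clock-eval padP _ (φ₁ , 0) (work≢in 2≤ ∷ []) (trans (cong length in₁) (length-map toℕ x))) eq₂))
          (loop≡⇒ROF inR copyInC (φ₂ , 0) in₂
            (trans (cong (λ s → loop (evalC copyInC) s (φ₂ , 0)) (≡-sym (reverse-map toℕ x))) eq₃))) ,
      record
        { input = trans (else₃ inR (in≢work 2≤)) in₂
        ; left = trans (else₃ rL (λ ())) (trans (else₂ rL (λ ())) (trans at₁
            (trans (cong (replicate (suc (⟦ p ⟧ (length x))) 0 ++_) (empty rL 2≤)) (++-identityʳ _))))
        ; right = trans at₃ (trans (ʳ++-defn (map (λ a → toℕ (sym M a)) (reverse x)))
            (cong₂ _++_
              (trans (cong reverse (reverse-map (λ a → toℕ (sym M a)) x))
                (trans (reverse-involutive (map (λ a → toℕ (sym M a)) x)) (map-∘ x)))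
              (trans at₂ (trans (cong (replicate (suc (⟦ p ⟧ (length x))) 0 ++_) (trans (else₁ rR (λ ())) (empty rR 2≤)))
                (++-identityʳ _)))))
        ; empty = λ z le z≢L z≢R → trans (else₃ z z≢R) (trans (else₂ z z≢R) (trans (else₁ z z≢L) (empty z le)))
        }
      where
      in₁ : φ₁ inR ≡ map toℕ x
      in₁ = trans (else₁ inR (in≢work 2≤)) eIn

      in₂ : φ₂ inR ≡ map toℕ x
      in₂ = trans (else₂ inR (in≢work 2≤)) in₁

    step-written : All (_≢ inR) (writtenB stepB)
    step-written = RegsB-written stepB (Ok.regs (ok-step {Q = All-regs} (work≢in 2≤) (work≢in 2≤) (work≢in 2≤) (work≢in 2≤)))

    simulate-eval : ∀ x {y} φ → φ inR ≡ map toℕ x → (∀ z → 2 ≤ z → φ z ≡ []) →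
      run M (⟦ p ⟧ (length x)) (initial M x) ≡ just y →
      ∃[ φ' ] ∃[ gs ] ∃[ a ] ((simulateB , (φ , 0)) ⇓B (φ' , 0) × φ' rR ≡ map toℕ gs ++ replicate a 0 × readOut M gs ≡ y
        × φ' rF ≡ 0 ∷ [] × φ' rO ≡ [])
    simulate-eval x {y} φ eIn empty halts =
      case load-eval x φ eIn empty of λ { (φ₃ , d₃ , loaded) →
      case Padded-uncons {n = P} (map (sym M) x) (suc P , ≤-refl , Loaded.right loaded) of λ { (s' , eqR , padR) →
      case steps-eval P (start φ₃ s' loaded padR) of λ { (φ₄ , eq₄ , sim₄) →
      case unfetch-eval sim₄ of λ { (φ₅ , a , eq₅ , eR , eF , eO) →
      φ₅ [ rF ↦ 0 ∷ φ₅ rF ] , _ , a ,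
      seq d₃
        (seq (evalB≡⇒⇓B (fetch zero rR) (φ₃ , 0)
          (fetch-eval zero {rR} {φ₃} (hd (map (sym M) x)) (λ ()) (Loaded.empty loaded rA 2≤ (λ ()) (λ ())) eqR))
          (seq (evalB≡⇒⇓B (clock inR p stepB) (fetched φ₃ s' , 0)
            (trans (clock-eval p stepB (fetched φ₃ s' , 0) step-written
              (trans (cong length (input φ₃ s' loaded)) (length-map toℕ x))) eq₄))
            (seq (evalB≡⇒⇓B unfetch (φ₄ , 0) eq₅) atom))) ,
      eR , run-iter P (initial M x) halts , cong (0 ∷_) eF , eO }}}}
      where
      P : ℕ
      P = ⟦ p ⟧ (length x)

      fetched : Store → Stack → Store
      fetched φ s' = (φ [ rA ↦ code zero (hd (map (sym M) x)) ∷ [] ]) [ rR ↦ s' ]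

      start : ∀ φ s' → Loaded x φ → Padded P (tl (map (sym M) x)) s' → Sim P (initial M x) (fetched φ s')
      start φ s' loaded padR = subst (λ c → Sim P c (fetched φ s')) (≡-sym (initial-hd x))
        (sim refl (suc P , n≤1+n _ , Loaded.left loaded) padR
          (Loaded.empty loaded rF 2≤ (λ ()) (λ ())) (Loaded.empty loaded rO 2≤ (λ ()) (λ ())))

      input : ∀ φ s' → Loaded x φ → fetched φ s' inR ≡ map toℕ x
      input φ s' loaded = trans (update-other (φ [ rA ↦ _ ]) s' (in≢work 2≤))
        (trans (update-other φ _ (in≢work 2≤)) (Loaded.input loaded))

    ok-simulate : ∀ {P Q : Reg → Set} → P inR → Q inR → (∀ y → 2 ≤ y → P y) → Ok P Q simulateB
    ok-simulate pin qin pw = ok-⨾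
      (ok-⨾ (ok-clock padP pin qin (work≢in 2≤ ∷ []) (ok-atom (pw rL 2≤)))
        (ok-⨾ (ok-clock padP pin qin (work≢in 2≤ ∷ []) (ok-atom (pw rR 2≤)))
          (ok-ROF k pin qin (λ _ → ok-atom (pw rR 2≤)) (λ _ → ok-atom (work≢in 2≤)))))
      (ok-⨾ (ok-fetch zero rR (λ ()) (pw rA 2≤) (pw rR 2≤))
        (ok-⨾ (ok-clock p pin qin step-written (ok-step (pw rA 2≤) (pw rL 2≤) (pw rR 2≤) (pw rH 2≤)))
          (ok-⨾ (ok-unfetch (pw rA 2≤) (pw rR 2≤)) (ok-atom (pw rF 2≤)))))

    simulate-written : All (_≢ inR) (writtenB simulateB)
    simulate-written =
      All-++⁺ (All-++⁺ (clock-written inR padP (atom (PUSH 0 rL)) (work≢in 2≤ ∷ []))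
                (All-++⁺ (clock-written inR padP (atom (PUSH 0 rR)) (work≢in 2≤ ∷ []))
                  (RegsC-written (clauses k _)
                    (proj₁ (ok-clauses {Q = All-regs} k (λ a → ok-atom {a = PUSH (toℕ (sym M a)) rR} (work≢in 2≤)))))))
      (All-++⁺ (RegsB-written (fetch zero rR) (Ok.regs (ok-fetch {Q = All-regs} zero rR (λ ()) (work≢in 2≤) (work≢in 2≤))))
      (All-++⁺ (clock-written inR p stepB step-written)
      (All-++⁺ (RegsB-written unfetch (Ok.regs (ok-unfetch {Q = All-regs} (work≢in 2≤) (work≢in 2≤))))
        (work≢in {rF} 2≤ ∷ []))))

  -- Letters are emitted until the first non-letter puts 1 on top of the flag.
  emit : Maybe (Fin k) → Body
  emit (just a) = IF rF 0 (atom (PUSH (toℕ a) rO))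
  emit nothing  = atom (PUSH 1 rF)

  emitC : Clauses
  emitC = clauses nG (λ g → emit (unsym M g))

  outputB : Body
  outputB = FOR rR emitC

  ok-emit : ∀ {P Q : Reg → Set} m → P rF → P rO → Ok P Q (emit m)
  ok-emit (just a) pF pO = ok-IF pF (λ { (here ()) }) (ok-atom pO)
  ok-emit nothing pF pO = ok-atom pF

  ok-output : ∀ {P Q : Reg → Set} → P rR → P rF → P rO → Q rR → Ok P Q outputB
  ok-output pR pF pO qR = ok-FOR nG pR qR (λ g → ok-emit (unsym M g) pF pO) (λ g → ok-emit (unsym M g) (λ ()) (λ ()))

  -- Further non-letters pile more 1s on the flag, so only its top is kept as an invariant.
  emit-stopped : ∀ m {φ s} → φ rF ≡ 1 ∷ s → ∃[ φ' ] ∃[ s' ]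
    (evalB (emit m) (φ , 0) ≡ (φ' , 0) × φ' rF ≡ 1 ∷ s' × φ' rO ≡ φ rO)
  emit-stopped (just a) {φ} {s} e =
    φ , s , evalB-IF-no {s = atom (PUSH (toℕ a) rO)} {φ , 0} (λ e' → contradiction (trans (≡-sym (cong top e)) e') λ ()) , e , refl
  emit-stopped nothing {φ} e = _ , _ , refl , refl , refl

  loop-stopped : ∀ gs {φ s} → φ rF ≡ 1 ∷ s → ∃[ φ' ]
    (loop (evalC emitC) (map toℕ gs) (φ , 0) ≡ (φ' , 0) × φ' rO ≡ φ rO)
  loop-stopped [] e = _ , refl , refl
  loop-stopped (g ∷ gs) {φ} e =
    case emit-stopped (unsym M g) {φ} e of λ { (φ₁ , s₁ , eq₁ , e₁ , o₁) →
    case loop-stopped gs {φ₁} e₁ of λ { (φ₂ , eq₂ , o₂) →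
    φ₂ , trans (cong (loop (evalC emitC) (map toℕ gs)) (trans (evalC-clauses nG (λ g → emit (unsym M g)) g (φ , 0)) eq₁)) eq₂ , trans o₂ o₁ }}

  readOut-step : Maybe (Fin k) → List (Fin nG) → List (Fin k)
  readOut-step (just a) gs = a ∷ readOut M gs
  readOut-step nothing  gs = []

  readOut-∷ : ∀ g gs → readOut M (g ∷ gs) ≡ readOut-step (unsym M g) gs
  readOut-∷ g gs with unsym M g
  ... | just _  = refl
  ... | nothing = refl

  loop-emit : ∀ gs {φ s} → φ rF ≡ 0 ∷ s → ∃[ φ' ]
    (loop (evalC emitC) (map toℕ gs) (φ , 0) ≡ (φ' , 0) × φ' rO ≡ map toℕ (readOut M gs) ʳ++ φ rO)
  loop-emit [] e = _ , refl , refl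
  loop-emit (g ∷ gs) {φ} {s} e =
    case go (unsym M g) of λ { (φ' , eq , o) →
    φ' , trans (cong (loop (evalC emitC) (map toℕ gs)) (evalC-clauses nG (λ g → emit (unsym M g)) g (φ , 0))) eq ,
    trans o (cong (λ y → map toℕ y ʳ++ φ rO) (≡-sym (readOut-∷ g gs))) }
    where
    go : ∀ m → ∃[ φ' ] (loop (evalC emitC) (map toℕ gs) (evalB (emit m) (φ , 0)) ≡ (φ' , 0)
                        × φ' rO ≡ map toℕ (readOut-step m gs) ʳ++ φ rO)
    go nothing = loop-stopped gs {φ [ rF ↦ 1 ∷ φ rF ]} refl
    go (just a) =
      case loop-emit gs {φ [ rO ↦ toℕ a ∷ φ rO ]} e of λ { (φ' , eq , o) →
      φ' , trans (cong (loop (evalC emitC) (map toℕ gs)) (evalB-IF-yes {s = atom (PUSH (toℕ a) rO)} {φ , 0} (cong top e))) eq , o }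

  readOut-blanks : ∀ a → readOut M (replicate a zero) ≡ []
  readOut-blanks zero = refl
  readOut-blanks (suc a) = refl

  -- The padding consists of blanks, and reading stops at the first blank in any case.
  readOut-padded : ∀ gs a → readOut M (gs ++ replicate a zero) ≡ readOut M gs
  readOut-padded [] a = readOut-blanks a
  readOut-padded (g ∷ gs) a with unsym M g
  ... | just b  = cong (b ∷_) (readOut-padded gs a)
  ... | nothing = refl

-- Compute, copy, uncompute

RegsT-written : ∀ {P} t → RegsT P t → All P (writtenT t)
RegsT-written (atom a) r = RegsB-written (atom a) r
RegsT-written (t ⨾ u) (r , r') = All-++⁺ (RegsT-written t r) (RegsT-written u r')
RegsT-written (IF x n t) (_ , r) = RegsT-written t r
RegsT-written (NORMAL N s) r = RegsB-written s r

-- Bennett's trick: run t, copy its result to the fresh register o, undo t.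
uncompute : ∀ t u {o φ φ₁ φ₂ s} → ForNo t → RegsT (_≢ o) t →
  (t , (φ , 0)) ⇓ (φ₁ , 0) → (u , (φ₁ , 0)) ⇓ (φ₂ , 0) →
  (∀ y → y ≢ o → φ₂ y ≡ φ₁ y) → φ₂ o ≡ s →
  evalT ((t ⨾ u) ⨾ invT t) (φ , 0) ≈ (φ [ o ↦ s ] , 0)
uncompute t u {o} {φ} {φ₁} {φ₂} {s} fn regs d₁ d₂ else₂ out₂ rewrite evalT-unique d₁ | evalT-unique d₂ =
  (λ y _ → by-cases y (y ≟ o)) , proj₂ undone
  where
  -- `invT t` does not mention `o`, so outside `o` it acts on `φ₂` as on `φ₁`, where it is known to
  -- lead back to `φ`.
  undone : evalT (invT t) (φ₂ , 0) ≈[ _≢ o ] (φ , 0)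
  undone = ≈-trans {ω' = evalT (invT t) (φ₁ , 0)}
    (evalT-cong (invT t) (RegsT-inv t regs) (else₂ , refl))
    (≈-weaken {P = All-regs} (λ _ _ → tt)
      (subst (λ ω → evalT (invT t) ω ≈ (φ , 0)) (evalT-unique d₁) (evalT-inv t (φ , 0) fn)))

  kept : proj₁ (evalT (invT t) (φ₂ , 0)) o ≡ φ₂ o
  kept = evalT-unwritten (invT t) (φ₂ , 0)
    (λ o∈ → All⇒∉ (RegsT-written t regs) (λ ¬p → ¬p refl) (writtenT-inv t o∈))

  by-cases : ∀ y → Dec (y ≡ o) → proj₁ (evalT (invT t) (φ₂ , 0)) y ≡ (φ [ o ↦ s ]) y
  by-cases y (yes refl) = trans kept (trans out₂ (≡-sym (update-same φ o s)))
  by-cases y (no y≢) = trans (proj₁ undone y y≢) (≡-sym (update-other φ s y≢))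

module Compute {k : ℕ} {f : List (Fin k) → List (Fin k)} (M : TM k) (p : Poly)
  (computes : ∀ x → run M (⟦ p ⟧ (length x)) (initial M x) ≡ just (f x))
  (inR outR : Reg) (inR<2 : inR < 2) (outR<2 : outR < 2) (in≢out : inR ≢ outR) where
  open Simulation M

  -- Simulation and output need separate blocks: `rR` is written in the first and leads the loop of
  -- the second. For the same reason the copy led by `rO` gets a block of its own.
  workT : Term
  workT = NORMAL (inR ∷⁺ []) (simulateB inR inR<2 p) ⨾ NORMAL (rR ∷⁺ []) outputB

  copyC : Clauses
  copyC = clauses k (λ a → atom (PUSH (toℕ a) outR))

  -- `rO` holds the output reversed, so pushing its symbols from the top down restores the order.
  copyB : Body
  copyB = FOR rO copyC

  computeT : Term
  computeT = (workT ⨾ NORMAL (rO ∷⁺ []) copyB) ⨾ invT workT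

  work≢out : ∀ {y} → 2 ≤ y → y ≢ outR
  work≢out le refl = <⇒≱ outR<2 le

  2≤ᵒ : ∀ {n} → 2 ≤ suc (suc n)
  2≤ᵒ = s≤s (s≤s z≤n)

  ok-simulate-out : Ok (_≢ outR) (_∈ inR ∷ []) (simulateB inR inR<2 p)
  ok-simulate-out = ok-simulate inR inR<2 p in≢out (here refl) (λ y le → work≢out le)

  ok-output-out : Ok (_≢ outR) (_∈ rR ∷ []) outputB
  ok-output-out = ok-output (work≢out 2≤ᵒ) (work≢out 2≤ᵒ) (work≢out 2≤ᵒ) (here refl)

  ok-copy : Ok All-regs (_∈ rO ∷ []) copyB
  ok-copy = ok-FOR k tt (here refl) (λ _ → ok-atom tt) (λ _ → ok-atom (≢-sym (work≢out 2≤ᵒ)))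

  ForNo-NORMAL : ∀ {P x s} → Ok P (_∈ x ∷ []) s → x ∉ writtenB s → ForNo (NORMAL (x ∷⁺ []) s)
  ForNo-NORMAL (ok _ l w) x∉ = (x∉ ∷ []) , l , w

  workT-ForNo : ForNo workT
  workT-ForNo =
    ForNo-NORMAL ok-simulate-out (All⇒∉ (simulate-written inR inR<2 p) (λ ¬p → ¬p refl)) ,
    ForNo-NORMAL ok-output-out (proj₁ (Ok.wf ok-output-out))

  computeT-ForNo : ForNo computeT
  computeT-ForNo = (workT-ForNo , ForNo-NORMAL ok-copy (proj₁ (Ok.wf ok-copy))) , ForNo-inv workT workT-ForNo

  workT-regs : RegsT (_≢ outR) workT
  workT-regs = Ok.regs ok-simulate-out , Ok.regs ok-output-out

  workT-eval : ∀ x {φ} → φ inR ≡ map toℕ x → (∀ z → 2 ≤ z → φ z ≡ []) →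
    ∃[ φ' ] ((workT , (φ , 0)) ⇓ (φ' , 0) × φ' rO ≡ map toℕ (f x) ʳ++ [])
  workT-eval x {φ} eIn empty =
    case simulate-eval inR inR<2 p x φ eIn empty (computes x) of λ { (φ₁ , gs , a , d₁ , eR , out , eF , eO) →
    case loop-emit (gs ++ replicate a zero) eF of λ { (φ₂ , eq₂ , o) →
    φ₂ ,
    seq (normal d₁) (normal (loop≡⇒FOR rR emitC (φ₁ , 0)
      (trans eR (≡-sym (trans (map-++ toℕ gs (replicate a zero)) (cong (map toℕ gs ++_) (map-replicate toℕ a zero)))))
      eq₂)) ,
    trans o (cong₂ (λ y s → map toℕ y ʳ++ s) (trans (readOut-padded gs a) out) eO) }}

  computeT-eval : ∀ x {φ} → φ inR ≡ map toℕ x → (∀ z → z ≢ inR → φ z ≡ []) →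
    evalT computeT (φ , 0) ≈ (φ [ outR ↦ map toℕ (f x) ] , 0)
  computeT-eval x {φ} eIn empty =
    case workT-eval x {φ} eIn (λ z le → empty z (work≢in inR inR<2 p le)) of λ { (φ₁ , d₁ , o₁) →
    case loop-PUSH k toℕ outR (reverse (f x)) φ₁ of λ { (φ₂ , eq₂ , changed at₂ else₂) →
    uncompute workT (NORMAL (rO ∷⁺ []) copyB) workT-ForNo workT-regs d₁
      (normal (loop≡⇒FOR rO copyC (φ₁ , 0) (trans o₁ (≡-sym (reverse-map toℕ (f x)))) eq₂))
      else₂ (out₂ at₂ (unwritten workT d₁ (All⇒∉ (RegsT-written workT workT-regs) (λ ¬p → ¬p refl)) (empty outR (≢-sym in≢out)))) }}
    where
    unwritten : ∀ t {φ₁ y s} → (t , (φ , 0)) ⇓ (φ₁ , 0) → y ∉ writtenT t → φ y ≡ s → φ₁ y ≡ s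
    unwritten t {y = y} d y∉ e = trans (cong (λ ω → proj₁ ω y) (≡-sym (evalT-unique d)))
      (trans (evalT-unwritten t (φ , 0) y∉) e)

    out₂ : ∀ {s₁ s₂} → s₂ ≡ map toℕ (reverse (f x)) ʳ++ s₁ → s₁ ≡ [] → s₂ ≡ map toℕ (f x)
    out₂ at₂ e = trans at₂ (trans (ʳ++-defn (map toℕ (reverse (f x))))
      (trans (cong₂ _++_ (trans (cong reverse (reverse-map toℕ (f x))) (reverse-involutive (map toℕ (f x)))) e)
        (++-identityʳ _)))

-- Assembling the two directions

only : Reg → Stack → State
only x s = ∅ [ x ↦ s ] , 0

update-comm : ∀ φ {x y} s s' → x ≢ y → ∀ z → ((φ [ x ↦ s ]) [ y ↦ s' ]) z ≡ ((φ [ y ↦ s' ]) [ x ↦ s ]) z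
update-comm φ {x} {y} s s' x≢y z with z ≟ y in eqy | z ≟ x in eqx
... | yes refl | yes refl with () ← x≢y refl
... | yes refl | no _ rewrite eqy = refl
... | no _ | yes refl rewrite eqx = refl
... | no _ | no _ rewrite eqx | eqy = refl

-- t maps (x, []) to (x, f x) in the registers (i, o).
Computes : ∀ {k} → (List (Fin k) → List (Fin k)) → Reg → Reg → Term → Set
Computes f i o t = ∀ x →
  evalT t (∅ [ i ↦ map toℕ x ] , 0) ≈ ((∅ [ i ↦ map toℕ x ]) [ o ↦ map toℕ (f x) ] , 0)

FPTIME⇒Computes : ∀ {k} {f : List (Fin k) → List (Fin k)} → FPTIME f →
  ∀ i o → i < 2 → o < 2 → i ≢ o → ∃[ t ] (ForNo t × Computes f i o t)
FPTIME⇒Computes {f = f} (M , p , runs) i o i<2 o<2 i≢o = computeT , computeT-ForNo , computes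
  where
  open Compute {f = f} M p runs i o i<2 o<2 i≢o

  computes : ∀ x →
    evalT computeT (∅ [ i ↦ map toℕ x ] , 0) ≈ ((∅ [ i ↦ map toℕ x ]) [ o ↦ map toℕ (f x) ] , 0)
  computes x = computeT-eval x {∅ [ i ↦ map toℕ x ]} (update-same ∅ i _) (λ z z≢ → update-other ∅ _ z≢)

Computes⇒ZG : ∀ {k} (f : List (Fin k) ↔ List (Fin k)) →
  ∃[ t ] (ForNo t × Computes (Inverse.to f) 0 1 t) →
  ∃[ u ] (ForNo u × Computes (Inverse.from f) 1 0 u) → ForNoComputesZG (Inverse.to f)
Computes⇒ZG {k} f (t , fn-t , t-computes) (u , fn-u , u-computes) =
  v , (fn-t , ForNo-inv u fn-u) , 0 , 1 , ↔-id (Fin k) , λ x →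
  proj₁ (evalT v (input x)) ,
  subst (λ c → (v , input x) ⇓ (proj₁ (evalT v (input x)) , c)) (proj₂ (correct x)) (⇓-evalT v (input x)) ,
  proj₁ (correct x) 1 tt ,
  λ y y≢ → trans (proj₁ (correct x) y tt) (update-other ∅ _ y≢)
  where
  to = Inverse.to f

  v : Term
  v = t ⨾ invT u

  input output' : List (Fin k) → State
  input x = only 0 (map toℕ x)
  output' x = only 1 (map toℕ (to x))

  -- Both t and u lead to the state holding x in register 0 and f x in register 1.
  meet : ∀ x → evalT t (input x) ≈ evalT u (output' x)
  meet x = ≈-trans {ω' = (∅ [ 0 ↦ map toℕ x ]) [ 1 ↦ map toℕ (to x) ] , 0} (t-computes x)
    (≈-trans {ω' = (∅ [ 1 ↦ map toℕ (to x) ]) [ 0 ↦ map toℕ x ] , 0}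
      ((λ z _ → update-comm ∅ (map toℕ x) (map toℕ (to x)) (λ ()) z) , refl)
      (≈-sym {ω = evalT u (output' x)}
        (subst (λ x' → evalT u (output' x) ≈ ((∅ [ 1 ↦ map toℕ (to x) ]) [ 0 ↦ map toℕ x' ] , 0))
          (Inverse.strictlyInverseʳ f x) (u-computes (to x)))))

  correct : ∀ x → evalT v (input x) ≈ output' x
  correct x = ≈-trans {ω' = evalT (invT u) (evalT u (output' x))}
    (evalT-≈ (invT u) {evalT t (input x)} (meet x)) (evalT-inv u (output' x) fn-u)

FPTIME⇒forNo : ∀ {k} (f : List (Fin k) ↔ List (Fin k)) →
  FPTIME (Inverse.to f) → FPTIME (Inverse.from f) → ForNoComputesZG (Inverse.to f)
FPTIME⇒forNo f fptime fptime⁻¹ = Computes⇒ZG f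
  (FPTIME⇒Computes fptime 0 1 (s≤s z≤n) (s≤s (s≤s z≤n)) (λ ()))
  (FPTIME⇒Computes fptime⁻¹ 1 0 (s≤s (s≤s z≤n)) (s≤s z≤n) (λ ()))

forNo⇒TwoWay : ∀ {k} (f : List (Fin k) ↔ List (Fin k)) → ForNoComputesZG (Inverse.to f) → TwoWay f
forNo⇒TwoWay {k} f (t , fn , inR , outR , π , computes) =
  -- Honesty of each direction comes from the machine for the other one.
  honest from (λ x → Inverse.strictlyInverseʳ f x) fptime⁻¹ , fptime ,
  honest to (λ y → Inverse.strictlyInverseˡ f y) fptime , fptime⁻¹
  where
  to = Inverse.to f
  from = Inverse.from f

  evaluates : ∀ x → evalT t (only inR (encode π x)) ≈ only outR (encode π (to x))
  evaluates x with computes x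
  ... | φ , d , out , zero-garbage rewrite evalT-unique d =
    (λ y _ → final y) , refl
    where
    final : ∀ y → φ y ≡ (∅ [ outR ↦ encode π (to x) ]) y
    final y with y ≟ outR
    ... | yes refl = out
    ... | no y≢ = zero-garbage y y≢

  -- Zero garbage fixes the whole final store in terms of the output. Hence a store holding `y` in
  -- `outR` alone is the end of a run of `t`, and the inverse term can start from it.
  evaluates⁻¹ : ∀ y → evalT (invT t) (only outR (encode π y)) ≈ only inR (encode π (from y))
  evaluates⁻¹ y = ≈-trans {ω' = evalT (invT t) (evalT t (only inR (encode π (from y))))}
    (evalT-≈ (invT t) {only outR (encode π y)} (≈-sym {ω = evalT t (only inR (encode π (from y)))}
      (subst (λ z → evalT t (only inR (encode π (from y))) ≈ only outR (encode π z))
        (Inverse.strictlyInverseˡ f y) (evaluates (from y)))))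
    (evalT-inv t (only inR (encode π (from y))) fn)

  fptime : FPTIME to
  fptime = forNo⇒FPTIME t inR outR π fn evaluates

  fptime⁻¹ : FPTIME from
  fptime⁻¹ = forNo⇒FPTIME (invT t) outR inR π (ForNo-inv t fn) evaluates⁻¹

  honest : ∀ {g : List (Fin k) → List (Fin k)} h → (∀ x → h (g x) ≡ x) → FPTIME h → Honest g
  honest {g} h hg fp with FPTIME-length fp
  ... | q , bound = q , λ x → ≤-trans (≤-reflexive (cong length (≡-sym (hg x)))) (bound (g x))

theorem4 : (k : ℕ) (f : List (Fin k) ↔ List (Fin k)) →
    TwoWay f ⇔ ForNoComputesZG (Inverse.to f)
theorem4 k f = mk⇔
  (λ (_ , fptime , _ , fptime⁻¹) → FPTIME⇒forNo f fptime fptime⁻¹)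
  (forNo⇒TwoWay f)
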